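{- \textsc{Capacitated Vertex Cover} is NP-hard even when restricted to input graphs of linear clique-width at most $6$.
   Context: \textsc{Capacitated Vertex Cover}: the input is an undirected loopless graph $G=(V,E)$, a capacity function $c\colon V\to\mathbb{N}$, and an integer $k$; the question is whether there exists $S\subseteq V$ with $|S|\le k$ and an assignment of every edge to one of its endpoints lying in $S$ such that every $v\in S$ is assigned at most $c(v)$ incident edges. The linear clique-width of a graph is the minimum number of labels needed to construct it (up to forgetting labels) by a sequence of operations each of which is: introduce a new single vertex with a given label (added to the current graph), join all vertices of label $a$ to all vertices of label $b$ for $a\neq b$, or relabel all vertices of label $a$ to label $b$. -}

module Defs where

open import Data.Bool using (Bool; true; false; if_then_else_; _∨_; _∧_; not)
open import Data.Maybe using (Maybe; just; nothing)
open import Data.Nat using (ℕ; zero; suc; _+_; _*_; _^_; _≤_)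
open import Data.Nat.Binary using (ℕᵇ; 2[1+_]; 1+[2_]) renaming (zero to zeroᵇ; fromℕ to toBin)
open import Data.Fin using (Fin; _≟_) renaming (zero to fzero; suc to fsuc)
open import Data.List using (List; []; _∷_; _++_; length; concat; map; allFin)
open import Data.Nat.ListAction using (sum)
open import Data.Product using (Σ; ∃; _×_; _,_)
open import Function using (_∘_)
open import Function.Bundles using (_⇔_; _↔_; Inverse)
open import Relation.Binary.PropositionalEquality using (_≡_; _≢_)
open import Relation.Nullary using (does)

-- Machine model: deterministic single-tape Turing machines over the
-- tape alphabet {0,1,blank} (blank = nothing).

Symbol : Set
Symbol = Maybe Bool

data Move : Set where
  moveL moveR stay : Move

record TM : Set where
  field
    Q     : ℕ
    start : Fin Q
    halt  : Fin Q
    δ     : Fin Q → Symbol → Fin Q × Symbol × Move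

-- left part of the tape is stored reversed (nearest cell first);
-- cells beyond the stored lists are blank.
record Config (Q : ℕ) : Set where
  constructor conf
  field
    state : Fin Q
    left  : List Symbol
    head  : Symbol
    right : List Symbol

moveHead : ∀ {Q} → Fin Q → List Symbol → Symbol → List Symbol → Move → Config Q
moveHead q ls s rs stay          = conf q ls s rs
moveHead q []       s rs moveL   = conf q [] nothing (s ∷ rs)
moveHead q (l ∷ ls) s rs moveL   = conf q ls l (s ∷ rs)
moveHead q ls s []       moveR   = conf q (s ∷ ls) nothing []
moveHead q ls s (r ∷ rs) moveR   = conf q (s ∷ ls) r rs

step : (M : TM) → Config (TM.Q M) → Config (TM.Q M)
step M (conf q ls s rs) with does (q ≟ TM.halt M)
... | true  = conf q ls s rs
... | false with TM.δ M q s
...   | (q' , s' , m) = moveHead q' ls s' rs m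

run : (M : TM) → ℕ → Config (TM.Q M) → Config (TM.Q M)
run M zero    c = c
run M (suc t) c = run M t (step M c)

initConf : (M : TM) → List Bool → Config (TM.Q M)
initConf M []       = conf (TM.start M) [] nothing []
initConf M (b ∷ bs) = conf (TM.start M) [] (just b) (map just bs)

readOut : List Symbol → List Bool
readOut []             = []
readOut (nothing ∷ _)  = []
readOut (just b ∷ xs)  = b ∷ readOut xs

output : ∀ {Q} → Config Q → List Bool
output (conf _ _ s rs) = readOut (s ∷ rs)

RunsTo : TM → List Bool → ℕ → List Bool → Set
RunsTo M x t y =
  Config.state (run M t (initConf M x)) ≡ TM.halt M × output (run M t (initConf M x)) ≡ y

poly : ℕ → ℕ → ℕ → ℕ
poly a d n = a * n ^ d + a

PolyTimeComputable : (List Bool → List Bool) → Set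
PolyTimeComputable f =
  Σ TM λ M → Σ ℕ λ a → Σ ℕ λ d →
    ∀ x → Σ ℕ λ t → t ≤ poly a d (length x) × RunsTo M x t (f x)

PolyTimeDecidable : (List Bool → Set) → Set
PolyTimeDecidable V =
  Σ (List Bool → Bool) λ χ →
    PolyTimeComputable (λ y → χ y ∷ []) × (∀ y → V y ⇔ (χ y ≡ true))

pairEnc : List Bool → List Bool → List Bool
pairEnc []       w = false ∷ true ∷ w
pairEnc (b ∷ x)  w = b ∷ b ∷ pairEnc x w

InNP : (List Bool → Set) → Set₁
InNP L =
  Σ (List Bool → Set) λ V → PolyTimeDecidable V ×
    Σ ℕ λ a → Σ ℕ λ d →
      ∀ x → L x ⇔ (Σ (List Bool) λ w → length w ≤ poly a d (length x) × V (pairEnc x w))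

NPHardOn : (I : Set) → (I → List Bool) → (Yes : I → Set) → (Allowed : I → Set) → Set₁
NPHardOn I enc Yes Allowed =
  ∀ (L : List Bool → Set) → InNP L →
    Σ (List Bool → List Bool) λ f → PolyTimeComputable f ×
      (∀ x → Σ I λ y → f x ≡ enc y × Allowed y × (L x ⇔ Yes y))

record Graph : Set where
  field
    n   : ℕ
    adj : Fin n → Fin n → Bool
    sym : ∀ i j → adj i j ≡ adj j i
    irr : ∀ i → adj i i ≡ false

countTrue : ∀ {n} → (Fin n → Bool) → ℕ
countTrue {n} f = sum (map (λ i → if f i then 1 else 0) (allFin n))

record CVCInstance : Set where
  field
    G   : Graph
    cap : Fin (Graph.n G) → ℕ
    k   : ℕ

-- S ⊆ V given by its characteristic function; h i j = true means the
-- edge {i,j} is assigned to its endpoint i.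
CVCYes : CVCInstance → Set
CVCYes I =
  Σ (Fin n → Bool) λ S → Σ (Fin n → Fin n → Bool) λ h →
    countTrue S ≤ k ×
    (∀ i j → adj i j ≡ true → h i j ≡ not (h j i)) ×
    (∀ i j → adj i j ≡ true → h i j ≡ true → S i ≡ true) ×
    (∀ i → countTrue (λ j → adj i j ∧ h i j) ≤ cap i)
  where
    open CVCInstance I
    open Graph G

-- bijective base-2 digits of a natural number (length O(log n))
digits : ℕᵇ → List Bool
digits zeroᵇ     = []
digits 2[1+ x ]  = true ∷ digits x
digits 1+[2 x ]  = false ∷ digits x

selfDelim : List Bool → List Bool
selfDelim []      = false ∷ true ∷ []
selfDelim (b ∷ x) = b ∷ b ∷ selfDelim x

encℕ : ℕ → List Bool
encℕ m = selfDelim (digits (toBin m))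

encCVC : CVCInstance → List Bool
encCVC I =
  encℕ n ++ encℕ k ++ concat (map (encℕ ∘ cap) (allFin n))
    ++ concat (map (λ i → map (adj i) (allFin n)) (allFin n))
  where
    open CVCInstance I
    open Graph G

data Op (w : ℕ) : Set where
  intro   : Fin w → Op w
  join    : (a b : Fin w) → a ≢ b → Op w
  relabel : Fin w → Fin w → Op w

record LGraph (w : ℕ) : Set where
  constructor lgraph
  field
    m     : ℕ
    label : Fin m → Fin w
    ladj  : Fin m → Fin m → Bool

emptyLG : ∀ {w} → LGraph w
emptyLG = lgraph zero (λ ()) (λ ())

eqF : ∀ {w} → Fin w → Fin w → Bool
eqF a b = does (a ≟ b)

applyOp : ∀ {w} → Op w → LGraph w → LGraph w
applyOp (intro a) (lgraph m lab ad) = lgraph (suc m) lab' ad'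
  where
    lab' : Fin (suc m) → _
    lab' fzero    = a
    lab' (fsuc u) = lab u
    ad' : Fin (suc m) → Fin (suc m) → Bool
    ad' (fsuc u) (fsuc v) = ad u v
    ad' _        _        = false
applyOp (join a b _) (lgraph m lab ad) =
  lgraph m lab (λ u v → ad u v ∨ (eqF (lab u) a ∧ eqF (lab v) b) ∨ (eqF (lab u) b ∧ eqF (lab v) a))
applyOp (relabel a b) (lgraph m lab ad) =
  lgraph m (λ u → if eqF (lab u) a then b else lab u) ad

evalOps : ∀ {w} → List (Op w) → LGraph w → LGraph w
evalOps []         g = g
evalOps (o ∷ os)   g = evalOps os (applyOp o g)

IsoTo : ∀ {w} → Graph → LGraph w → Set
IsoTo G H = Σ (Fin (Graph.n G) ↔ Fin (LGraph.m H)) λ σ →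
  ∀ i j → Graph.adj G i j ≡ LGraph.ladj H (Inverse.to σ i) (Inverse.to σ j)

LinCWAtMost : ℕ → Graph → Set
LinCWAtMost w G = Σ (List (Op w)) λ ops → IsoTo G (evalOps ops emptyLG)

{-# OPTIONS --safe #-}

-- Every language in NP is reduced directly, by the tableau of the verifier.  Shifting row t by t cells makes the
-- symbol at place p + w (w the row width) a function of those at p, p + 1, p + 2, so that the tableau is a single
-- string, described by clauses of at most four literals whose variables are tied to the clause by fixed offsets.
--
-- In the graph, all slots (occurrences of variables in clauses, two vertices each) are completely joined to all
-- columns (two vertices for each clause), and this is what keeps the linear clique-width small: the gadgets of the
-- variables can be introduced one at a time, with only the two literal vertices of the current one having labels of
-- their own.  The clauses are encoded in the capacities alone.  The budget forces all slot vertices and columns, and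
-- one literal vertex for each variable, into the cover.  A slot vertex whose literal vertex is left out has to take
-- one more edge.  The capacity of a slot of clause i is about 2 i, which lets it take its edges to the columns of the
-- earlier clauses; comparing the total capacity of the slots and the columns up to each clause with the number of
-- edges between them shows that all bounds are tight, so that the first column of a clause can serve all the slots
-- left to it exactly if one of the literals of the clause is true.
--
-- The instance has so regular a structure that its encoding is written by nested loops over counters of polynomial
-- size, given in a language of stack programs that is compiled to Turing machines with bounds on the running time.

module Submission where

open import Data.Bool using (Bool; true; false; if_then_else_; _∨_; _∧_; not; T)
open import Data.Bool.Properties using (∨-comm; ∧-comm; ∨-identityʳ; ∧-zeroʳ; not-involutive)
open import Data.Maybe using (Maybe; just; nothing)
open import Data.Nat using (ℕ; zero; suc; _+_; _*_; _^_; _∸_; _≤_; _<_; z≤n; s≤s; s≤s⁻¹; _≡ᵇ_; _/_; _%_)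
open import Data.Nat.Properties
open import Data.Nat.DivMod using (m<n⇒m%n≡m; [m+kn]%n≡m%n; m*n/n≡m; m<n⇒m/n≡0; +-distrib-/-∣ʳ; m≡m%n+[m/n]*n; m%n<n; m<n*o⇒m/o<n)
open import Data.Nat.Divisibility using (divides)
open import Data.Nat.ListAction using (sum)
open import Data.Nat.Tactic.RingSolver using (solve-∀)
open import Tactic.MonoidSolver using (solve)
open import Data.Nat.Binary using (2[1+_]; 1+[2_]) renaming (zero to zeroᵇ; suc to sucᵇ; fromℕ to toBin)
open import Data.Nat.Binary.Properties using (fromℕ≡fromℕ')
open import Data.Integer using (ℤ; +_; -[1+_])
import Data.Integer as ℤ
import Data.Integer.Properties as ℤₚ
import Algebra.Properties.AbelianGroup ℤₚ.+-0-abelianGroup as ℤGroup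
open import Data.Fin using (Fin; zero; suc; toℕ; combine; remQuot; splitAt)
import Data.Fin as Fin
import Data.Fin.Properties as Finₚ
open import Data.List using (List; []; _∷_; _++_; length; concat; map; allFin; tabulate; replicate; _ʳ++_; cartesianProduct)
import Data.List as List
import Data.List.Properties as Listₚ
open import Data.List.Membership.Propositional using (_∈_)
import Data.List.Membership.Propositional.Properties as ∈ₚ
open import Data.List.Relation.Unary.Any using (here; there; index)
import Data.List.Relation.Unary.Any.Properties as Anyₚ
open import Data.List.Relation.Unary.All using (All; []; _∷_)
import Data.List.Relation.Unary.All as All
open import Data.List.Relation.Unary.AllPairs using ([]; _∷_)
open import Data.List.Relation.Unary.Unique.Propositional using (Unique)
import Data.List.Relation.Unary.Unique.Propositional.Properties as Uniqueₚ
open import Data.Vec using (Vec; []; _∷_; _[_]≔_; lookup)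
import Data.Vec as Vec
import Data.Vec.Properties as Vecₚ
open import Data.Product using (Σ; Σ-syntax; _×_; _,_; proj₁; proj₂)
import Data.Product.Properties as Productₚ
import Data.Maybe.Properties as Maybeₚ
import Data.Bool as Bool
open import Data.Sum using (_⊎_; inj₁; inj₂; [_,_]′)
import Data.Sum as Sum
open import Data.Empty using (⊥; ⊥-elim)
open import Data.Unit using (⊤; tt)
open import Function using (_∘_; id)
open import Function.Bundles using (_⇔_; mk⇔; Equivalence; mk↔ₛ′)
open import Relation.Nullary using (Dec; yes; no; ¬_; does; contradiction)
open import Relation.Nullary.Decidable using (dec-true; dec-false)
open import Relation.Binary.PropositionalEquality hiding ([_]; J)
open import Relation.Binary using (tri<; tri≈; tri>)
open import Defs

-- Tape programs and Turing machines

-- Exactly one literal vertex of each variable is left out, so a pair of slot vertices carries one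
-- extra edge whatever the value of the variable: besides it and the two edges to `columnHub`, the
-- pair has room for `4 * i + 2` column edges in either case. Truth can only show in the way this
-- room is split. For a true literal both vertices have `2 * i + 1`; for a false one the split is
-- `2 * i` against `2 * i + 2`. Only `2 * i + 1` columns lie up to the first column of clause `i`,
-- so a false literal wastes one unit there. The second column of the clause makes up for this
-- difference and keeps the balance of the later clauses undisturbed: an active clause merely has
-- one unit of capacity moved from its first column to its second. The hubs, of capacities 0 and 1,
-- are what makes every slot vertex and every column enter the cover. Giving each position of the
-- tableau a clause of every kind makes the number of edges left to a column a closed formula, and
-- an unwanted clause is switched off by keeping both its columns at equal capacity.

sucℤ predℤ : ℤ → ℤ
sucℤ (+ n)            = + suc n
sucℤ -[1+ zero ]      = + 0
sucℤ -[1+ suc n ]     = -[1+ n ]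
predℤ (+ zero)        = -[1+ 0 ]
predℤ (+ suc n)       = + n
predℤ -[1+ n ]        = -[1+ suc n ]

sucℤ-predℤ : ∀ z → sucℤ (predℤ z) ≡ z
sucℤ-predℤ (+ zero)   = refl
sucℤ-predℤ (+ suc n)  = refl
sucℤ-predℤ -[1+ n ]   = refl

predℤ-sucℤ : ∀ z → predℤ (sucℤ z) ≡ z
predℤ-sucℤ (+ n)          = refl
predℤ-sucℤ -[1+ zero ]    = refl
predℤ-sucℤ -[1+ suc n ]   = refl

-- The recursion moves the starting point, so that the cells seen after a head move are by
-- definition those seen before with a shifted index.
rightOf leftOf : ℕ → ℤ → ℤ
rightOf zero    z = z
rightOf (suc n) z = rightOf n (sucℤ z)
leftOf zero     z = z
leftOf (suc n)  z = leftOf n (predℤ z)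

sucℤ-+ : ∀ z → sucℤ z ≡ + 1 ℤ.+ z
sucℤ-+ (+ n)          = refl
sucℤ-+ -[1+ zero ]    = refl
sucℤ-+ -[1+ suc n ]   = refl

rightOf-+ : ∀ n z → rightOf n z ≡ + n ℤ.+ z
rightOf-+ zero    z = sym (ℤₚ.+-identityˡ z)
rightOf-+ (suc n) z = trans (rightOf-+ n (sucℤ z)) (trans (cong (ℤ._+_ (+ n)) (sucℤ-+ z))
  (trans (sym (ℤₚ.+-assoc (+ n) (+ 1) z)) (cong (λ k → + k ℤ.+ z) (+-comm n 1))))

rightOf-≢ : ∀ n z → rightOf n (sucℤ z) ≢ z
rightOf-≢ n z eq = absurd (ℤGroup.∙-cancelʳ z (+ suc n) (+ 0)
  (trans (sym (rightOf-+ (suc n) z)) (trans eq (sym (ℤₚ.+-identityˡ z)))))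
  where
  absurd : + suc n ≡ + 0 → ⊥
  absurd ()

rightOf-sucℤ : ∀ n z → rightOf n (sucℤ z) ≡ sucℤ (rightOf n z)
rightOf-sucℤ zero    z = refl
rightOf-sucℤ (suc n) z = rightOf-sucℤ n (sucℤ z)

rightOf-leftOf : ∀ n z → rightOf n (leftOf n z) ≡ z
rightOf-leftOf zero    z = refl
rightOf-leftOf (suc n) z = trans (rightOf-sucℤ n (leftOf n (predℤ z)))
  (trans (cong sucℤ (rightOf-leftOf n (predℤ z))) (sucℤ-predℤ z))

leftOf-≢ : ∀ n z → leftOf n (predℤ z) ≢ z
leftOf-≢ n z eq = rightOf-≢ n z (trans (cong (rightOf (suc n)) (sym eq)) (rightOf-leftOf (suc n) z))

Tape : Set
Tape = ℤ → Symbol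

write : Tape → ℤ → Symbol → Tape
write c h s z = if does (z ℤ.≟ h) then s else c z

write-same : ∀ c h s → write c h s h ≡ s
write-same c h s rewrite dec-true (h ℤ.≟ h) refl = refl

write-other : ∀ c h s {z} → z ≢ h → write c h s z ≡ c z
write-other c h s {z} z≢h rewrite dec-false (z ℤ.≟ h) z≢h = refl

shift : Move → ℤ → ℤ
shift moveL = predℤ
shift moveR = sucℤ
shift stay  = id

nth : List Symbol → ℕ → Symbol
nth []       _       = nothing
nth (x ∷ xs) zero    = x
nth (x ∷ xs) (suc n) = nth xs n

-- The configuration shows the tape c around the head position h.
record Shows {Q : ℕ} (k : Config Q) (h : ℤ) (c : Tape) : Set where
  constructor shows
  open Config k
  field
    at-head  : c h ≡ head
    at-right : ∀ i → c (rightOf i (sucℤ h)) ≡ nth right i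
    at-left  : ∀ i → c (leftOf i (predℤ h)) ≡ nth left i

shows-write : ∀ {Q} {q q′ : Fin Q} {ls s rs h c} s′ →
  Shows (conf q ls s rs) h c → Shows (conf q′ ls s′ rs) h (write c h s′)
shows-write {h = h} {c} s′ (shows _ r l) = shows (write-same c h s′)
  (λ i → trans (write-other c h s′ (rightOf-≢ i h)) (r i))
  (λ i → trans (write-other c h s′ (leftOf-≢ i h)) (l i))

shows-move : ∀ {Q} {q q′ : Fin Q} {ls s rs h c} m →
  Shows (conf q ls s rs) h c → Shows (moveHead q′ ls s rs m) (shift m h) c
shows-move stay (shows a r l) = shows a r l
shows-move {ls = []} {h = h} {c} moveL (shows a r l) = shows (l 0)
  (λ { zero → trans (cong c (sucℤ-predℤ h)) a
     ; (suc i) → trans (cong (c ∘ rightOf i ∘ sucℤ) (sucℤ-predℤ h)) (r i) }) (λ i → l (suc i))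
shows-move {ls = _ ∷ ls} {h = h} {c} moveL (shows a r l) = shows (l 0)
  (λ { zero → trans (cong c (sucℤ-predℤ h)) a
     ; (suc i) → trans (cong (c ∘ rightOf i ∘ sucℤ) (sucℤ-predℤ h)) (r i) }) (λ i → l (suc i))
shows-move {rs = []} {h = h} {c} moveR (shows a r l) = shows (r 0) (λ i → r (suc i))
  (λ { zero → trans (cong c (predℤ-sucℤ h)) a
     ; (suc i) → trans (cong (c ∘ leftOf i ∘ predℤ) (predℤ-sucℤ h)) (l i) })
shows-move {rs = _ ∷ rs} {h = h} {c} moveR (shows a r l) = shows (r 0) (λ i → r (suc i))
  (λ { zero → trans (cong c (predℤ-sucℤ h)) a
     ; (suc i) → trans (cong (c ∘ leftOf i ∘ predℤ) (predℤ-sucℤ h)) (l i) })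

moveHead-state : ∀ {Q} (q : Fin Q) ls s rs m → Config.state (moveHead q ls s rs m) ≡ q
moveHead-state q ls       s rs       stay  = refl
moveHead-state q []       s rs       moveL = refl
moveHead-state q (_ ∷ _)  s rs       moveL = refl
moveHead-state q ls       s []       moveR = refl
moveHead-state q ls       s (_ ∷ _)  moveR = refl

infixr 5 _⨾_

data TapeProg : Set where
  wr   : Symbol → TapeProg
  mv   : Move → TapeProg
  _⨾_  : TapeProg → TapeProg → TapeProg
  cond : (blank zero one : TapeProg) → TapeProg
  loop : (Symbol → Bool) → TapeProg → TapeProg

-- States are places in the syntax tree, so the states of a subprogram embed by constructors alone;
-- numbers are attached only at the end, by `numbering`.
State : TapeProg → Set
State (wr _)       = ⊤
State (mv _)       = ⊤
State (p ⨾ q)      = State p ⊎ State q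
State (cond p q r) = ⊤ ⊎ (State p ⊎ (State q ⊎ State r))
State (loop _ p)   = ⊤ ⊎ State p

entry : ∀ p → State p
entry (wr _)       = tt
entry (mv _)       = tt
entry (p ⨾ q)      = inj₁ (entry p)
entry (cond _ _ _) = inj₁ tt
entry (loop _ _)   = inj₁ tt

-- e embeds the states of p into those of a machine, and x is where control goes when p ends.
trans-of : ∀ p {X : Set} → (State p → X) → X → State p → Symbol → X × Symbol × Move
trans-of (wr s′) e x _ s = x , s′ , stay
trans-of (mv m) e x _ s = x , s , m
trans-of (p ⨾ q) e x (inj₁ st) s = trans-of p (e ∘ inj₁) (e (inj₂ (entry q))) st s
trans-of (p ⨾ q) e x (inj₂ st) s = trans-of q (e ∘ inj₂) x st s
trans-of (cond p q r) e x (inj₁ _) nothing      = e (inj₂ (inj₁ (entry p))) , nothing , stay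
trans-of (cond p q r) e x (inj₁ _) (just false) = e (inj₂ (inj₂ (inj₁ (entry q)))) , just false , stay
trans-of (cond p q r) e x (inj₁ _) (just true)  = e (inj₂ (inj₂ (inj₂ (entry r)))) , just true , stay
trans-of (cond p q r) e x (inj₂ (inj₁ st)) s        = trans-of p (e ∘ inj₂ ∘ inj₁) x st s
trans-of (cond p q r) e x (inj₂ (inj₂ (inj₁ st))) s = trans-of q (e ∘ inj₂ ∘ inj₂ ∘ inj₁) x st s
trans-of (cond p q r) e x (inj₂ (inj₂ (inj₂ st))) s = trans-of r (e ∘ inj₂ ∘ inj₂ ∘ inj₂) x st s
trans-of (loop f p) e x (inj₁ _) s with f s
... | true  = e (inj₂ (entry p)) , s , stay
... | false = x , s , stay
trans-of (loop f p) e x (inj₂ st) s = trans-of p (e ∘ inj₂) (e (inj₁ tt)) st s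

-- The last index is an upper bound for the number of machine steps.
data TapeRun : TapeProg → ℤ → Tape → ℤ → Tape → ℕ → Set where
  wr    : ∀ {s h c} → TapeRun (wr s) h c h (write c h s) 1
  mv    : ∀ {m h c} → TapeRun (mv m) h c (shift m h) c 1
  _⨾_   : ∀ {p q h c h₁ c₁ h₂ c₂ t₁ t₂} → TapeRun p h c h₁ c₁ t₁ → TapeRun q h₁ c₁ h₂ c₂ t₂ →
          TapeRun (p ⨾ q) h c h₂ c₂ (t₁ + t₂)
  condB : ∀ {p q r h c h₁ c₁ t} → c h ≡ nothing → TapeRun p h c h₁ c₁ t →
          TapeRun (cond p q r) h c h₁ c₁ (suc t)
  cond0 : ∀ {p q r h c h₁ c₁ t} → c h ≡ just false → TapeRun q h c h₁ c₁ t →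
          TapeRun (cond p q r) h c h₁ c₁ (suc t)
  cond1 : ∀ {p q r h c h₁ c₁ t} → c h ≡ just true → TapeRun r h c h₁ c₁ t →
          TapeRun (cond p q r) h c h₁ c₁ (suc t)
  done  : ∀ {f p h c} → f (c h) ≡ false → TapeRun (loop f p) h c h c 1
  again : ∀ {f p h c h₁ c₁ h₂ c₂ t₁ t₂} → f (c h) ≡ true → TapeRun p h c h₁ c₁ t₁ →
          TapeRun (loop f p) h₁ c₁ h₂ c₂ t₂ → TapeRun (loop f p) h c h₂ c₂ (suc (t₁ + t₂))
  weak  : ∀ {p h c h₁ c₁ t t′} → t ≤ t′ → TapeRun p h c h₁ c₁ t → TapeRun p h c h₁ c₁ t′

run-+ : ∀ M s t c → run M (s + t) c ≡ run M t (run M s c)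
run-+ M zero    t c = refl
run-+ M (suc s) t c = run-+ M s t (step M c)

module Simulation (M : TM) where
  open TM M

  -- Nothing is asked outside the image of `e`, so the property passes to a subprogram by composing
  -- `e` with an injection. The states must avoid `halt`, where `step` ignores the transition
  -- function.
  Embeds : ∀ p → (State p → Fin Q) → Fin Q → Set
  Embeds p e x = ∀ st s → δ (e st) s ≡ trans-of p e x st s × e st ≢ halt

  -- Quantified over all configurations that show the tape, since lists differing in trailing blanks
  -- show the same one.
  Reaches : ℕ → Fin Q → ℤ → Tape → Fin Q → ℤ → Tape → Set
  Reaches t q h c q′ h′ c′ = ∀ {ls s rs} → Shows (conf q ls s rs) h c →
    Σ[ t′ ∈ ℕ ] Σ[ ls′ ∈ List Symbol ] Σ[ s′ ∈ Symbol ] Σ[ rs′ ∈ List Symbol ] t′ ≤ t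
      × run M t′ (conf q ls s rs) ≡ conf q′ ls′ s′ rs′ × Shows (conf q′ ls′ s′ rs′) h′ c′

  reaches-trans : ∀ {t₁ t₂ q h c q₁ h₁ c₁ q₂ h₂ c₂} → Reaches t₁ q h c q₁ h₁ c₁ →
    Reaches t₂ q₁ h₁ c₁ q₂ h₂ c₂ → Reaches (t₁ + t₂) q h c q₂ h₂ c₂
  reaches-trans r₁ r₂ {ls} {s} {rs} sh with r₁ sh
  ... | a , _ , _ , _ , a≤ , eq₁ , sh₁ with r₂ sh₁
  ... | b , ls₂ , s₂ , rs₂ , b≤ , eq₂ , sh₂ =
    a + b , ls₂ , s₂ , rs₂ , +-mono-≤ a≤ b≤ , trans (run-+ M a b _) (trans (cong (run M b) eq₁) eq₂) , sh₂

  one-step : ∀ {q q′ h c s′ m} → q ≢ halt → δ q (c h) ≡ (q′ , s′ , m) →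
    Reaches 1 q h c q′ (shift m h) (write c h s′)
  one-step {q} {q′} {h} {c} {s′} {m} q≢ δeq {ls} {s} {rs} sh@(shows a _ _) = 
    1 , Config.left k , Config.head k , Config.right k , ≤-refl , trans stepeq k≡ , subst (λ k′ → Shows k′ _ _) k≡ (shows-move m (shows-write {q′ = q′} s′ sh))
    where
    k = moveHead q′ ls s′ rs m
    k≡ : k ≡ conf q′ (Config.left k) (Config.head k) (Config.right k)
    k≡ = cong (λ st → conf st (Config.left k) (Config.head k) (Config.right k)) (moveHead-state q′ ls s′ rs m)
    stepeq : step M (conf q ls s rs) ≡ k
    stepeq rewrite dec-false (q Fin.≟ halt) q≢ | trans (cong (δ q) (sym a)) δeq = refl

  -- Writing back the symbol just read gives a tape that is equal only pointwise. `Shows` looks at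
  -- values of the tape, so this is enough.
  same-tape : ∀ {t q h c c₁ q′} → (∀ z → c₁ z ≡ c z) → Reaches t q h c q′ h c₁ → Reaches t q h c q′ h c
  same-tape eq r sh with r sh
  ... | t , ls , s , rs , t≤ , e , shows a b d =
    t , ls , s , rs , t≤ , e , shows (trans (sym (eq _)) a) (λ i → trans (sym (eq _)) (b i)) (λ i → trans (sym (eq _)) (d i))

  write-id : ∀ c h z → write c h (c h) z ≡ c z
  write-id c h z with z ℤ.≟ h
  ... | yes refl = refl
  ... | no _     = refl

  test-step : ∀ {q q′ h c} → q ≢ halt → δ q (c h) ≡ (q′ , c h , stay) → Reaches 1 q h c q′ h c
  test-step {h = h} {c} q≢ eq = same-tape (write-id c h) (one-step q≢ eq)

  move-step : ∀ {q q′ h c m} → q ≢ halt → δ q (c h) ≡ (q′ , c h , m) → Reaches 1 q h c q′ (shift m h) c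
  move-step {q} {q′} {h} {c} {m} q≢ eq sh with one-step q≢ eq sh
  ... | t , ls , s , rs , t≤ , e , shows a b d = t , ls , s , rs , t≤ , e ,
    shows (trans (sym (write-id c h _)) a) (λ i → trans (sym (write-id c h _)) (b i)) (λ i → trans (sym (write-id c h _)) (d i))

  simulate : ∀ {p h c h′ c′ t} → TapeRun p h c h′ c′ t →
    ∀ e x → Embeds p e x → Reaches t (e (entry p)) h c x h′ c′
  simulate wr e x em = one-step (proj₂ (em tt nothing)) (proj₁ (em tt _))
  simulate mv e x em = move-step (proj₂ (em tt nothing)) (proj₁ (em tt _))
  simulate (_⨾_ {p} {q} r₁ r₂) e x em = reaches-trans
    (simulate r₁ (e ∘ inj₁) (e (inj₂ (entry q))) (em ∘ inj₁)) (simulate r₂ (e ∘ inj₂) x (em ∘ inj₂))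
  simulate (condB {c = c} eq r) e x em = reaches-trans
    (test-step (proj₂ (em (inj₁ tt) nothing)) (subst (λ s → δ (e (inj₁ tt)) s ≡ (_ , s , stay)) (sym eq) (proj₁ (em (inj₁ tt) nothing))))
    (simulate r _ x (em ∘ inj₂ ∘ inj₁))
  simulate (cond0 {c = c} eq r) e x em = reaches-trans
    (test-step (proj₂ (em (inj₁ tt) nothing)) (subst (λ s → δ (e (inj₁ tt)) s ≡ (_ , s , stay)) (sym eq) (proj₁ (em (inj₁ tt) (just false)))))
    (simulate r _ x (em ∘ inj₂ ∘ inj₂ ∘ inj₁))
  simulate (cond1 {c = c} eq r) e x em = reaches-trans
    (test-step (proj₂ (em (inj₁ tt) nothing)) (subst (λ s → δ (e (inj₁ tt)) s ≡ (_ , s , stay)) (sym eq) (proj₁ (em (inj₁ tt) (just true)))))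
    (simulate r _ x (em ∘ inj₂ ∘ inj₂ ∘ inj₂))
  simulate (done {f} {p} {h} {c} eq) e x em = test-step (proj₂ (em (inj₁ tt) nothing)) (trans (proj₁ (em (inj₁ tt) (c h))) exits)
    where
    exits : trans-of (loop f p) e x (inj₁ tt) (c h) ≡ (x , c h , stay)
    exits rewrite eq = refl
  simulate (again {f} {p} {h} {c} eq r₁ r₂) e x em = reaches-trans (reaches-trans
    (test-step (proj₂ (em (inj₁ tt) nothing)) (trans (proj₁ (em (inj₁ tt) (c h))) enters))
    (simulate r₁ (e ∘ inj₂) (e (inj₁ tt)) (em ∘ inj₂))) (simulate r₂ e x em)
    where
    enters : trans-of (loop f p) e x (inj₁ tt) (c h) ≡ (e (inj₂ (entry p)) , c h , stay)
    enters rewrite eq = refl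
  simulate (weak le r) e x em sh with simulate r e x em sh
  ... | t , ls , s , rs , t≤ , rest = t , ls , s , rs , ≤-trans t≤ le , rest

size : TapeProg → ℕ
size (wr _)       = 1
size (mv _)       = 1
size (p ⨾ q)      = size p + size q
size (cond p q r) = 1 + (size p + (size q + size r))
size (loop _ p)   = 1 + size p

numbering : ∀ p → State p → Fin (size p)
numbering (wr _) _ = zero
numbering (mv _) _ = zero
numbering (p ⨾ q) st = Fin.join (size p) (size q) (Sum.map (numbering p) (numbering q) st)
numbering (cond p q r) (inj₁ _) = zero
numbering (cond p q r) (inj₂ st) = suc (Fin.join (size p) (size q + size r)
  (Sum.map (numbering p) (Fin.join (size q) (size r) ∘ Sum.map (numbering q) (numbering r)) st))
numbering (loop _ p) (inj₁ _)  = zero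
numbering (loop _ p) (inj₂ st) = suc (numbering p st)

numbered : ∀ p → Fin (size p) → State p
numbered (wr _) _ = tt
numbered (mv _) _ = tt
numbered (p ⨾ q) i = Sum.map (numbered p) (numbered q) (splitAt (size p) i)
numbered (cond p q r) zero = inj₁ tt
numbered (cond p q r) (suc i) = inj₂ (Sum.map (numbered p)
  (Sum.map (numbered q) (numbered r) ∘ splitAt (size q)) (splitAt (size p) i))
numbered (loop _ p) zero    = inj₁ tt
numbered (loop _ p) (suc i) = inj₂ (numbered p i)

numbered-numbering : ∀ p st → numbered p (numbering p st) ≡ st
numbered-numbering (wr _) _ = refl
numbered-numbering (mv _) _ = refl
numbered-numbering (p ⨾ q) (inj₁ st) rewrite Finₚ.splitAt-join (size p) (size q) (inj₁ (numbering p st)) =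
  cong inj₁ (numbered-numbering p st)
numbered-numbering (p ⨾ q) (inj₂ st) rewrite Finₚ.splitAt-join (size p) (size q) (inj₂ (numbering q st)) =
  cong inj₂ (numbered-numbering q st)
numbered-numbering (cond p q r) (inj₁ _) = refl
numbered-numbering (cond p q r) (inj₂ (inj₁ st))
  rewrite Finₚ.splitAt-join (size p) (size q + size r) (inj₁ (numbering p st)) =
  cong (inj₂ ∘ inj₁) (numbered-numbering p st)
numbered-numbering (cond p q r) (inj₂ (inj₂ (inj₁ st)))
  rewrite Finₚ.splitAt-join (size p) (size q + size r) (inj₂ (Fin.join (size q) (size r) (inj₁ (numbering q st))))
        | Finₚ.splitAt-join (size q) (size r) (inj₁ (numbering q st)) =
  cong (inj₂ ∘ inj₂ ∘ inj₁) (numbered-numbering q st)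
numbered-numbering (cond p q r) (inj₂ (inj₂ (inj₂ st)))
  rewrite Finₚ.splitAt-join (size p) (size q + size r) (inj₂ (Fin.join (size q) (size r) (inj₂ (numbering r st))))
        | Finₚ.splitAt-join (size q) (size r) (inj₂ (numbering r st)) =
  cong (inj₂ ∘ inj₂ ∘ inj₂) (numbered-numbering r st)
numbered-numbering (loop _ p) (inj₁ _)  = refl
numbered-numbering (loop _ p) (inj₂ st) = cong inj₂ (numbered-numbering p st)

-- State `zero` is where control goes when the program ends; shifting all program states up by one
-- keeps them apart from it.
machine : TapeProg → TM
machine p = record
  { Q = suc (size p) ; start = suc (numbering p (entry p)) ; halt = zero
  ; δ = λ { zero s → zero , s , stay ; (suc i) s → trans-of p (suc ∘ numbering p) zero (numbered p i) s } }

machine-embeds : ∀ p → Simulation.Embeds (machine p) p (suc ∘ numbering p) zero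
machine-embeds p st s = cong (λ st′ → trans-of p (suc ∘ numbering p) zero st′ s) (numbered-numbering p st) , λ ()

-- Stack programs

≤-by : ∀ {a b} c → a + c ≡ b → a ≤ b
≤-by {a} c eq = subst (a ≤_) eq (m≤m+n a c)

if-dec : ∀ {X A : Set} (d : Dec X) (P : A → Set) {x y : A} → (X → P x) → (¬ X → P y) → P (if does d then x else y)
if-dec (yes p) P f g = f p
if-dec (no ¬p) P f g = g ¬p

nonBlank isBlank : Symbol → Bool
nonBlank nothing  = false
nonBlank (just _) = true
isBlank nothing   = true
isBlank (just _)  = false

-- Stacks are lists with the top first, whereas cell 0 on the tape is the bottom.
at : List Bool → ℕ → Symbol
at []       i = nothing
at (b ∷ xs) i = if does (i ≟ length xs) then just b else at xs i

at-beyond : ∀ xs {i} → length xs ≤ i → at xs i ≡ nothing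
at-beyond []       le = refl
at-beyond (b ∷ xs) {i} le rewrite dec-false (i ≟ length xs) (λ e → <-irrefl (sym e) le) = at-beyond xs (<⇒≤ le)

at-within : ∀ xs {i} → i < length xs → nonBlank (at xs i) ≡ true
at-within (b ∷ xs) {i} (s≤s le) = if-dec (i ≟ length xs) (λ s → nonBlank s ≡ true)
  (λ _ → refl) (λ i≢ → at-within xs (≤∧≢⇒< le i≢))

at-top : ∀ b xs → at (b ∷ xs) (length xs) ≡ just b
at-top b xs rewrite dec-true (length xs ≟ length xs) refl = refl

-- The origin is chosen so that the input ends in cell -2. It then is the initial content of the
-- stack that extends to the left, with its first bit on top.
inputTape : List Bool → Tape
inputTape x (+ n)        = nothing
inputTape x -[1+ zero ]  = nothing
inputTape x -[1+ suc i ] = at x i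

moves : Move → ℕ → TapeProg
moves m zero    = mv stay
moves m (suc n) = mv m ⨾ moves m n

moves-right : ∀ n x {c} → TapeRun (moves moveR n) (+ x) c (+ (n + x)) c (suc n)
moves-right zero    x = mv
moves-right (suc n) x {c} = mv ⨾ subst (λ y → TapeRun (moves moveR n) (+ suc x) c (+ y) c (suc n)) (+-suc n x) (moves-right n (suc x))

moves-left : ∀ n x {c} → TapeRun (moves moveL n) (+ (n + x)) c (+ x) c (suc n)
moves-left zero    x = mv
moves-left (suc n) x = mv ⨾ moves-left n x

data StackProg (k : ℕ) : Set where
  push  : Fin k → Bool → StackProg k
  out   : Bool → StackProg k
  case  : Fin k → (empty zero one : StackProg k) → StackProg k
  while : Fin k → StackProg k → StackProg k
  _⨟_   : StackProg k → StackProg k → StackProg k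
  skip  : StackProg k

infixr 5 _⨟_

Stacks : ℕ → Set
Stacks = Vec (List Bool)

data StackRun {k} : StackProg k → List Bool → Stacks k → List Bool → Stacks k → ℕ → Set
data StackLoop {k} (j : Fin k) (p : StackProg k) : List Bool → Stacks k → List Bool → Stacks k → ℕ → Set

-- out pushes on a further stack, the first component of the state.
data StackRun {k} where
  push  : ∀ {j b L σ} → StackRun (push j b) L σ L (σ [ j ]≔ (b ∷ lookup σ j)) 1
  out   : ∀ {b L σ} → StackRun (out b) L σ (b ∷ L) σ 1
  skip  : ∀ {L σ} → StackRun skip L σ L σ 1
  _⨟_   : ∀ {p q L σ L₁ σ₁ L₂ σ₂ s t} → StackRun p L σ L₁ σ₁ s → StackRun q L₁ σ₁ L₂ σ₂ t →
          StackRun (p ⨟ q) L σ L₂ σ₂ (s + t)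
  caseE : ∀ {j p q r L σ L₁ σ₁ t} → lookup σ j ≡ [] → StackRun p L σ L₁ σ₁ t →
          StackRun (case j p q r) L σ L₁ σ₁ (suc t)
  case0 : ∀ {j p q r L σ L₁ σ₁ t xs} → lookup σ j ≡ false ∷ xs → StackRun q L (σ [ j ]≔ xs) L₁ σ₁ t →
          StackRun (case j p q r) L σ L₁ σ₁ (suc t)
  case1 : ∀ {j p q r L σ L₁ σ₁ t xs} → lookup σ j ≡ true ∷ xs → StackRun r L (σ [ j ]≔ xs) L₁ σ₁ t →
          StackRun (case j p q r) L σ L₁ σ₁ (suc t)
  while : ∀ {j p L σ L₁ σ₁ t} → StackLoop j p L σ L₁ σ₁ t → StackRun (while j p) L σ L₁ σ₁ (suc t)
  weak  : ∀ {p L σ L₁ σ₁ s t} → s ≤ t → StackRun p L σ L₁ σ₁ s → StackRun p L σ L₁ σ₁ t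

data StackLoop {k} j p where
  done  : ∀ {L σ} → lookup σ j ≡ [] → StackLoop j p L σ L σ 1
  again : ∀ {L σ L₁ σ₁ L₂ σ₂ s t b xs} → lookup σ j ≡ b ∷ xs → StackRun p L σ L₁ σ₁ s →
          StackLoop j p L₁ σ₁ L₂ σ₂ t → StackLoop j p L σ L₂ σ₂ (suc (s + t))

record Within {k} (L : List Bool) (σ : Stacks k) (z : ℕ) : Set where
  constructor _,_
  field
    left-within  : length L ≤ z
    stack-within : ∀ j → length (lookup σ j) ≤ z
open Within

within-≤ : ∀ {k L} {σ : Stacks k} {y z} → y ≤ z → Within L σ y → Within L σ z
within-≤ le (a , b) = ≤-trans a le , λ j → ≤-trans (b j) le

within-set : ∀ {k L} {σ : Stacks k} {z} j {ys} → length ys ≤ z → Within L σ z → Within L (σ [ j ]≔ ys) z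
within-set {σ = σ} {z} j {ys} le (a , b) = a , λ i → bound i (i Fin.≟ j)
  where
  bound : ∀ i → Dec (i ≡ j) → length (lookup (σ [ j ]≔ ys) i) ≤ z
  bound i (yes refl) rewrite Vecₚ.lookup∘update i σ ys = le
  bound i (no i≢j) rewrite Vecₚ.lookup∘update′ i≢j σ ys = b i

within-pop : ∀ {k L} {σ : Stacks k} {z} j {b xs} → lookup σ j ≡ b ∷ xs → Within L σ z → Within L (σ [ j ]≔ xs) z
within-pop {σ = σ} {z} j {b} {xs} eq w =
  within-set j (<⇒≤ (subst (λ ys → length ys ≤ z) eq (stack-within w j))) w

-- A step pushes at most one bit, so a bound on the time is also a bound on the stacks and hence on
-- the part of the tape that scans have to cross.
run-within : ∀ {k} {p : StackProg k} {L σ L₁ σ₁ t z} → StackRun p L σ L₁ σ₁ t → Within L σ z → Within L₁ σ₁ (t + z)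
loop-within : ∀ {k j} {p : StackProg k} {L σ L₁ σ₁ t z} → StackLoop j p L σ L₁ σ₁ t → Within L σ z → Within L₁ σ₁ (t + z)
run-within (push {j}) w = within-set j (s≤s (stack-within w j)) (within-≤ (n≤1+n _) w)
run-within out (a , b) = s≤s a , λ j → ≤-trans (b j) (n≤1+n _)
run-within skip w = within-≤ (n≤1+n _) w
run-within {z = z} (_⨟_ {s = s} {t} r₁ r₂) w =
  within-≤ (≤-reflexive (trans (sym (+-assoc t s z)) (cong (_+ z) (+-comm t s)))) (run-within r₂ (run-within r₁ w))
run-within (caseE eq r) w = within-≤ (n≤1+n _) (run-within r w)
run-within (case0 {j} eq r) w = within-≤ (n≤1+n _) (run-within r (within-pop j eq w))
run-within (case1 {j} eq r) w = within-≤ (n≤1+n _) (run-within r (within-pop j eq w))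
run-within (while l) w = within-≤ (n≤1+n _) (loop-within l w)
run-within (weak le r) w = within-≤ (+-monoˡ-≤ _ le) (run-within r w)
loop-within (done _) w = within-≤ (n≤1+n _) w
loop-within {z = z} (again {s = s} {t} _ r l) w =
  within-≤ (≤-trans (≤-reflexive (trans (sym (+-assoc t s z)) (cong (_+ z) (+-comm t s)))) (n≤1+n _)) (loop-within l (run-within r w))

-- The stacks of a program are interleaved on the tape to the right of cell 0, with period suc k; track 0
-- holds nothing but a mark in cell 0.  One more stack extends from cell -2 to the left.
module Layout (k : ℕ) where
  period : ℕ
  period = suc k

  pos : ℕ → ℕ → ℕ
  pos a zero    = a
  pos a (suc i) = period + pos a i

  pos-+ : ∀ a i → pos a i ≡ a + pos 0 i
  pos-+ a zero    = sym (+-identityʳ a)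
  pos-+ a (suc i) = trans (cong (λ y → period + y) (pos-+ a i)) (swap a period (pos 0 i))
    where
    swap : ∀ x y z → y + (x + z) ≡ x + (y + z)
    swap = solve-∀

  pos-injective : ∀ {a b} i j → a < period → b < period → pos a i ≡ pos b j → a ≡ b × i ≡ j
  pos-injective zero    zero    _ _ eq = eq , refl
  pos-injective zero    (suc j) l _ eq = ⊥-elim (<-irrefl eq (≤-trans l (m≤m+n period _)))
  pos-injective (suc i) zero    _ l eq = ⊥-elim (<-irrefl (sym eq) (≤-trans l (m≤m+n period _)))
  pos-injective (suc i) (suc j) l m eq with pos-injective i j l m (+-cancelˡ-≡ period _ _ eq)
  ... | a≡b , i≡j = a≡b , cong suc i≡j

  content : Stacks k → Fin (suc k) → ℕ → Symbol
  content σ zero    zero    = just true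
  content σ zero    (suc i) = nothing
  content σ (suc j) i       = at (lookup σ j) i

  record Holds (c : Tape) (L : List Bool) (σ : Stacks k) : Set where
    constructor holds
    field
      tracks : ∀ a i → c (+ pos (toℕ a) i) ≡ content σ a i
      gap    : c -[1+ 0 ] ≡ nothing
      left   : ∀ i → c -[1+ suc i ] ≡ at L i
  open Holds

  -- A push and a pop both change a stack at a single height `r`; writing one cell covers the two.
  holds-set : ∀ {c L σ} j r s ys → (∀ i → at ys i ≡ (if does (i ≟ r) then s else at (lookup σ j) i)) →
    Holds c L σ → Holds (write c (+ pos (suc (toℕ j)) r) s) L (σ [ j ]≔ ys)
  holds-set {c} {L} {σ} j r s ys eq H = holds tr
    (trans (write-other c h s (λ ())) (gap H)) (λ i → trans (write-other c h s (λ ())) (left H i))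
    where
    h = + pos (suc (toℕ j)) r
    elsewhere : ∀ a i → ¬ (a ≡ suc j × i ≡ r) → write c h s (+ pos (toℕ a) i) ≡ content σ a i
    elsewhere a i ≢ = trans (write-other c h s λ e → ≢ (distinct e)) (tracks H a i)
      where
      distinct : + pos (toℕ a) i ≡ h → a ≡ suc j × i ≡ r
      distinct e with pos-injective i r (Finₚ.toℕ<n a) (Finₚ.toℕ<n (suc j)) (ℤₚ.+-injective e)
      ... | p , q = Finₚ.toℕ-injective p , q
    tr : ∀ a i → write c h s (+ pos (toℕ a) i) ≡ content (σ [ j ]≔ ys) a i
    tr zero zero    = elsewhere zero zero λ ()
    tr zero (suc i) = elsewhere zero (suc i) λ ()
    tr (suc j′) i with j′ Fin.≟ j
    ... | no j′≢j rewrite Vecₚ.lookup∘update′ j′≢j σ ys = elsewhere (suc j′) i λ { (e , _) → j′≢j (Finₚ.suc-injective e) }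
    ... | yes refl rewrite Vecₚ.lookup∘update j σ ys | eq i = if-dec (i ≟ r) (write c h s (+ pos (suc (toℕ j)) i) ≡_)
      (λ { refl → write-same c h s }) (λ i≢r → elsewhere (suc j) i λ { (_ , e) → i≢r e })

  holds-left : ∀ {c L σ} r s ys → (∀ i → at ys i ≡ (if does (i ≟ r) then s else at L i)) →
    Holds c L σ → Holds (write c -[1+ suc r ] s) ys σ
  holds-left {c} {L} r s ys eq H = holds (λ a i → trans (write-other c -[1+ suc r ] s (λ ())) (tracks H a i))
    (trans (write-other c -[1+ suc r ] s (λ ())) (gap H)) lf
    where
    lf : ∀ i → write c -[1+ suc r ] s -[1+ suc i ] ≡ at ys i
    lf i rewrite eq i = if-dec (i ≟ r) (write c -[1+ suc r ] s -[1+ suc i ] ≡_)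
      (λ { refl → write-same c -[1+ suc r ] s }) (λ i≢r → trans (write-other c -[1+ suc r ] s λ { refl → i≢r refl }) (left H i))

  at-pop : ∀ b xs i → at xs i ≡ (if does (i ≟ length xs) then nothing else at (b ∷ xs) i)
  at-pop b xs i with i ≡ᵇ length xs in eq
  ... | true  = at-beyond xs (≤-reflexive (sym (≡ᵇ⇒≡ i _ (subst T (sym eq) tt))))
  ... | false = refl

  goTo : Fin k → TapeProg
  goTo j = moves moveR (suc (toℕ j))

  goBack : Fin k → TapeProg
  goBack j = moves moveL (suc (toℕ j))

  scanUp : TapeProg
  scanUp = loop nonBlank (moves moveR period)

  -- Above its mark track 0 is blank, so descending along it by whole periods can only stop in cell
  -- 0.
  home : Fin k → TapeProg
  home j = goBack j ⨾ loop isBlank (moves moveL period)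

  homeL : TapeProg
  homeL = mv moveR ⨾ loop nonBlank (mv moveR) ⨾ mv moveR

  pushT : Fin k → Bool → TapeProg
  pushT j b = goTo j ⨾ scanUp ⨾ wr (just b) ⨾ home j

  leftEnd : TapeProg
  leftEnd = moves moveL 2 ⨾ loop nonBlank (mv moveL)

  outT : Bool → TapeProg
  outT b = leftEnd ⨾ wr (just b) ⨾ homeL

  popT : Fin k → TapeProg → TapeProg → TapeProg
  popT j q r = scanUp ⨾ moves moveL period ⨾
    cond (mv stay) (wr nothing ⨾ home j ⨾ q) (wr nothing ⨾ home j ⨾ r)

  loadBody : Fin k → TapeProg
  loadBody j = loop nonBlank (mv moveL) ⨾ mv moveR ⨾
    cond (mv stay) (wr nothing ⨾ homeL ⨾ pushT j false ⨾ moves moveL 2) (wr nothing ⨾ homeL ⨾ pushT j true ⨾ moves moveL 2)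

  setup : TapeProg
  setup = loop nonBlank (mv moveR) ⨾ mv moveR ⨾ wr (just true)

  load : Fin k → TapeProg
  load j = moves moveL 2 ⨾ loop nonBlank (loadBody j) ⨾ moves moveR 2

  finish : TapeProg
  finish = leftEnd ⨾ mv moveR

  compile : StackProg k → TapeProg
  compile (push j b)     = pushT j b
  compile (out b)        = outT b
  -- The bottom cell only tells whether the stack is empty. Either bit there leads to the same pop,
  -- which branches on the top.
  compile (case j p q r) = goTo j ⨾ cond (home j ⨾ compile p) (popT j (compile q) (compile r)) (popT j (compile q) (compile r))
  compile (while j p)    = goTo j ⨾ loop nonBlank (goBack j ⨾ compile p ⨾ goTo j) ⨾ goBack j
  compile (p ⨟ q)        = compile p ⨾ compile q
  compile skip           = mv stay

  whole : Fin k → StackProg k → TapeProg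
  whole j p = setup ⨾ load j ⨾ compile p ⨾ finish

  empty : Stacks k
  empty = Vec.replicate k []

  mark-holds : ∀ x → Holds (write (inputTape x) (+ 0) (just true)) x empty
  mark-holds x = holds tr refl (λ i → refl)
    where
    tr : ∀ a i → write (inputTape x) (+ 0) (just true) (+ pos (toℕ a) i) ≡ content empty a i
    tr zero zero    = refl
    tr zero (suc i) = refl
    tr (suc a) i = trans (write-other (inputTape x) (+ 0) (just true) {+ pos (suc (toℕ a)) i} λ e → nonzero i (ℤₚ.+-injective e))
      (sym (cong (λ ys → at ys i) (Vecₚ.lookup-replicate a [])))
      where
      nonzero : ∀ i → pos (suc (toℕ a)) i ≢ 0
      nonzero zero ()
      nonzero (suc i) ()

  -- A scan makes at most `Z` rounds of at most `period + 2` steps each; the remaining allowance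
  -- covers the last test and the short fixed moves.
  bound : ℕ → ℕ
  bound Z = suc Z * (period + 4)

  bound-long : ∀ Z n e → n ≤ Z → e ≤ period + 4 → suc (n * e) ≤ bound Z
  bound-long Z n e n≤ e≤ = +-mono-≤ {x = 1} (≤-trans (s≤s z≤n) (m≤n+m 4 period)) (*-mono-≤ n≤ e≤)

  bound-short : ∀ Z {n} → n ≤ period + 4 → n ≤ bound Z
  bound-short Z le = ≤-trans le (m≤m+n _ _)

  track≤ : ∀ (j : Fin k) → suc (suc (toℕ j)) ≤ period + 4
  track≤ j = ≤-trans (s≤s (Finₚ.toℕ<n j)) (m≤m+n period 4)

  -- U is kept abstract, since unfolding the bound makes type checking slow.
  module Timed (Z U : ℕ) (U-long : ∀ n e → n ≤ Z → e ≤ period + 4 → suc (n * e) ≤ U)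
               (U-short : ∀ {n} → n ≤ period + 4 → n ≤ U) where
    U-one : 1 ≤ U
    U-one = U-short (≤-trans (s≤s z≤n) (m≤n+m 4 period))

    goTo-run : ∀ j i {c} → TapeRun (goTo j) (+ pos 0 i) c (+ pos (suc (toℕ j)) i) c U
    goTo-run j i {c} rewrite pos-+ (suc (toℕ j)) i = weak (U-short (track≤ j)) (moves-right (suc (toℕ j)) (pos 0 i))
    goBack-run : ∀ j i {c} → TapeRun (goBack j) (+ pos (suc (toℕ j)) i) c (+ pos 0 i) c U
    goBack-run j i {c} rewrite pos-+ (suc (toℕ j)) i = weak (U-short (track≤ j)) (moves-left (suc (toℕ j)) (pos 0 i))
    period≤ : suc (suc period) ≤ period + 4
    period≤ = subst (_≤ period + 4) (+-comm period 2) (+-monoʳ-≤ period (s≤s (s≤s z≤n)))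

    scan-loop : ∀ {c L σ} j → Holds c L σ → ∀ d i → d + i ≡ length (lookup σ j) →
      TapeRun scanUp (+ pos (suc (toℕ j)) i) c (+ pos (suc (toℕ j)) (length (lookup σ j))) c (suc (d * suc (suc period)))
    scan-loop {σ = σ} j H zero i refl = done (cong nonBlank (trans (tracks H (suc j) i) (at-beyond (lookup σ j) ≤-refl)))
    scan-loop {σ = σ} j H (suc d) i eq = weak (≤-reflexive (cong suc (+-suc (suc period) (d * suc (suc period)))))
      (again (trans (cong nonBlank (tracks H (suc j) i)) (at-within (lookup σ j) (subst (i <_) eq (s≤s (m≤n+m i d)))))
        (moves-right period (pos (suc (toℕ j)) i)) (scan-loop j H d (suc i) (trans (+-suc d i) eq)))

    scan-run : ∀ {c L σ} j → Holds c L σ → length (lookup σ j) ≤ Z →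
      TapeRun scanUp (+ pos (suc (toℕ j)) 0) c (+ pos (suc (toℕ j)) (length (lookup σ j))) c U
    scan-run j H le = weak (U-long _ _ le period≤) (scan-loop j H _ 0 (+-identityʳ _))

    down-loop : ∀ {c L σ} → Holds c L σ → ∀ i →
      TapeRun (loop isBlank (moves moveL period)) (+ pos 0 i) c (+ 0) c (suc (i * suc (suc period)))
    down-loop H zero = done (cong isBlank (tracks H zero zero))
    down-loop H (suc i) = weak (≤-reflexive (cong suc (+-suc (suc period) (i * suc (suc period)))))
      (again (cong isBlank (tracks H zero (suc i))) (moves-left period (pos 0 i)) (down-loop H i))

    home-run : ∀ {c L σ} j i → i ≤ Z → Holds c L σ → TapeRun (home j) (+ pos (suc (toℕ j)) i) c (+ 0) c (U + U)
    home-run j i le H = goBack-run j i ⨾ weak (U-long i _ le period≤) (down-loop H i)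

    push-run : ∀ {c L σ} j b → length (lookup σ j) ≤ Z → Holds c L σ →
      Σ[ c′ ∈ Tape ] TapeRun (pushT j b) (+ 0) c (+ 0) c′ (5 * U) × Holds c′ L (σ [ j ]≔ (b ∷ lookup σ j))
    push-run {c} {L} {σ} j b le H = _ , weak (≤-reflexive (sum5 U))
      (goTo-run j 0 ⨾ scan-run j H le ⨾ weak U-one wr ⨾ home-run j _ le H′) , H′
      where
      H′ = holds-set j (length (lookup σ j)) (just b) (b ∷ lookup σ j) (λ _ → refl) H
      sum5 : ∀ u → u + (u + (u + (u + u))) ≡ 5 * u
      sum5 = solve-∀

    left-loop : ∀ {c L σ} → Holds c L σ → ∀ d i → d + i ≡ length L →
      TapeRun (loop nonBlank (mv moveL)) -[1+ suc i ] c -[1+ suc (length L) ] c (suc (d * 2))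
    left-loop {L = L} H zero i refl = done (cong nonBlank (trans (left H i) (at-beyond L ≤-refl)))
    left-loop {L = L} H (suc d) i eq = again
      (trans (cong nonBlank (left H i)) (at-within L (subst (i <_) eq (s≤s (m≤n+m i d)))))
      mv (left-loop H d (suc i) (trans (+-suc d i) eq))

    left-run : ∀ {c L σ} → Holds c L σ → length L ≤ Z → TapeRun leftEnd (+ 0) c -[1+ suc (length L) ] c (U + U)
    left-run H le = weak (U-short (≤-trans (s≤s (s≤s (s≤s z≤n))) (m≤n+m 4 period))) (mv ⨾ mv ⨾ mv) ⨾
      weak (U-long _ _ le (≤-trans (s≤s (s≤s z≤n)) period≤)) (left-loop H _ 0 (+-identityʳ _))

    right-loop : ∀ {c L} → c -[1+ 0 ] ≡ nothing → (∀ i → c -[1+ suc i ] ≡ at L i) → ∀ i → i ≤ length L →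
      TapeRun (loop nonBlank (mv moveR)) -[1+ i ] c -[1+ 0 ] c (suc (i * 2))
    right-loop g l zero    le = done (cong nonBlank g)
    right-loop {L = L} g l (suc i) le = again (trans (cong nonBlank (l i)) (at-within L le)) mv (right-loop {L = L} g l i (<⇒≤ le))

    right-run : ∀ {c L} → c -[1+ 0 ] ≡ nothing → (∀ i → c -[1+ suc i ] ≡ at L i) → ∀ i → i ≤ length L → i ≤ Z →
      TapeRun (loop nonBlank (mv moveR)) -[1+ i ] c -[1+ 0 ] c U
    right-run {L = L} g l i le i≤ = weak (U-long i 2 i≤ (≤-trans (s≤s (s≤s z≤n)) period≤)) (right-loop {L = L} g l i le)

    homeL-run : ∀ {c L σ} → Holds c L σ → ∀ i → i ≤ length L → i ≤ Z →
      TapeRun homeL -[1+ suc i ] c (+ 0) c (U + (U + U))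
    homeL-run {L = L} H i le i≤ = weak U-one mv ⨾ right-run {L = L} (gap H) (left H) i le i≤ ⨾ weak U-one mv

    out-run : ∀ {c L σ} b → length L ≤ Z → Holds c L σ →
      Σ[ c′ ∈ Tape ] TapeRun (outT b) (+ 0) c (+ 0) c′ (6 * U) × Holds c′ (b ∷ L) σ
    out-run {c} {L} {σ} b le H = _ , weak (≤-reflexive (sum6 U))
      (left-run H le ⨾ weak U-one wr ⨾ homeL-run H′ _ (n≤1+n _) le) , H′
      where
      H′ = holds-left (length L) (just b) (b ∷ L) (λ _ → refl) H
      sum6 : ∀ u → (u + u) + (u + (u + (u + u))) ≡ 6 * u
      sum6 = solve-∀

    popped : ∀ {c L σ} j {b xs} → lookup σ j ≡ b ∷ xs → Holds c L σ →
      Holds (write c (+ pos (suc (toℕ j)) (length xs)) nothing) L (σ [ j ]≔ xs)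
    popped {σ = σ} j {b} {xs} eq H = holds-set j (length xs) nothing xs
      (λ i → trans (at-pop b xs i) (cong (λ ys → if does (i ≟ length xs) then nothing else at ys i) (sym eq))) H

    pop-run : ∀ {c L σ} j {b xs q r h′ c′ t} → length (lookup σ j) ≤ Z → lookup σ j ≡ b ∷ xs → Holds c L σ →
      TapeRun (if b then r else q) (+ 0) (write c (+ pos (suc (toℕ j)) (length xs)) nothing) h′ c′ t →
      TapeRun (popT j q r) (+ pos (suc (toℕ j)) 0) c h′ c′ (6 * U + t)
    pop-run {c} {L} {σ} j {b} {xs} {q} {r} {h′} {c′} {t} le eq H run =
      weak (≤-trans (+-monoʳ-≤ U (+-monoʳ-≤ U (+-monoˡ-≤ _ U-one))) (≤-reflexive (sum6 U t)))
        (scan-run j H le ⨾ down ⨾ branch b refl run)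
      where
      le′ : length xs ≤ Z
      le′ = ≤-trans (n≤1+n _) (subst (λ ys → length ys ≤ Z) eq le)
      down : TapeRun (moves moveL period) (+ pos (suc (toℕ j)) (length (lookup σ j))) c (+ pos (suc (toℕ j)) (length xs)) c U
      down rewrite eq = weak (U-short (≤-trans (n≤1+n _) period≤)) (moves-left period _)
      top : c (+ pos (suc (toℕ j)) (length xs)) ≡ just b
      top = trans (tracks H (suc j) (length xs)) (trans (cong (λ ys → at ys (length xs)) eq) (at-top b xs))
      branch : ∀ b′ → b ≡ b′ → TapeRun (if b′ then r else q) (+ 0) (write c (+ pos (suc (toℕ j)) (length xs)) nothing) h′ c′ t →
        TapeRun (cond (mv stay) (wr nothing ⨾ home j ⨾ q) (wr nothing ⨾ home j ⨾ r)) (+ pos (suc (toℕ j)) (length xs)) c h′ c′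
          (suc (U + ((U + U) + t)))
      branch false refl run′ = cond0 top (weak U-one wr ⨾ home-run j _ le′ (popped j eq H) ⨾ run′)
      branch true  refl run′ = cond1 top (weak U-one wr ⨾ home-run j _ le′ (popped j eq H) ⨾ run′)
      sum6 : ∀ u t → u + (u + (u + (u + ((u + u) + t)))) ≡ 6 * u + t
      sum6 = solve-∀

    -- Every construct spends a fixed number of passes of length at most `U` on each step of a stack
    -- program. The most expensive item is a round of loading the input, with fourteen.
    cost : ℕ
    cost = 16 * U

    bottom : ∀ {c L σ} j {b xs} → lookup σ j ≡ b ∷ xs → Holds c L σ → nonBlank (c (+ pos (suc (toℕ j)) 0)) ≡ true
    bottom {σ = σ} j eq H = trans (cong nonBlank (tracks H (suc j) 0))
      (at-within (lookup σ j) (subst (λ ys → 0 < length ys) (sym eq) (s≤s z≤n)))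

    bottom-empty : ∀ {c L σ} j → lookup σ j ≡ [] → Holds c L σ → c (+ pos (suc (toℕ j)) 0) ≡ nothing
    bottom-empty j eq H = trans (tracks H (suc j) 0) (cong (λ ys → at ys 0) eq)

    -- The bound `z` holds at the start and `t + z` throughout, so that a single `Z` serves all
    -- scans of the run.
    compile-run : ∀ {p L σ L₁ σ₁ t} → StackRun p L σ L₁ σ₁ t → ∀ {z c} → Within L σ z → t + z ≤ Z → Holds c L σ →
      Σ[ c′ ∈ Tape ] TapeRun (compile p) (+ 0) c (+ 0) c′ (t * cost) × Holds c′ L₁ σ₁
    compile-loop : ∀ {j p L σ L₁ σ₁ t} → StackLoop j p L σ L₁ σ₁ t → ∀ {z c} → Within L σ z → t + z ≤ Z → Holds c L σ →
      Σ[ c′ ∈ Tape ] TapeRun (loop nonBlank (goBack j ⨾ compile p ⨾ goTo j)) (+ pos (suc (toℕ j)) 0) c (+ pos (suc (toℕ j)) 0) c′ (t * cost)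
        × Holds c′ L₁ σ₁
    compile-run (push {j} {b}) w le H with push-run j b (≤-trans (stack-within w j) (≤-trans (n≤1+n _) le)) H
    ... | c′ , r , H′ = c′ , weak (≤-by (11 * U) (adds U)) r , H′
      where
      adds : ∀ u → 5 * u + 11 * u ≡ 1 * (16 * u)
      adds = solve-∀
    compile-run (out {b}) w le H with out-run b (≤-trans (left-within w) (≤-trans (n≤1+n _) le)) H
    ... | c′ , r , H′ = c′ , weak (≤-by (10 * U) (adds U)) r , H′
      where
      adds : ∀ u → 6 * u + 10 * u ≡ 1 * (16 * u)
      adds = solve-∀
    compile-run skip w le H = _ , weak (≤-trans U-one (≤-by (15 * U) (adds U))) mv , H
      where
      adds : ∀ u → u + 15 * u ≡ 1 * (16 * u)
      adds = solve-∀
    compile-run (_⨟_ {s = s} {t} r₁ r₂) {z} w le H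
      with compile-run r₁ w (≤-trans (+-monoˡ-≤ z (m≤m+n s t)) le) H
    ... | c₁ , run₁ , H₁
      with compile-run r₂ (run-within r₁ w) (≤-trans (≤-reflexive (trans (sym (+-assoc t s z)) (cong (_+ z) (+-comm t s)))) le) H₁
    ... | c₂ , run₂ , H₂ = c₂ , weak (≤-reflexive (sym (*-distribʳ-+ cost s t))) (run₁ ⨾ run₂) , H₂
    compile-run (caseE {j} {t = t} eq r) {z} w le H with compile-run r w (≤-trans (n≤1+n _) le) H
    ... | c₁ , run₁ , H₁ = c₁ , weak (≤-trans (+-monoʳ-≤ U (+-monoˡ-≤ _ U-one)) (≤-by (12 * U) (adds U (t * cost))))
      (goTo-run j 0 ⨾ condB (bottom-empty j eq H) (home-run j 0 z≤n H ⨾ run₁)) , H₁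
      where
      adds : ∀ u b → (u + (u + ((u + u) + b))) + 12 * u ≡ 16 * u + b
      adds = solve-∀
    compile-run (case0 {j} {q = q} {r = r} {t = t} eq run) {z} {c} w le H
      with compile-run run (within-pop j eq w) (≤-trans (n≤1+n _) le) (popped j eq H)
    ... | c₁ , run₁ , H₁ = c₁ , weak (≤-trans (+-monoʳ-≤ U (+-monoˡ-≤ _ U-one)) (≤-by (8 * U) (adds U (t * cost))))
      (goTo-run j 0 ⨾ enter (c (+ pos (suc (toℕ j)) 0)) refl) , H₁
      where
      adds : ∀ u b → (u + (u + (6 * u + b))) + 8 * u ≡ 16 * u + b
      adds = solve-∀
      popping = pop-run j {q = compile q} {compile r} (≤-trans (stack-within w j) (≤-trans (m≤n+m _ _) le)) eq H run₁
      enter : ∀ s → c (+ pos (suc (toℕ j)) 0) ≡ s → TapeRun (cond _ _ _) (+ pos (suc (toℕ j)) 0) c (+ 0) c₁ (suc (6 * U + t * cost))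
      enter nothing      e = contradiction (trans (sym (bottom j eq H)) (cong nonBlank e)) λ ()
      enter (just false) e = cond0 e popping
      enter (just true)  e = cond1 e popping
    compile-run (case1 {j} {q = q} {r = r} {t = t} eq run) {z} {c} w le H
      with compile-run run (within-pop j eq w) (≤-trans (n≤1+n _) le) (popped j eq H)
    ... | c₁ , run₁ , H₁ = c₁ , weak (≤-trans (+-monoʳ-≤ U (+-monoˡ-≤ _ U-one)) (≤-by (8 * U) (adds U (t * cost))))
      (goTo-run j 0 ⨾ enter (c (+ pos (suc (toℕ j)) 0)) refl) , H₁
      where
      adds : ∀ u b → (u + (u + (6 * u + b))) + 8 * u ≡ 16 * u + b
      adds = solve-∀
      popping = pop-run j {q = compile q} {compile r} (≤-trans (stack-within w j) (≤-trans (m≤n+m _ _) le)) eq H run₁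
      enter : ∀ s → c (+ pos (suc (toℕ j)) 0) ≡ s → TapeRun (cond _ _ _) (+ pos (suc (toℕ j)) 0) c (+ 0) c₁ (suc (6 * U + t * cost))
      enter nothing      e = contradiction (trans (sym (bottom j eq H)) (cong nonBlank e)) λ ()
      enter (just false) e = cond0 e popping
      enter (just true)  e = cond1 e popping
    compile-run (while {j} {t = t} l) w le H with compile-loop l w (≤-trans (n≤1+n _) le) H
    ... | c₁ , run₁ , H₁ = c₁ , weak (≤-by (14 * U) (adds U (t * cost))) (goTo-run j 0 ⨾ run₁ ⨾ goBack-run j 0) , H₁
      where
      adds : ∀ u b → (u + (b + u)) + 14 * u ≡ 16 * u + b
      adds = solve-∀
    compile-run {t = t} (weak le′ r) {z} w le H with compile-run r w (≤-trans (+-monoˡ-≤ z le′) le) H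
    ... | c₁ , run₁ , H₁ = c₁ , weak (*-monoˡ-≤ cost le′) run₁ , H₁
    compile-loop {j} (done eq) w le H = _ , weak (≤-trans U-one (≤-by (15 * U) (adds U))) (done (cong nonBlank (bottom-empty j eq H))) , H
      where
      adds : ∀ u → u + 15 * u ≡ 1 * (16 * u)
      adds = solve-∀
    compile-loop {j} (again {s = s} {t} eq r l) {z} w le H
      with compile-run r w (≤-trans (+-monoˡ-≤ z (≤-trans (m≤m+n s t) (n≤1+n _))) le) H
    ... | c₁ , run₁ , H₁
      with compile-loop l (run-within r w) (≤-trans (≤-reflexive (trans (sym (+-assoc t s z)) (cong (_+ z) (+-comm t s)))) (≤-trans (n≤1+n _) le)) H₁
    ... | c₂ , run₂ , H₂ = c₂ , weak (≤-trans (+-monoˡ-≤ _ U-one) (≤-by (13 * U) (adds U s t)))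
      (again (bottom j eq H) (goBack-run j 0 ⨾ run₁ ⨾ goTo-run j 0) run₂) , H₂
      where
      adds : ∀ u s t → (u + ((u + (s * (16 * u) + u)) + t * (16 * u))) + 13 * u ≡ 16 * u + (s + t) * (16 * u)
      adds = solve-∀

    -- The first bit is the top of the left stack, so it is moved first and ends at the bottom:
    -- loading reverses the word.
    load-loop : ∀ j L {c σ} → length L + length (lookup σ j) ≤ Z → Holds c L σ →
      Σ[ c′ ∈ Tape ] TapeRun (loop nonBlank (loadBody j)) -[1+ 1 ] c -[1+ 1 ] c′ (suc (length L) * cost)
        × Holds c′ [] (σ [ j ]≔ (L ʳ++ lookup σ j))
    load-loop j [] {σ = σ} le H = _ , weak (≤-trans U-one (≤-by (15 * U) (adds U))) (done (cong nonBlank (left H 0))) ,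
      subst (Holds _ []) (sym (Vecₚ.[]≔-lookup σ j)) H
      where
      adds : ∀ u → u + 15 * u ≡ 1 * (16 * u)
      adds = solve-∀
    load-loop j (b ∷ L) {c} {σ} le H
      with push-run j b (≤-trans (m≤n+m _ (length L)) (≤-trans (n≤1+n _) le)) (holds-left (length L) nothing L (at-pop b L) H)
    ... | c₁ , run₁ , H₁
      with load-loop j L {c₁} {σ [ j ]≔ (b ∷ lookup σ j)}
             (subst (λ ys → length L + length ys ≤ Z) (sym (Vecₚ.lookup∘update j σ _)) (≤-trans (≤-reflexive (+-suc (length L) _)) le)) H₁
    ... | c₂ , run₂ , H₂ = c₂ ,
      weak (≤-trans (+-mono-≤ U-one (+-monoˡ-≤ (suc (length L) * cost) (+-monoʳ-≤ U (+-monoʳ-≤ U (+-monoˡ-≤ _ U-one))))) (≤-by (2 * U) (adds U (suc (length L) * cost))))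
        (again (trans (cong nonBlank (left H 0)) (at-within (b ∷ L) (s≤s z≤n)))
          (weak (U-long (suc (length L)) 2 (≤-trans (m≤m+n _ (length (lookup σ j))) le) (≤-trans (s≤s (s≤s z≤n)) period≤)) (left-loop H _ 0 (+-identityʳ _))
            ⨾ weak U-one mv ⨾ branch b refl run₁) run₂) ,
      subst (Holds c₂ []) (trans (Vecₚ.[]≔-idempotent σ j) (cong (λ ys → σ [ j ]≔ (L ʳ++ ys)) (Vecₚ.lookup∘update j σ _))) H₂
      where
      adds : ∀ u b → (u + ((u + (u + (u + (u + ((u + (u + u)) + (5 * u + u)))))) + b)) + 2 * u ≡ 16 * u + b
      adds = solve-∀
      le′ : length L ≤ Z
      le′ = ≤-trans (n≤1+n _) (≤-trans (m≤m+n _ _) le)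
      branch : ∀ b′ → b ≡ b′ → TapeRun (pushT j b′) (+ 0) (write c -[1+ suc (length L) ] nothing) (+ 0) c₁ (5 * U) →
        TapeRun (cond (mv stay) (wr nothing ⨾ homeL ⨾ pushT j false ⨾ moves moveL 2) (wr nothing ⨾ homeL ⨾ pushT j true ⨾ moves moveL 2))
          -[1+ suc (length L) ] c -[1+ 1 ] c₁ (suc (U + ((U + (U + U)) + (5 * U + U))))
      branch false refl r = cond0 (trans (left H _) (at-top b L)) (weak U-one wr ⨾
        homeL-run (holds-left (length L) nothing L (at-pop b L) H) _ ≤-refl le′ ⨾ r ⨾ weak (U-short (≤-trans (s≤s (s≤s (s≤s z≤n))) (m≤n+m 4 period))) (mv ⨾ mv ⨾ mv))
      branch true  refl r = cond1 (trans (left H _) (at-top b L)) (weak U-one wr ⨾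
        homeL-run (holds-left (length L) nothing L (at-pop b L) H) _ ≤-refl le′ ⨾ r ⨾ weak (U-short (≤-trans (s≤s (s≤s (s≤s z≤n))) (m≤n+m 4 period))) (mv ⨾ mv ⨾ mv))

    2≤U : ∀ {m z c} → TapeRun (moves m 2) z c (shift m (shift m z)) c U
    2≤U = weak (U-short (≤-trans (s≤s (s≤s (s≤s z≤n))) (m≤n+m 4 period))) (mv ⨾ mv ⨾ mv)

    whole-run : ∀ {p j x y σ t} → length x ≤ Z → t + length x ≤ Z → StackRun p [] (empty [ j ]≔ (x ʳ++ [])) y σ t →
      Σ[ c ∈ Tape ] TapeRun (whole j p) -[1+ length x ] (inputTape x) -[1+ length y ] c ((2 + (t + length x)) * cost)
        × Holds c y σ
    whole-run {p} {j} {x} {y} {σ} {t} x≤ tx≤ r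
      with load-loop j x (subst (λ ys → length x + length ys ≤ Z) (sym (Vecₚ.lookup-replicate j [])) (subst (_≤ Z) (sym (+-identityʳ _)) x≤)) (mark-holds x)
    ... | c₁ , run₁ , H₁
      with compile-run r {z = length x} (within-set j (≤-reflexive rev-length) (z≤n , λ i → subst (λ ys → length ys ≤ length x) (sym (Vecₚ.lookup-replicate i [])) z≤n)) tx≤
             (subst (λ ys → Holds c₁ [] (empty [ j ]≔ (x ʳ++ ys))) (Vecₚ.lookup-replicate j []) H₁)
      where
      rev-length : length (x ʳ++ []) ≡ length x
      rev-length = trans (Listₚ.length-ʳ++ x) (+-identityʳ _)
    ... | c₂ , run₂ , H₂ = c₂ , weak total
        ((right-run {L = x} refl (λ i → refl) (length x) ≤-refl x≤ ⨾ weak U-one mv ⨾ weak U-one wr) ⨾ (2≤U ⨾ run₁ ⨾ 2≤U) ⨾ run₂ ⨾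
          left-run H₂ (≤-trans (left-within (run-within r start-within)) tx≤) ⨾ weak U-one mv) , H₂
      where
      start-within : Within [] (empty [ j ]≔ (x ʳ++ [])) (length x)
      start-within = within-set j (≤-reflexive (trans (Listₚ.length-ʳ++ x) (+-identityʳ _)))
        (z≤n , λ i → subst (λ ys → length ys ≤ length x) (sym (Vecₚ.lookup-replicate i [])) z≤n)
      adds : ∀ u n t → ((u + (u + u)) + ((u + (suc n * (16 * u) + u)) + (t * (16 * u) + ((u + u) + u)))) + 8 * u ≡ (2 + (t + n)) * (16 * u)
      adds = solve-∀
      total : (U + (U + U)) + ((U + (suc (length x) * cost + U)) + (t * cost + ((U + U) + U))) ≤ (2 + (t + length x)) * cost
      total = ≤-by (8 * U) (adds U (length x) t)

leftOf-negative : ∀ i n → leftOf i -[1+ n ] ≡ -[1+ i + n ]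
leftOf-negative zero    n = refl
leftOf-negative (suc i) n = trans (leftOf-negative i (suc n)) (cong -[1+_] (+-suc i n))

-- Beyond the gap in cell -1 the reading meets the cells from 0 on. They are blank for the initial
-- tape, but on the final tape they hold the tracks; there the reading stops at the gap, which
-- suffices because the output ends with it.
read-right : ∀ (c : Tape) ys → (∀ i → i < length ys → c -[1+ suc i ] ≡ at ys i) → c -[1+ 0 ] ≡ nothing →
  ∀ i → i ≤ length ys ⊎ (∀ n → c (+ n) ≡ nothing) → c (rightOf i -[1+ length ys ]) ≡ nth (map just ys) i
read-right c []       l g zero    _ = g
read-right c []       l g (suc i) (inj₁ ())
read-right c []       l g (suc i) (inj₂ b) = trans (cong c (trans (rightOf-+ i (+ 0)) (ℤₚ.+-identityʳ (+ i)))) (b i)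
read-right c (y ∷ ys) l g zero    _ = trans (l (length ys) ≤-refl) (at-top y ys)
read-right c (y ∷ ys) l g (suc i) h = read-right c ys
  (λ k k< → trans (l k (<-trans k< ≤-refl)) (not-top k k<)) g i (Sum.map₁ (λ { (s≤s p) → p }) h)
  where
  not-top : ∀ k → k < length ys → at (y ∷ ys) k ≡ at ys k
  not-top k k< rewrite dec-false (k ≟ length ys) (<⇒≢ k<) = refl

-- Agreement is required at the index `length ys` too: it provides the blank that ends the output.
readOut-nth : ∀ zs ys → (∀ i → i ≤ length ys → nth zs i ≡ nth (map just ys) i) → readOut zs ≡ ys
readOut-nth []             []       h = refl
readOut-nth []             (y ∷ ys) h with () ← h 0 z≤n
readOut-nth (nothing ∷ zs) []       h = refl
readOut-nth (just _ ∷ zs)  []       h with () ← h 0 z≤n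
readOut-nth (nothing ∷ zs) (y ∷ ys) h with () ← h 0 z≤n
readOut-nth (just z ∷ zs)  (y ∷ ys) h with refl ← h 0 z≤n = cong (z ∷_) (readOut-nth zs ys λ i le → h (suc i) (s≤s le))

module _ (p : TapeProg) where
  on-right : ∀ x i → inputTape x (rightOf i -[1+ length x ]) ≡ nth (map just x) i
  on-right x i = read-right (inputTape x) x (λ _ _ → refl) refl i (inj₂ λ _ → refl)

  on-left : ∀ x i → inputTape x (leftOf i -[1+ suc (length x) ]) ≡ nothing
  on-left x i rewrite leftOf-negative i (suc (length x)) | +-suc i (length x) = at-beyond x (m≤n+m (length x) i)

  start-conf : List Bool → Config (suc (size p))
  start-conf x = conf (suc (numbering p (entry p))) (Config.left k) (Config.head k) (Config.right k)
    where k = initConf (machine p) x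

  start-shows : ∀ x → Shows (start-conf x) -[1+ length x ] (inputTape x)
  start-shows []       = shows refl (λ i → on-right [] (suc i)) (on-left [])
  start-shows (b ∷ bs) = shows (on-right (b ∷ bs) 0) (λ i → on-right (b ∷ bs) (suc i)) (on-left (b ∷ bs))

  start-init : ∀ x → start-conf x ≡ initConf (machine p) x
  start-init []      = refl
  start-init (_ ∷ _) = refl

  machine-computes : ∀ x y {c t} → TapeRun p -[1+ length x ] (inputTape x) -[1+ length y ] c t →
    (∀ i → c -[1+ suc i ] ≡ at y i) → c -[1+ 0 ] ≡ nothing →
    Σ[ t′ ∈ ℕ ] t′ ≤ t × RunsTo (machine p) x t′ y
  machine-computes x y {c} {t} r l g =
    finished (Simulation.simulate (machine p) r (suc ∘ numbering p) zero (machine-embeds p) (start-shows x))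
    where
    finished : (Σ[ t′ ∈ ℕ ] Σ[ ls ∈ List Symbol ] Σ[ s ∈ Symbol ] Σ[ rs ∈ List Symbol ] t′ ≤ t ×
      run (machine p) t′ (start-conf x) ≡ conf zero ls s rs × Shows (conf {suc (size p)} zero ls s rs) -[1+ length y ] c) →
      Σ[ t′ ∈ ℕ ] t′ ≤ t × RunsTo (machine p) x t′ y
    finished (t′ , ls , s , rs , t′≤ , eq , shows a b _) =
      t′ , t′≤ , cong Config.state eq′ , trans (cong output eq′) (readOut-nth (s ∷ rs) y cells)
      where
      eq′ : run (machine p) t′ (initConf (machine p) x) ≡ conf zero ls s rs
      eq′ = trans (cong (run (machine p) t′) (sym (start-init x))) eq
      from-tape : ∀ i → nth (s ∷ rs) i ≡ c (rightOf i -[1+ length y ])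
      from-tape zero    = sym a
      from-tape (suc i) = sym (b i)
      cells : ∀ i → i ≤ length y → nth (s ∷ rs) i ≡ nth (map just y) i
      cells i le = trans (from-tape i) (read-right c y (λ i _ → l i) g i (inj₁ le))

stack-run-computes : ∀ {k} j (p : StackProg k) x {y σ t} → StackRun p [] (Vec.replicate k [] [ j ]≔ (x ʳ++ [])) y σ t →
  Σ[ t′ ∈ ℕ ] t′ ≤ (2 + (t + length x)) * (16 * Layout.bound k (t + length x)) × RunsTo (machine (Layout.whole k j p)) x t′ y
stack-run-computes {k} j p x {y} {σ} {t} r = finished
  (Layout.Timed.whole-run k Z (Layout.bound k Z) (Layout.bound-long k Z) (Layout.bound-short k Z) (m≤n+m (length x) t) ≤-refl r)
  where
  Z = t + length x
  finished : (Σ[ c ∈ Tape ] TapeRun (Layout.whole k j p) -[1+ length x ] (inputTape x) -[1+ length y ] c ((2 + Z) * (16 * Layout.bound k Z))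
    × Layout.Holds k c y σ) → _
  finished (c , run₁ , H) = machine-computes (Layout.whole k j p) x y run₁ (Layout.Holds.left H) (Layout.Holds.gap H)

-- Polynomial bounds and loops over stacks

-- The base is at least 2 and the exponent at least 1, so the bounds themselves are at least 2. Then
-- a sum of two is at most their product, and sums and products of functions are treated alike.
PolyBounded : (ℕ → ℕ) → Set
PolyBounded g = Σ[ a ∈ ℕ ] Σ[ d ∈ ℕ ] ∀ n → g n ≤ (2 + a + n) ^ suc d

2≤power : ∀ a n d → 2 ≤ (2 + a + n) ^ suc d
2≤power a n d = ≤-trans (s≤s (s≤s z≤n)) (≤-trans (≤-reflexive (sym (*-identityʳ (2 + a + n))))
  (*-monoʳ-≤ (2 + a + n) (m^n>0 (2 + a + n) d)))

sum≤product : ∀ x y → 2 ≤ x → 2 ≤ y → x + y ≤ x * y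
sum≤product (suc (suc x)) (suc (suc y)) _ _ = ≤-by (x + y + x * y) (expand x y)
  where
  expand : ∀ x y → (2 + x + (2 + y)) + (x + y + x * y) ≡ (2 + x) * (2 + y)
  expand = solve-∀
sum≤product (suc zero) _ (s≤s ()) _
sum≤product (suc (suc x)) (suc zero) _ (s≤s ())

pb-product-raw : ∀ a b d e n → (2 + a + n) ^ suc d * (2 + b + n) ^ suc e ≤ (2 + (a + b) + n) ^ suc (d + suc e)
pb-product-raw a b d e n = ≤-trans
  (*-mono-≤ (^-monoˡ-≤ (suc d) (+-monoˡ-≤ n (+-monoʳ-≤ 2 (m≤m+n a b)))) (^-monoˡ-≤ (suc e) (+-monoˡ-≤ n (+-monoʳ-≤ 2 (m≤n+m b a)))))
  (≤-reflexive (sym (^-distribˡ-+-* (2 + (a + b) + n) (suc d) (suc e))))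

pb-+ : ∀ {g h} → PolyBounded g → PolyBounded h → PolyBounded (λ n → g n + h n)
pb-+ (a , d , p) (b , e , q) = a + b , d + suc e , λ n → ≤-trans (+-mono-≤ (p n) (q n))
  (≤-trans (sum≤product _ _ (2≤power a n d) (2≤power b n e)) (pb-product-raw a b d e n))

pb-* : ∀ {g h} → PolyBounded g → PolyBounded h → PolyBounded (λ n → g n * h n)
pb-* (a , d , p) (b , e , q) = a + b , d + suc e , λ n → ≤-trans (*-mono-≤ (p n) (q n)) (pb-product-raw a b d e n)

pb-const : ∀ c → PolyBounded (λ _ → c)
pb-const c = c , 0 , λ n → ≤-trans (≤-trans (m≤n+m c 2) (m≤m+n (2 + c) n)) (≤-reflexive (sym (*-identityʳ (2 + c + n))))

pb-id : PolyBounded (λ n → n)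
pb-id = 0 , 0 , λ n → ≤-trans (m≤n+m n 2) (≤-reflexive (sym (*-identityʳ (2 + n))))

pb-suc : ∀ {g} → PolyBounded g → PolyBounded (λ n → suc (g n))
pb-suc = pb-+ (pb-const 1)

^-distrib-* : ∀ x y d → (x * y) ^ d ≡ x ^ d * y ^ d
^-distrib-* x y zero    = refl
^-distrib-* x y (suc d) = trans (cong (x * y *_) (^-distrib-* x y d)) (interchange x y (x ^ d) (y ^ d))
  where
  interchange : ∀ a b c d → (a * b) * (c * d) ≡ (a * c) * (b * d)
  interchange = solve-∀

pb-poly : ∀ {g} → PolyBounded g → Σ[ a ∈ ℕ ] Σ[ d ∈ ℕ ] ∀ n → g n ≤ poly a d n
pb-poly (a , d , p) = (3 + a) ^ suc d , suc d , λ n → ≤-trans (p n) (raise n)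
  where
  raise : ∀ n → (2 + a + n) ^ suc d ≤ poly ((3 + a) ^ suc d) (suc d) n
  raise zero = m≤n⇒m≤o+n ((3 + a) ^ suc d * 0 ^ suc d) (^-monoˡ-≤ (suc d) (≤-trans (≤-reflexive (+-identityʳ (2 + a))) (n≤1+n _)))
  raise (suc n) = ≤-trans (^-monoˡ-≤ (suc d) (≤-by ((2 + a) * n) (expand a n)))
    (≤-trans (≤-reflexive (^-distrib-* (3 + a) (suc n) (suc d))) (m≤m+n _ _))
    where
    expand : ∀ a n → (2 + a + (1 + n)) + (2 + a) * n ≡ (3 + a) * (1 + n)
    expand = solve-∀

pop-run : ∀ {k j p q r L σ L₁ σ₁ σ′ t} b {xs} → lookup {n = k} σ j ≡ b ∷ xs → σ [ j ]≔ xs ≡ σ′ →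
  StackRun (if b then r else q) L σ′ L₁ σ₁ t → StackRun (case j p q r) L σ L₁ σ₁ (suc t)
pop-run false eq refl r = case0 eq r
pop-run true  eq refl r = case1 eq r

push-run : ∀ {k j b L σ σ′} → _[_]≔_ {n = k} σ j (b ∷ lookup σ j) ≡ σ′ → StackRun (push j b) L σ L σ′ 1
push-run refl = push

loop-time : ∀ {k j p L σ L₁ σ₁ s t} → s ≡ t → StackLoop {k} j p L σ L₁ σ₁ s → StackLoop j p L σ L₁ σ₁ t
loop-time refl l = l

transfer : ∀ {k} (from to : Fin k) → StackProg k
transfer i j = while i (case i skip (push j false) (push j true))

-- The bits go to `scratch` and come back at the end, so the source survives the loop. The body
-- depends on the bit, which is how the input is read.
foreach : ∀ {k} (source scratch : Fin k) → (Bool → StackProg k) → StackProg k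
foreach i j f = while i (case i skip (f false ⨟ push j false) (f true ⨟ push j true)) ⨟ transfer j i

-- `view` exposes the two stacks that the loop moves and hides all others behind a parameter of type
-- `A`; the four laws say that source and scratch can be read and set independently.
module Foreach {k : ℕ} {A : Set} (i j : Fin k) (f : Bool → StackProg k) (view : List Bool → List Bool → A → Stacks k)
  (look-source : ∀ s xs a → lookup (view s xs a) i ≡ xs) (set-source : ∀ s xs a ys → view s xs a [ i ]≔ ys ≡ view s ys a)
  (look-scratch : ∀ s xs a → lookup (view s xs a) j ≡ s) (set-scratch : ∀ s xs a ys → view s xs a [ j ]≔ ys ≡ view ys xs a)
  where

  push-scratch : ∀ {L} b s xs a → StackRun (push j b) L (view s xs a) L (view (b ∷ s) xs a) 1
  push-scratch b s xs a = push-run (trans (cong (λ ys → view s xs a [ j ]≔ (b ∷ ys)) (look-scratch s xs a)) (set-scratch s xs a (b ∷ s)))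

  push-source : ∀ {L} b s xs a → StackRun (push i b) L (view s xs a) L (view s (b ∷ xs) a) 1
  push-source b s xs a = push-run (trans (cong (λ ys → view s xs a [ i ]≔ (b ∷ ys)) (look-source s xs a)) (set-source s xs a (b ∷ xs)))

  module _ {L : List Bool} (next : Bool → List Bool → List Bool → A → A) (P : List Bool → List Bool → A → Set) (t : ℕ)
    (body : ∀ b s xs a → P s (b ∷ xs) a → StackRun (f b) L (view s xs a) L (view s xs (next b s xs a)) t × P (b ∷ s) xs (next b s xs a))
    where

    result : List Bool → List Bool → A → A
    result s []       a = a
    result s (b ∷ xs) a = result (b ∷ s) xs (next b s xs a)

    forward : ∀ s xs a → P s xs a → StackLoop i (case i skip (f false ⨟ push j false) (f true ⨟ push j true))
      L (view s xs a) L (view (xs ʳ++ s) [] (result s xs a)) (suc (length xs * (3 + t)))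
    forward s []       a p = done (look-source s [] a)
    forward s (b ∷ xs) a p with body b s xs a p
    ... | r , p′ = loop-time (cong suc (shape t (length xs * (3 + t))))
        (again (look-source s (b ∷ xs) a) (pop-run b (look-source s (b ∷ xs) a) (set-source s (b ∷ xs) a xs) (branch b r))
          (forward (b ∷ s) xs (next b s xs a) p′))
      where
      shape : ∀ t m → suc (t + 1) + suc m ≡ 3 + t + m
      shape = solve-∀
      branch : ∀ b → StackRun (f b) L (view s xs a) L (view s xs (next b s xs a)) t →
        StackRun (if b then f true ⨟ push j true else f false ⨟ push j false) L (view s xs a) L (view (b ∷ s) xs (next b s xs a)) (t + 1)
      branch false r = r ⨟ push-scratch false s xs _
      branch true  r = r ⨟ push-scratch true s xs _

    backward : ∀ s xs a → StackLoop j (case j skip (push i false) (push i true))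
      L (view s xs a) L (view [] (s ʳ++ xs) a) (suc (length s * 3))
    backward []      xs a = done (look-scratch [] xs a)
    backward (b ∷ s) xs a = again (look-scratch (b ∷ s) xs a) (pop-run b (look-scratch (b ∷ s) xs a) (set-scratch (b ∷ s) xs a s) (branch b))
        (backward s (b ∷ xs) a)
      where
      branch : ∀ b → StackRun (if b then push i true else push i false) L (view s xs a) L (view s (b ∷ xs) a) 1
      branch false = push-source false s xs a
      branch true  = push-source true s xs a

    foreach-run : ∀ xs a {B} → length xs ≤ B → P [] xs a →
      StackRun (foreach i j f) L (view [] xs a) L (view [] xs (result [] xs a)) (B * (t + 6) + 4)
    foreach-run xs a {B} le p = weak (≤-trans (≤-reflexive time) (+-monoˡ-≤ 4 (*-monoˡ-≤ (t + 6) le))) (while (forward [] xs a p) ⨟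
        while (subst (λ ys → StackLoop j (case j skip (push i false) (push i true)) L (view (xs ʳ++ []) [] (result [] xs a)) L (view [] ys (result [] xs a)) (suc (length (xs ʳ++ []) * 3)))
          back (backward (xs ʳ++ []) [] (result [] xs a))))
      where
      back : (xs ʳ++ []) ʳ++ [] ≡ xs
      back = trans (Listₚ.ʳ++-ʳ++ xs) (Listₚ.++-identityʳ xs)
      shape : ∀ l t → suc (suc (l * (3 + t))) + suc (suc (l * 3)) ≡ l * (t + 6) + 4
      shape = solve-∀
      time : suc (suc (length xs * (3 + t))) + suc (suc (length (xs ʳ++ []) * 3)) ≡ length xs * (t + 6) + 4
      time rewrite Listₚ.length-ʳ++ xs {[]} | +-identityʳ (length xs) = shape (length xs) t

-- Stacks 0-3 are scratch (stack 1 holds a number in binary), stack 4 collects what is emitted, last bit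
-- on top, and the others are read as counters by their lengths.
pattern tmpᵢ   = zero
pattern numᵢ   = suc zero
pattern flagᵢ  = suc (suc zero)
pattern carryᵢ = suc (suc (suc zero))
pattern emitᵢ  = suc (suc (suc (suc zero)))
pattern ctrᵢ r = suc (suc (suc (suc (suc r))))

emit : ∀ {κ} → List Bool → StackProg (5 + κ)
emit []       = skip
emit (b ∷ bs) = push emitᵢ b ⨟ emit bs

emit-run : ∀ {κ L u k g h o} {cs : Stacks κ} bs →
  StackRun (emit bs) L (u ∷ k ∷ g ∷ h ∷ o ∷ cs) L (u ∷ k ∷ g ∷ h ∷ (bs ʳ++ o) ∷ cs) (suc (length bs))
emit-run []       = skip
emit-run (b ∷ bs) = push ⨟ emit-run bs

-- The lowest digit is on top; `false` stands for the digit 1 and `true` for 2. Adding one turns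
-- each leading 2 into 1 and carries on, until a 1 becomes 2 or the number ends and receives a new
-- 1. Stack `flagᵢ` is nonempty while the carry is under way. The digits passed are only counted on
-- `carryᵢ`, since all of them return as `false`.
carry increment emitNumber : ∀ {κ} → StackProg (5 + κ)
carry = case numᵢ (push numᵢ false) (push numᵢ true) (push carryᵢ true ⨟ push flagᵢ true)
increment = push flagᵢ true ⨟ while flagᵢ (case flagᵢ skip carry carry) ⨟
  while carryᵢ (case carryᵢ skip (push numᵢ false) (push numᵢ false))
emitNumber = while numᵢ (case numᵢ skip (push emitᵢ false ⨟ push emitᵢ false) (push emitᵢ true ⨟ push emitᵢ true)) ⨟
  push emitᵢ false ⨟ push emitᵢ true

increments : ∀ {κ} → ℕ → StackProg (5 + κ)
increments zero    = skip
increments (suc n) = increment ⨟ increments n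

prependFalse : List Bool → List Bool → List Bool
prependFalse []       k = k
prependFalse (_ ∷ hs) k = prependFalse hs (false ∷ k)

stop-time : ∀ l → suc (suc (suc (7 + 5 * l)) + 1) ≡ suc (5 * suc (suc l))
stop-time l = cong ℕ.suc (trans (+-comm _ 1) (sym (trans (*-suc 5 (suc l)) (cong (λ y → 5 + y) (*-suc 5 l)))))

carry-time : ∀ l → suc (suc (suc (1 + 1)) + suc (5 * suc l)) ≡ suc (5 * suc (suc l))
carry-time l = cong ℕ.suc (sym (*-suc 5 (suc l)))

module _ {κ : ℕ} {L u o : List Bool} {cs : Stacks κ} where

  -- The stack `h` of digits already passed is owed as `false` digits on top. Counting this debt in,
  -- through `prependFalse`, is the invariant that makes the induction go through.
  carry-run : ∀ b h → Σ[ k ∈ List Bool ] Σ[ h′ ∈ List Bool ]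
    StackLoop flagᵢ (case flagᵢ skip carry carry) L (u ∷ digits b ∷ (true ∷ []) ∷ h ∷ o ∷ cs) L (u ∷ k ∷ [] ∷ h′ ∷ o ∷ cs) (suc (5 * suc (length (digits b))))
      × prependFalse h′ k ≡ prependFalse h (digits (sucᵇ b)) × length h′ ≤ length h + length (digits b)
  carry-run zeroᵇ h = _ , _ , again refl (case1 refl (caseE refl (weak {t = 2} (s≤s z≤n) push))) (done refl) , refl , ≤-reflexive (sym (+-identityʳ _))
  carry-run 1+[2 x ] h = _ , _ , loop-time (stop-time (length (digits x)))
      (again refl (case1 refl (case0 refl (weak {t = 7 + 5 * length (digits x)} (s≤s z≤n) push))) (done refl) ) , refl , m≤m+n _ _
  carry-run 2[1+ x ] h with carry-run x (true ∷ h)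
  ... | k , h′ , r , eq , le = k , h′ , loop-time (carry-time (length (digits x)))
      (again refl (case1 refl (case1 refl (push ⨟ push))) r) , eq , ≤-trans le (≤-reflexive (sym (+-suc (length h) _)))

  uncarry-run : ∀ k h → StackLoop carryᵢ (case carryᵢ skip (push numᵢ false) (push numᵢ false))
    L (u ∷ k ∷ [] ∷ h ∷ o ∷ cs) L (u ∷ prependFalse h k ∷ [] ∷ [] ∷ o ∷ cs) (suc (length h * 3))
  uncarry-run k []          = done refl
  uncarry-run k (false ∷ h) = again refl (case0 refl push) (uncarry-run (false ∷ k) h)
  uncarry-run k (true ∷ h)  = again refl (case1 refl push) (uncarry-run (false ∷ k) h)

toBin-suc : ∀ n → toBin (suc n) ≡ sucᵇ (toBin n)
toBin-suc n = trans (fromℕ≡fromℕ' (suc n)) (cong sucᵇ (sym (fromℕ≡fromℕ' n)))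

length-digits-suc : ∀ b → length (digits (sucᵇ b)) ≤ suc (length (digits b))
length-digits-suc zeroᵇ    = ≤-refl
length-digits-suc 2[1+ x ] = s≤s (length-digits-suc x)
length-digits-suc 1+[2 x ] = n≤1+n _

length-digits : ∀ n → length (digits (toBin n)) ≤ n
length-digits zero    = z≤n
length-digits (suc n) rewrite toBin-suc n = ≤-trans (length-digits-suc (toBin n)) (s≤s (length-digits n))

counting : ∀ {κ} → List Bool → List Bool → Stacks κ → ℕ → Stacks (5 + κ)
counting u o cs v = u ∷ digits (toBin v) ∷ [] ∷ [] ∷ o ∷ cs

increment-run : ∀ {κ L u o} {cs : Stacks κ} v {V} → v ≤ V →
  StackRun increment L (counting u o cs v) L (counting u o cs (suc v)) (8 * V + 10)
increment-run {L = L} {u} {o} {cs} v {V} le with carry-run {L = L} {u} {o} {cs} (toBin v) []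
... | k , h , r , eq , h≤ = subst (λ ds → StackRun increment L (counting u o cs v) L (u ∷ ds ∷ [] ∷ [] ∷ o ∷ cs) (8 * V + 10))
    (trans eq (cong digits (sym (toBin-suc v))))
    (weak (≤-trans (+-monoʳ-≤ 1 (+-mono-≤ (s≤s (s≤s (*-monoʳ-≤ 5 (s≤s l≤)))) (s≤s (s≤s (*-monoˡ-≤ 3 (≤-trans h≤ l≤)))))) (≤-reflexive (time V)))
      (push ⨟ while r ⨟ while (uncarry-run k h)))
  where
  l≤ : length (digits (toBin v)) ≤ V
  l≤ = ≤-trans (length-digits v) le
  time : ∀ V → 1 + (suc (suc (5 * suc V)) + suc (suc (V * 3))) ≡ 8 * V + 10
  time = solve-∀

increments-run : ∀ {κ L u o} {cs : Stacks κ} n v {V} → v + n ≤ V →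
  StackRun (increments n) L (counting u o cs v) L (counting u o cs (v + n)) (n * (8 * V + 10) + 1)
increments-run {L = L} {u} {o} {cs} zero v le rewrite +-identityʳ v = skip
increments-run {L = L} {u} {o} {cs} (suc n) v {V} le rewrite +-suc v n =
  weak (≤-reflexive (sym (+-assoc (8 * V + 10) _ 1))) (increment-run v (≤-trans (m≤m+n v n) (<⇒≤ le)) ⨟ increments-run n (suc v) le)

emitNumber-loop : ∀ {κ L u o} {cs : Stacks κ} ds →
  StackRun emitNumber L (u ∷ ds ∷ [] ∷ [] ∷ o ∷ cs) L (u ∷ [] ∷ [] ∷ [] ∷ (selfDelim ds ʳ++ o) ∷ cs) (4 * length ds + 4)
emitNumber-loop {L = L} {u} {o} {cs} ds = subst (λ o′ → StackRun emitNumber L (u ∷ ds ∷ [] ∷ [] ∷ o ∷ cs) L (u ∷ [] ∷ [] ∷ [] ∷ o′ ∷ cs) (4 * length ds + 4)) (delimited ds o)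
  (weak (≤-reflexive (time (length ds))) (while (go ds o) ⨟ push ⨟ push))
  where
  doubled : List Bool → List Bool → List Bool
  doubled []       o = o
  doubled (b ∷ ds) o = doubled ds (b ∷ b ∷ o)
  go : ∀ ds o → StackLoop numᵢ _ L (u ∷ ds ∷ [] ∷ [] ∷ o ∷ cs) L (u ∷ [] ∷ [] ∷ [] ∷ doubled ds o ∷ cs) (suc (4 * length ds))
  go [] o = done refl
  go (false ∷ ds) o = loop-time (cong ℕ.suc (sym (*-suc 4 (length ds)))) (again refl (case0 refl (push ⨟ push)) (go ds (false ∷ false ∷ o)))
  go (true ∷ ds) o = loop-time (cong ℕ.suc (sym (*-suc 4 (length ds)))) (again refl (case1 refl (push ⨟ push)) (go ds (true ∷ true ∷ o)))
  delimited : ∀ ds o → true ∷ false ∷ doubled ds o ≡ selfDelim ds ʳ++ o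
  delimited []       o = refl
  delimited (b ∷ ds) o = delimited ds (b ∷ b ∷ o)
  time : ∀ l → suc (suc (4 * l)) + (1 + 1) ≡ 4 * l + 4
  time = solve-∀

-- Programs that emit bit strings

-- Abstract, since unfolding the binary representation makes type checking slow.
abstract
  encode : ℕ → List Bool
  encode = encℕ

  encode-encℕ : ∀ n → encode n ≡ encℕ n
  encode-encℕ n = refl

-- num emits the number given by a constant plus multiples of counters.
data Leaf (κ : ℕ) : Set where
  bits : List Bool → Leaf κ
  rep  : Fin κ → List Bool → Leaf κ
  num  : List (Fin κ × ℕ) → ℕ → Leaf κ

value : ∀ {κ} → List (Fin κ × ℕ) → ℕ → Stacks κ → ℕ
value []             v cs = v
value ((r , α) ∷ ls) v cs = value ls (v + length (lookup cs r) * α) cs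

outLeaf : ∀ {κ} → Leaf κ → Stacks κ → List Bool
outLeaf (bits bs)  cs = bs
outLeaf (rep r bs) cs = concat (replicate (length (lookup cs r)) bs)
outLeaf (num ls β) cs = encode (value ls β cs)

outLeaves : ∀ {κ} → List (Leaf κ) → Stacks κ → List Bool
outLeaves []       cs = []
outLeaves (l ∷ ls) cs = outLeaf l cs ++ outLeaves ls cs

addAll : ∀ {κ} → List (Fin κ × ℕ) → StackProg (5 + κ)
addAll []             = skip
addAll ((r , α) ∷ ls) = foreach (ctrᵢ r) tmpᵢ (λ _ → increments α) ⨟ addAll ls

leafProg : ∀ {κ} → Leaf κ → StackProg (5 + κ)
leafProg (bits bs)  = emit bs
leafProg (rep r bs) = foreach (ctrᵢ r) tmpᵢ (λ _ → emit bs)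
leafProg (num ls β) = increments β ⨟ addAll ls ⨟ emitNumber

leavesProg : ∀ {κ} → List (Leaf κ) → StackProg (5 + κ)
leavesProg []       = skip
leavesProg (l ∷ ls) = leafProg l ⨟ leavesProg ls

valueBound : ∀ {κ} → List (Fin κ × ℕ) → ℕ → ℕ → ℕ
valueBound []             v B = v
valueBound ((r , α) ∷ ls) v B = valueBound ls (v + B * α) B

addAllTime : ∀ {κ} → List (Fin κ × ℕ) → ℕ → ℕ → ℕ
addAllTime []             V B = 1
addAllTime ((r , α) ∷ ls) V B = (B * ((α * (8 * V + 10) + 1) + 6) + 4) + addAllTime ls V B

leafTime : ∀ {κ} → Leaf κ → ℕ → ℕ
leafTime (bits bs)  B = suc (length bs)
leafTime (rep r bs) B = B * (suc (length bs) + 6) + 4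
leafTime (num ls β) B = (β * (8 * V + 10) + 1) + (addAllTime ls V B + (4 * V + 4))
  where V = valueBound ls β B

leavesTime : ∀ {κ} → List (Leaf κ) → ℕ → ℕ
leavesTime []       B = 1
leavesTime (l ∷ ls) B = leafTime l B + leavesTime ls B

Small : ∀ {κ} → Stacks κ → ℕ → Set
Small cs B = ∀ r → length (lookup cs r) ≤ B

valueBound-mono : ∀ {κ} (ls : List (Fin κ × ℕ)) {v w B} → v ≤ w → valueBound ls v B ≤ valueBound ls w B
valueBound-mono []             le = le
valueBound-mono ((r , α) ∷ ls) le = valueBound-mono ls (+-monoˡ-≤ _ le)

≤-valueBound : ∀ {κ} (ls : List (Fin κ × ℕ)) v B → v ≤ valueBound ls v B
≤-valueBound []             v B = ≤-refl
≤-valueBound ((r , α) ∷ ls) v B = ≤-trans (m≤m+n v _) (≤-valueBound ls _ B)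

value≤ : ∀ {κ} (ls : List (Fin κ × ℕ)) v {B} {cs : Stacks κ} → Small cs B → value ls v cs ≤ valueBound ls v B
value≤ []             v sm = ≤-refl
value≤ ((r , α) ∷ ls) v {B} {cs} sm = ≤-trans (value≤ ls _ sm) (valueBound-mono ls (+-monoʳ-≤ v (*-monoˡ-≤ α (sm r))))

ready : ∀ {κ} → List Bool → Stacks κ → Stacks (5 + κ)
ready o cs = [] ∷ [] ∷ [] ∷ [] ∷ o ∷ cs

module _ {κ : ℕ} {L : List Bool} where

  module Counter {A : Set} (r : Fin κ) (f : Bool → StackProg (5 + κ)) (cs : Stacks κ) (k o : A → List Bool) where
    open Foreach {5 + κ} {A} (ctrᵢ r) tmpᵢ f (λ s xs a → s ∷ k a ∷ [] ∷ [] ∷ o a ∷ (cs [ r ]≔ xs))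
      (λ s xs a → Vecₚ.lookup∘update r cs xs) (λ s xs a ys → cong (λ cs → s ∷ k a ∷ [] ∷ [] ∷ o a ∷ cs) (Vecₚ.[]≔-idempotent cs r))
      (λ s xs a → refl) (λ s xs a ys → refl) public

  module _ (B : ℕ) where
    addAll-run : ∀ ls v {V o cs} → Small cs B → valueBound ls v B ≤ V →
      StackRun (addAll ls) L (counting [] o cs v) L (counting [] o cs (value ls v cs)) (addAllTime ls V B)
    addAll-run [] v sm le = skip
    addAll-run ((r , α) ∷ ls) v {V} {o} {cs} sm le =
      subst₂ (λ cs′ w → StackRun (foreach (ctrᵢ r) tmpᵢ (λ _ → increments α)) L (counting [] o cs′ v) L (counting [] o cs′ w) (B * ((α * (8 * V + 10) + 1) + 6) + 4))
        (Vecₚ.[]≔-lookup cs r) (added [] (lookup cs r) v)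
        (foreach-run next P (α * (8 * V + 10) + 1) body-run (lookup cs r) v (sm r)
          (≤-trans (+-monoʳ-≤ v (*-monoˡ-≤ α (sm r))) (≤-trans (≤-valueBound ls _ B) le)))
      ⨟ addAll-run ls (v + length (lookup cs r) * α) sm (≤-trans (valueBound-mono ls (+-monoʳ-≤ v (*-monoˡ-≤ α (sm r)))) le)
      where
      open Counter r (λ _ → increments α) cs (λ v → digits (toBin v)) (λ _ → o)
      next : Bool → List Bool → List Bool → ℕ → ℕ
      next _ _ _ v = v + α
      P : List Bool → List Bool → ℕ → Set
      P s xs v = v + length xs * α ≤ V
      body-run : ∀ b s xs v → P s (b ∷ xs) v → StackRun (increments α) L (counting s o (cs [ r ]≔ xs) v) L (counting s o (cs [ r ]≔ xs) (v + α)) (α * (8 * V + 10) + 1) × P (b ∷ s) xs (v + α)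
      body-run b s xs v p = increments-run α v (≤-trans (m≤m+n (v + α) _) p′) , p′
        where
        p′ : v + α + length xs * α ≤ V
        p′ = subst (_≤ V) (sym (+-assoc v α _)) p
      added : ∀ s xs v → result next P (α * (8 * V + 10) + 1) body-run s xs v ≡ v + length xs * α
      added s []       v = sym (+-identityʳ v)
      added s (b ∷ xs) v = trans (added (b ∷ s) xs (v + α)) (+-assoc v α _)

    leaf-run : ∀ l {o cs} → Small cs B → StackRun (leafProg l) L (ready o cs) L (ready (outLeaf l cs ʳ++ o) cs) (leafTime l B)
    leaf-run (bits bs) sm = emit-run bs
    leaf-run (rep r bs) {o} {cs} sm =
      subst₂ (λ cs′ o′ → StackRun (foreach (ctrᵢ r) tmpᵢ (λ _ → emit bs)) L (ready o cs′) L (ready o′ cs′) (leafTime {κ} (rep r bs) B))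
        (Vecₚ.[]≔-lookup cs r) (repeated [] (lookup cs r) o)
        (foreach-run (λ _ _ _ o → bs ʳ++ o) (λ _ _ _ → ⊤) (suc (length bs)) (λ _ _ _ _ _ → emit-run bs , tt) (lookup cs r) o (sm r) tt)
      where
      open Counter r (λ _ → emit bs) cs (λ _ → []) (λ o → o)
      repeated : ∀ s xs o → result {L = L} (λ _ _ _ o → bs ʳ++ o) (λ _ _ _ → ⊤) (suc (length bs)) (λ _ _ _ _ _ → emit-run bs , tt) s xs o
        ≡ concat (replicate (length xs) bs) ʳ++ o
      repeated s []       o = refl
      repeated s (b ∷ xs) o = trans (repeated (b ∷ s) xs (bs ʳ++ o)) (sym (Listₚ.++-ʳ++ bs))
    leaf-run (num ls β) {o} {cs} sm = increments-run β 0 (≤-valueBound ls β B) ⨟ addAll-run ls β sm ≤-refl ⨟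
      weak (+-monoˡ-≤ 4 (*-monoʳ-≤ 4 (≤-trans (length-digits v) (value≤ ls β {cs = cs} sm))))
        (subst (λ bs → StackRun emitNumber L (counting [] o cs v) L (ready (bs ʳ++ o) cs) (4 * length (digits (toBin v)) + 4)) (sym (encode-encℕ v)) (emitNumber-loop (digits (toBin v))))
      where v = value ls β cs

    leaves-run : ∀ ls {o cs} → Small cs B → StackRun (leavesProg ls) L (ready o cs) L (ready (outLeaves ls cs ʳ++ o) cs) (leavesTime ls B)
    leaves-run [] sm = skip
    leaves-run (l ∷ ls) {o} {cs} sm = leaf-run l sm ⨟ subst (λ o′ → StackRun (leavesProg ls) L (ready (outLeaf l cs ʳ++ o) cs) L (ready o′ cs) (leavesTime ls B))
      (sym (Listₚ.++-ʳ++ (outLeaf l cs))) (leaves-run ls sm)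

-- In a loop over a counter, counter 0 is the number of past iterations, and the counter itself shows
-- the number of those to come.
data Top (κ : ℕ) : Set where
  straight : List (Leaf (suc κ)) → Top κ
  for      : Fin κ → (Bool → List (Leaf (suc κ))) → Top κ

outFor : ∀ {κ} → (Bool → List (Leaf (suc κ))) → Stacks κ → Fin κ → List Bool → List Bool → List Bool
outFor body ds r s []       = []
outFor body ds r s (b ∷ xs) = outLeaves (body b) (s ∷ (ds [ r ]≔ xs)) ++ outFor body ds r (b ∷ s) xs

outTop : ∀ {κ} → Top κ → Stacks κ → List Bool
outTop (straight ls) ds = outLeaves ls ([] ∷ ds)
outTop (for r body)  ds = outFor body ds r [] (lookup ds r)

outTops : ∀ {κ} → List (Top κ) → Stacks κ → List Bool
outTops []       ds = []
outTops (t ∷ ts) ds = outTop t ds ++ outTops ts ds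

topProg : ∀ {κ} → Top κ → StackProg (6 + κ)
topProg (straight ls) = leavesProg ls
topProg (for r body)  = foreach (ctrᵢ (suc r)) (ctrᵢ zero) (λ b → leavesProg (body b))

topsProg : ∀ {κ} → List (Top κ) → StackProg (6 + κ)
topsProg []       = skip
topsProg (t ∷ ts) = topProg t ⨟ topsProg ts

topTime : ∀ {κ} → Top κ → ℕ → ℕ
topTime (straight ls) B = leavesTime ls B
topTime (for r body)  B = B * ((leavesTime (body false) B + leavesTime (body true) B) + 6) + 4

topsTime : ∀ {κ} → List (Top κ) → ℕ → ℕ
topsTime []       B = 1
topsTime (t ∷ ts) B = topTime t B + topsTime ts B

small-set : ∀ {κ} {ds : Stacks κ} {B} r {xs} → length xs ≤ B → Small ds B → Small (ds [ r ]≔ xs) B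
small-set {ds = ds} {B} r {xs} le sm i with i Fin.≟ r
... | yes refl = subst (λ ys → length ys ≤ B) (sym (Vecₚ.lookup∘update i ds xs)) le
... | no i≢r   = subst (λ ys → length ys ≤ B) (sym (Vecₚ.lookup∘update′ i≢r ds xs)) (sm i)

small-cons : ∀ {κ} {ds : Stacks κ} {B s} → length s ≤ B → Small ds B → Small (s ∷ ds) B
small-cons le sm zero    = le
small-cons le sm (suc i) = sm i

module _ {κ : ℕ} {L : List Bool} (B : ℕ) where

  top-run : ∀ t {o} {ds : Stacks κ} → Small ds B →
    StackRun (topProg t) L (ready o ([] ∷ ds)) L (ready (outTop t ds ʳ++ o) ([] ∷ ds)) (topTime t B)
  top-run (straight ls) sm = leaves-run B ls (small-cons z≤n sm)
  top-run (for r body) {o} {ds} sm =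
      subst₂ (λ ds′ o′ → StackRun (foreach (ctrᵢ (suc r)) (ctrᵢ zero) (λ b → leavesProg (body b))) L (ready o ([] ∷ ds′)) L (ready o′ ([] ∷ ds′)) (topTime (for r body) B))
        (Vecₚ.[]≔-lookup ds r) (collected [] (lookup ds r) o)
        (foreach-run next P time body-run (lookup ds r) o (sm r) (sm r))
    where
    open Foreach {6 + κ} {List Bool} (ctrᵢ (suc r)) (ctrᵢ zero) (λ b → leavesProg (body b)) (λ s xs o → ready o (s ∷ (ds [ r ]≔ xs)))
      (λ s xs o → Vecₚ.lookup∘update r ds xs) (λ s xs o ys → cong (λ ds → ready o (s ∷ ds)) (Vecₚ.[]≔-idempotent ds r))
      (λ s xs o → refl) (λ s xs o ys → refl)
    time = leavesTime (body false) B + leavesTime (body true) B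
    next : Bool → List Bool → List Bool → List Bool → List Bool
    next b s xs o = outLeaves (body b) (s ∷ (ds [ r ]≔ xs)) ʳ++ o
    P : List Bool → List Bool → List Bool → Set
    P s xs o = length s + length xs ≤ B
    time≤ : ∀ b → leavesTime (body b) B ≤ time
    time≤ false = m≤m+n _ _
    time≤ true  = m≤n+m _ _
    body-run : ∀ b s xs o → P s (b ∷ xs) o →
      StackRun (leavesProg (body b)) L (ready o (s ∷ (ds [ r ]≔ xs))) L (ready (next b s xs o) (s ∷ (ds [ r ]≔ xs))) time × P (b ∷ s) xs (next b s xs o)
    body-run b s xs o p = weak (time≤ b) (leaves-run B (body b) (small-cons (≤-trans (m≤m+n _ _) p)
        (small-set {ds = ds} r {xs} (≤-trans (n≤1+n _) (≤-trans (m≤n+m _ (length s)) p)) sm))) , subst (_≤ B) (+-suc (length s) (length xs)) p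
    collected : ∀ s xs o → result next P time body-run s xs o ≡ outFor body ds r s xs ʳ++ o
    collected s []       o = refl
    collected s (b ∷ xs) o = trans (collected (b ∷ s) xs _) (sym (Listₚ.++-ʳ++ (outLeaves (body b) (s ∷ (ds [ r ]≔ xs)))))

  tops-run : ∀ ts {o} {ds : Stacks κ} → Small ds B →
    StackRun (topsProg ts) L (ready o ([] ∷ ds)) L (ready (outTops ts ds ʳ++ o) ([] ∷ ds)) (topsTime ts B)
  tops-run [] sm = skip
  tops-run (t ∷ ts) {o} {ds} sm = top-run t sm ⨟ subst (λ o′ → StackRun (topsProg ts) L (ready (outTop t ds ʳ++ o) ([] ∷ ds)) L (ready o′ ([] ∷ ds)) (topsTime ts B))
      (sym (Listₚ.++-ʳ++ (outTop t ds))) (tops-run ts sm)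

-- Each step sets one counter to what its loops emit.
Steps : ℕ → Set
Steps κ = List (Fin κ × List (Top κ))

exec : ∀ {κ} → Steps κ → Stacks κ → Stacks κ
exec []              ds = ds
exec ((r , ts) ∷ ps) ds = exec ps (ds [ r ]≔ outTops ts ds)

clear : ∀ {k} → Fin k → StackProg k
clear i = while i (case i skip skip skip)

setProg : ∀ {κ} → Fin κ → List (Top κ) → StackProg (6 + κ)
setProg r ts = topsProg ts ⨟ clear (ctrᵢ (suc r)) ⨟ transfer emitᵢ (ctrᵢ (suc r))

stepsProg : ∀ {κ} → Steps κ → StackProg (6 + κ)
stepsProg []              = skip
stepsProg ((r , ts) ∷ ps) = setProg r ts ⨟ stepsProg ps

module _ {κ : ℕ} {L : List Bool} (ds : Stacks κ) (r : Fin κ) where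
  private
    stored : List Bool → List Bool → Stacks (6 + κ)
    stored o xs = ready o ([] ∷ (ds [ r ]≔ xs))

    set-stored : ∀ o xs ys → stored o xs [ ctrᵢ (suc r) ]≔ ys ≡ stored o ys
    set-stored o xs ys = cong (λ ds → ready o ([] ∷ ds)) (Vecₚ.[]≔-idempotent ds r)

  open Foreach {6 + κ} {⊤} (ctrᵢ (suc r)) emitᵢ (λ _ → skip) (λ s xs _ → stored s xs)
    (λ s xs _ → Vecₚ.lookup∘update r ds xs) (λ s xs _ ys → set-stored s xs ys) (λ s xs _ → refl) (λ s xs _ ys → refl)

  store-run : ∀ o xs {B} → length o ≤ B → StackRun (transfer emitᵢ (ctrᵢ (suc r))) L (stored o xs) L (stored [] (o ʳ++ xs)) (suc (suc (B * 3)))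
  store-run o xs le = weak (s≤s (s≤s (*-monoˡ-≤ 3 le))) (while (backward {L = L} (λ _ _ _ a → a) (λ _ _ _ → ⊤) 1 (λ _ _ _ _ _ → skip , tt) o xs tt))

  clear-loop : ∀ o xs → StackLoop (ctrᵢ (suc r)) (case (ctrᵢ (suc r)) skip skip skip) L (stored o xs) L (stored o []) (suc (length xs * 3))
  clear-loop o []       = done (Vecₚ.lookup∘update r ds [])
  clear-loop o (b ∷ xs) = again (Vecₚ.lookup∘update r ds (b ∷ xs))
    (pop-run b (Vecₚ.lookup∘update r ds (b ∷ xs)) (set-stored o (b ∷ xs) xs) (either b)) (clear-loop o xs)
    where
    either : ∀ b → StackRun (if b then skip else skip) L (stored o xs) L (stored o xs) 1
    either false = skip
    either true  = skip

  clear-run : ∀ o {B} → length (lookup ds r) ≤ B → StackRun (clear (ctrᵢ (suc r))) L (ready o ([] ∷ ds)) L (stored o []) (suc (suc (B * 3)))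
  clear-run o {B} le = subst (λ ds′ → StackRun (clear (ctrᵢ (suc r))) L (ready o ([] ∷ ds′)) L (stored o []) (suc (suc (B * 3)))) (Vecₚ.[]≔-lookup ds r)
    (weak (s≤s (s≤s (*-monoˡ-≤ 3 le))) (while (clear-loop o (lookup ds r))))

small-within : ∀ {κ} {ds : Stacks κ} {B} → Small ds B → Within [] (ready [] ([] ∷ ds)) B
small-within {B = B} sm = z≤n , bounds
  where
  bounds : ∀ j → length (lookup (ready [] ([] ∷ _)) j) ≤ B
  bounds tmpᵢ           = z≤n
  bounds numᵢ           = z≤n
  bounds flagᵢ          = z≤n
  bounds carryᵢ         = z≤n
  bounds emitᵢ          = z≤n
  bounds (ctrᵢ zero)    = z≤n
  bounds (ctrᵢ (suc r)) = sm r

reverse-twice : ∀ (xs : List Bool) → (xs ʳ++ []) ʳ++ [] ≡ xs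
reverse-twice xs = trans (Listₚ.ʳ++-ʳ++ xs) (Listₚ.++-identityʳ xs)

-- The emitted word is left on a stack, and stacks grow by at most one bit in each step, so its
-- length is read off from the running time.
length-outTops : ∀ {κ} ts {ds : Stacks κ} {B} → Small ds B → length (outTops ts ds) ≤ topsTime ts B + B
length-outTops ts {ds} {B} sm = ≤-trans (≤-reflexive (sym (trans (Listₚ.length-ʳ++ (outTops ts ds)) (+-identityʳ _))))
  (Within.stack-within (run-within (tops-run B ts sm) (small-within sm)) emitᵢ)

setTime : ∀ {κ} → List (Top κ) → ℕ → ℕ
setTime ts B = topsTime ts B + (suc (suc (B * 3)) + suc (suc ((topsTime ts B + B) * 3)))

set-run : ∀ {κ} r ts {ds : Stacks κ} {B} → Small ds B →
  StackRun (setProg r ts) [] (ready [] ([] ∷ ds)) [] (ready [] ([] ∷ (ds [ r ]≔ outTops ts ds))) (setTime ts B)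
set-run r ts {ds} {B} sm = tops-run B ts sm ⨟ clear-run ds r (outTops ts ds ʳ++ []) (sm r) ⨟
  subst (λ ys → StackRun (transfer emitᵢ (ctrᵢ (suc r))) [] (ready (outTops ts ds ʳ++ []) ([] ∷ (ds [ r ]≔ []))) [] (ready [] ([] ∷ (ds [ r ]≔ ys))) _)
    (reverse-twice (outTops ts ds))
    (store-run ds r (outTops ts ds ʳ++ []) [] (≤-trans (≤-reflexive (trans (Listₚ.length-ʳ++ (outTops ts ds)) (+-identityʳ _))) (length-outTops ts sm)))

pb-valueBound : ∀ {κ} (ls : List (Fin κ × ℕ)) {v B} → PolyBounded v → PolyBounded B → PolyBounded (λ n → valueBound ls (v n) (B n))
pb-valueBound []             pv pB = pv
pb-valueBound ((r , α) ∷ ls) pv pB = pb-valueBound ls (pb-+ pv (pb-* pB (pb-const α))) pB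

pb-addAll : ∀ {κ} (ls : List (Fin κ × ℕ)) {V B} → PolyBounded V → PolyBounded B → PolyBounded (λ n → addAllTime ls (V n) (B n))
pb-addAll []             pV pB = pb-const 1
pb-addAll ((r , α) ∷ ls) pV pB = pb-+ (pb-+ (pb-* pB (pb-+ (pb-+ (pb-* (pb-const α) (pb-+ (pb-* (pb-const 8) pV) (pb-const 10))) (pb-const 1)) (pb-const 6))) (pb-const 4))
  (pb-addAll ls pV pB)

pb-leaf : ∀ {κ} (l : Leaf κ) {B} → PolyBounded B → PolyBounded (λ n → leafTime l (B n))
pb-leaf (bits bs)  pB = pb-const (suc (length bs))
pb-leaf (rep r bs) pB = pb-+ (pb-* pB (pb-const (suc (length bs) + 6))) (pb-const 4)
pb-leaf (num ls β) pB = pb-+ (pb-+ (pb-* (pb-const β) (pb-+ (pb-* (pb-const 8) pV) (pb-const 10))) (pb-const 1))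
  (pb-+ (pb-addAll ls pV pB) (pb-+ (pb-* (pb-const 4) pV) (pb-const 4)))
  where pV = pb-valueBound ls (pb-const β) pB

pb-leaves : ∀ {κ} (ls : List (Leaf κ)) {B} → PolyBounded B → PolyBounded (λ n → leavesTime ls (B n))
pb-leaves []       pB = pb-const 1
pb-leaves (l ∷ ls) pB = pb-+ (pb-leaf l pB) (pb-leaves ls pB)

pb-tops : ∀ {κ} (ts : List (Top κ)) {B} → PolyBounded B → PolyBounded (λ n → topsTime ts (B n))
pb-tops []                 pB = pb-const 1
pb-tops (straight ls ∷ ts) pB = pb-+ (pb-leaves ls pB) (pb-tops ts pB)
pb-tops (for r body ∷ ts)  pB = pb-+ (pb-+ (pb-* pB (pb-+ (pb-+ (pb-leaves (body false) pB) (pb-leaves (body true) pB)) (pb-const 6))) (pb-const 4)) (pb-tops ts pB)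

PolySmall : ∀ {κ} → (List Bool → Stacks κ) → Set
PolySmall ds = Σ[ B ∈ (ℕ → ℕ) ] PolyBounded B × (∀ x → Small (ds x) (B (length x)))

-- Each step replaces the bound on the counters by a polynomial in it. The number of steps is
-- independent of the input, so the composed bound is still polynomial.
steps-run : ∀ {κ} (ps : Steps κ) (ds : List Bool → Stacks κ) → PolySmall ds →
  PolySmall (exec ps ∘ ds) × (Σ[ t ∈ (ℕ → ℕ) ] PolyBounded t ×
    (∀ x → StackRun (stepsProg ps) [] (ready [] ([] ∷ ds x)) [] (ready [] ([] ∷ exec ps (ds x))) (t (length x))))
steps-run [] ds sm = sm , (λ _ → 1) , pb-const 1 , λ x → skip
steps-run ((r , ts) ∷ ps) ds (B , pB , sm)
  with steps-run ps (λ x → ds x [ r ]≔ outTops ts (ds x))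
    ((λ n → topsTime ts (B n) + B n) , pb-+ (pb-tops ts pB) pB , λ x → small-set {ds = ds x} r {outTops ts (ds x)} (length-outTops ts (sm x)) (λ i → ≤-trans (sm x i) (m≤n+m _ _)))
... | sm′ , t , pt , run-rest = sm′ , (λ n → setTime ts (B n) + t n) ,
  pb-+ (pb-+ (pb-tops ts pB) (pb-+ (pb-suc (pb-suc (pb-* pB (pb-const 3)))) (pb-suc (pb-suc (pb-* (pb-+ (pb-tops ts pB) pB) (pb-const 3)))))) pt ,
  λ x → set-run r ts (sm x) ⨟ run-rest x

write-out : ∀ {κ} → StackProg (6 + κ)
write-out = while emitᵢ (case emitᵢ skip (out false) (out true))

write-out-run : ∀ {κ L} {ds : Stacks κ} xs → StackLoop emitᵢ (case emitᵢ skip (out false) (out true))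
  L (ready xs ([] ∷ ds)) (xs ʳ++ L) (ready [] ([] ∷ ds)) (suc (length xs * 3))
write-out-run []           = done refl
write-out-run (false ∷ xs) = again refl (case0 refl out) (write-out-run xs)
write-out-run (true ∷ xs)  = again refl (case1 refl out) (write-out-run xs)

start : ∀ {κ} → List Bool → Stacks (suc κ)
start x = x ∷ Vec.replicate _ []

evaluate : ∀ {κ} → Steps (suc κ) → List (Top (suc κ)) → List Bool → List Bool
evaluate ps ts x = outTops ts (exec ps (start x))

evaluate-polytime : ∀ {κ} (ps : Steps (suc κ)) (ts : List (Top (suc κ))) → PolyTimeComputable (evaluate ps ts)
evaluate-polytime {κ} ps ts = finished (steps-run ps start start-small)
  where
  start-small : PolySmall start
  start-small = (λ n → n) , pb-id , λ { x zero → ≤-refl ; x (suc i) → subst (λ ys → length ys ≤ length x) (sym (Vecₚ.lookup-replicate i [])) z≤n }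

  prog : StackProg (7 + κ)
  -- Loading has left the input reversed on `emitᵢ`; the transfer turns it round again.
  prog = transfer emitᵢ (ctrᵢ (suc zero)) ⨟ stepsProg ps ⨟ topsProg ts ⨟ write-out

  finished : PolySmall (exec ps ∘ start) × (Σ[ t ∈ (ℕ → ℕ) ] PolyBounded t ×
    (∀ x → StackRun (stepsProg ps) [] (ready [] ([] ∷ start x)) [] (ready [] ([] ∷ exec ps (start x))) (t (length x)))) →
    PolyTimeComputable (evaluate ps ts)
  finished ((B , pB , sm) , t , pt , steps) = machine (Layout.whole (7 + κ) emitᵢ prog) , proj₁ bounded , proj₁ (proj₂ bounded) ,
      λ x → computes x (stack-run-computes emitᵢ prog x (runs x))
    where
    time : ℕ → ℕ
    time n = suc (suc (n * 3)) + (t n + (topsTime ts (B n) + suc (suc ((topsTime ts (B n) + B n) * 3))))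

    pb-time : PolyBounded time
    pb-time = pb-+ (pb-suc (pb-suc (pb-* pb-id (pb-const 3)))) (pb-+ pt (pb-+ (pb-tops ts pB) (pb-suc (pb-suc (pb-* (pb-+ (pb-tops ts pB) pB) (pb-const 3))))))

    total : ℕ → ℕ
    total n = (2 + (time n + n)) * (16 * Layout.bound (7 + κ) (time n + n))

    bounded : Σ[ a ∈ ℕ ] Σ[ d ∈ ℕ ] ∀ n → total n ≤ poly a d n
    bounded = pb-poly (pb-* (pb-+ (pb-const 2) (pb-+ pb-time pb-id)) (pb-* (pb-const 16)
      (pb-* (pb-suc (pb-+ pb-time pb-id)) (pb-const (8 + κ + 4)))))

    runs : ∀ x → StackRun prog [] (Vec.replicate (7 + κ) [] [ emitᵢ ]≔ (x ʳ++ [])) (evaluate ps ts x) (ready [] ([] ∷ exec ps (start x))) (time (length x))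
    runs x = subst (λ ys → StackRun (transfer emitᵢ (ctrᵢ (suc zero))) [] (ready (x ʳ++ []) ([] ∷ start [])) [] (ready [] ([] ∷ start ys)) (suc (suc (length x * 3))))
          (reverse-twice x) (store-run (start []) zero (x ʳ++ []) [] (≤-reflexive (trans (Listₚ.length-ʳ++ x) (+-identityʳ _))))
      ⨟ steps x ⨟ tops-run (B (length x)) ts (sm x) ⨟
      subst (λ ys → StackRun write-out [] (ready (evaluate ps ts x ʳ++ []) ([] ∷ exec ps (start x))) ys (ready [] ([] ∷ exec ps (start x))) _) (reverse-twice (evaluate ps ts x))
        (weak (s≤s (s≤s (*-monoˡ-≤ 3 (≤-trans (≤-reflexive (trans (Listₚ.length-ʳ++ (evaluate ps ts x)) (+-identityʳ _))) (length-outTops ts (sm x))))))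
          (while (write-out-run (evaluate ps ts x ʳ++ []))))

    computes : ∀ x → (Σ[ t′ ∈ ℕ ] t′ ≤ total (length x) × RunsTo (machine (Layout.whole (7 + κ) emitᵢ prog)) x t′ (evaluate ps ts x)) →
      Σ[ t′ ∈ ℕ ] t′ ≤ poly (proj₁ bounded) (proj₁ (proj₂ bounded)) (length x) × RunsTo (machine (Layout.whole (7 + κ) emitᵢ prog)) x t′ (evaluate ps ts x)
    computes x (t′ , le , r) = t′ , ≤-trans le (proj₂ (proj₂ bounded) (length x)) , r

-- The graph and its covers

∑ : ∀ {A : Set} → List A → (A → ℕ) → ℕ
∑ []       f = 0
∑ (x ∷ xs) f = f x + ∑ xs f

ind : Bool → ℕ
ind b = if b then 1 else 0

module _ {A : Set} where
  ∑-cong : ∀ xs {f g : A → ℕ} → (∀ x → f x ≡ g x) → ∑ xs f ≡ ∑ xs g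
  ∑-cong []       eq = refl
  ∑-cong (x ∷ xs) eq = cong₂ _+_ (eq x) (∑-cong xs eq)

  ∑-mono : ∀ xs {f g : A → ℕ} → (∀ x → f x ≤ g x) → ∑ xs f ≤ ∑ xs g
  ∑-mono []       le = z≤n
  ∑-mono (x ∷ xs) le = +-mono-≤ (le x) (∑-mono xs le)

  ∑-++ : ∀ xs ys (f : A → ℕ) → ∑ (xs ++ ys) f ≡ ∑ xs f + ∑ ys f
  ∑-++ []       ys f = refl
  ∑-++ (x ∷ xs) ys f = trans (cong (λ s → f x + s) (∑-++ xs ys f)) (sym (+-assoc (f x) _ _))

  ∑-map : ∀ {B : Set} (g : B → A) xs (f : A → ℕ) → ∑ (map g xs) f ≡ ∑ xs (f ∘ g)
  ∑-map g []       f = refl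
  ∑-map g (x ∷ xs) f = cong (λ s → f (g x) + s) (∑-map g xs f)

module _ {A : Set} where
  ∑-product : ∀ {B : Set} xs (ys : List B) (f : A × B → ℕ) → ∑ (cartesianProduct xs ys) f ≡ ∑ xs (λ x → ∑ ys (λ y → f (x , y)))
  ∑-product []       ys f = refl
  ∑-product (x ∷ xs) ys f = trans (∑-++ (map (λ y → x , y) ys) _ f) (cong₂ _+_ (∑-map (λ y → x , y) ys f) (∑-product xs ys f))

  interchange : ∀ a b c d → (a + b) + (c + d) ≡ (a + c) + (b + d)
  interchange = solve-∀

  ∑-+ : ∀ xs (f g : A → ℕ) → ∑ xs (λ x → f x + g x) ≡ ∑ xs f + ∑ xs g
  ∑-+ []       f g = refl
  ∑-+ (x ∷ xs) f g = trans (cong (λ s → f x + g x + s) (∑-+ xs f g)) (interchange (f x) (g x) (∑ xs f) (∑ xs g))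

  ∑-const : ∀ (xs : List A) c → ∑ xs (λ _ → c) ≡ length xs * c
  ∑-const []       c = refl
  ∑-const (x ∷ xs) c = cong (λ s → c + s) (∑-const xs c)

  ∑-∈ : ∀ {x xs} (f : A → ℕ) → x ∈ xs → f x ≤ ∑ xs f
  ∑-∈ f (here refl) = m≤m+n _ _
  ∑-∈ {xs = y ∷ _} f (there x∈) = ≤-trans (∑-∈ f x∈) (m≤n+m _ (f y))

  -- No term of `f` is below that of `g`, so an excess in one term would not be made up elsewhere
  -- and would show in the total.
  ∑-tight : ∀ xs {f g : A → ℕ} → (∀ x → g x ≤ f x) → ∑ xs f ≤ ∑ xs g → ∀ {x} → x ∈ xs → f x ≤ g x
  ∑-tight (x ∷ xs) {f} {g} le total (here refl) =
    +-cancelʳ-≤ (∑ xs f) _ _ (≤-trans total (+-monoʳ-≤ (g x) (∑-mono xs le)))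
  ∑-tight (x ∷ xs) {f} {g} le total (there x∈) =
    ∑-tight xs le (+-cancelˡ-≤ (f x) _ _ (≤-trans total (+-monoˡ-≤ _ (le x)))) x∈

  ∑-single : ∀ {x xs} (f : A → ℕ) → Unique xs → x ∈ xs → (∀ y → y ≢ x → f y ≡ 0) → ∑ xs f ≡ f x
  ∑-single {x} f (nx ∷ un) (here refl) z = trans (cong (λ s → f x + s) (rest _ nx)) (+-identityʳ (f x))
    where
    rest : ∀ ys → All (x ≢_) ys → ∑ ys f ≡ 0
    rest []       []        = refl
    rest (y ∷ ys) (ne ∷ ns) = cong₂ _+_ (z y (ne ∘ sym)) (rest ys ns)
  ∑-single {x} {y ∷ ys} f (ny ∷ un) (there x∈) z = cong₂ _+_ (z y (All.lookup ny x∈)) (∑-single f un x∈ z)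

  sum-map : ∀ (f : A → ℕ) xs → sum (map f xs) ≡ ∑ xs f
  sum-map f []       = refl
  sum-map f (x ∷ xs) = cong (λ s → f x + s) (sum-map f xs)

  search : ∀ (P : A → Bool) xs → (Σ[ x ∈ A ] P x ≡ true) ⊎ (∀ {x} → x ∈ xs → P x ≡ false)
  search P []       = inj₂ λ ()
  search P (x ∷ xs) with P x in eq | search P xs
  ... | true  | _        = inj₁ (x , eq)
  ... | false | inj₁ r   = inj₁ r
  ... | false | inj₂ all = inj₂ λ { (here refl) → eq ; (there y∈) → all y∈ }

  lookup-unique : ∀ {xs : List A} → Unique xs → ∀ i j → List.lookup xs i ≡ List.lookup xs j → i ≡ j
  lookup-unique (nx ∷ un) zero    zero    eq = refl
  lookup-unique {x ∷ xs} (nx ∷ un) zero (suc j) eq = ⊥-elim (All.lookup nx (∈ₚ.∈-lookup j) eq)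
  lookup-unique {x ∷ xs} (nx ∷ un) (suc i) zero eq = ⊥-elim (All.lookup nx (∈ₚ.∈-lookup i) (sym eq))
  lookup-unique (nx ∷ un) (suc i) (suc j) eq = cong suc (lookup-unique un i j eq)

  map-allFin-lookup : ∀ {B : Set} (f : A → B) xs → map (f ∘ List.lookup xs) (allFin (length xs)) ≡ map f xs
  map-allFin-lookup f xs = trans (Listₚ.map-∘ (allFin (length xs)))
    (cong (map f) (trans (Listₚ.map-tabulate id (List.lookup xs)) (Listₚ.tabulate-lookup xs)))

∑-allFin : ∀ {n} (f : Fin (suc n) → ℕ) → ∑ (allFin (suc n)) f ≡ f zero + ∑ (allFin n) (f ∘ suc)
∑-allFin {n} f = cong (λ s → f zero + s) (trans (cong (λ xs → ∑ xs f) (sym (Listₚ.map-tabulate id suc))) (∑-map suc (allFin n) f))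

length-allFin : ∀ n → length (allFin n) ≡ n
length-allFin n = Listₚ.length-tabulate id

bools : List Bool
bools = false ∷ true ∷ []

same : Bool → Bool → Bool
same false b = not b
same true  b = b

same-sym : ∀ a b → same a b ≡ same b a
same-sym false false = refl
same-sym false true  = refl
same-sym true  false = refl
same-sym true  true  = refl

eqF-sym : ∀ {n} (i j : Fin n) → eqF i j ≡ eqF j i
eqF-sym i j with i Fin.≟ j
... | yes refl = sym (dec-true (i Fin.≟ i) refl)
... | no i≢j   = sym (dec-false (j Fin.≟ i) (i≢j ∘ sym))

eqF-refl : ∀ {n} (i : Fin n) → eqF i i ≡ true
eqF-refl i = dec-true (i Fin.≟ i) refl

eqF-≢ : ∀ {n} {i j : Fin n} → i ≢ j → eqF i j ≡ false
eqF-≢ {i = i} {j} i≢j = dec-false (i Fin.≟ j) i≢j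

-- A gadget for each of J variables: a pair of literal vertices lit j false, lit j true joined by an edge, and for
-- each slot r two vertices slot j r s adjacent to lit j s.  Two columns for each of M clauses are completely
-- joined to the slots.  The vertices slotHub and columnHub belong to the slot side and the column side of
-- this complete bipartite graph.
module Construction (J M : ℕ) {Slot : Set} (slots : List Slot) where

  Vertex : Set
  Vertex = (Fin J × (Slot × Bool ⊎ Bool)) ⊎ ((Fin M × Bool) ⊎ Bool)

  pattern slot j r s = inj₁ (j , inj₁ (r , s))
  pattern lit j s    = inj₁ (j , inj₂ s)
  pattern col m i    = inj₂ (inj₁ (m , i))
  pattern slotHub    = inj₂ (inj₂ false)
  pattern columnHub  = inj₂ (inj₂ true)

  -- The edges inside gadgets are kept apart from the complete bipartite graph, because a
  -- construction with few labels produces them first and all the others by one final join.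
  within : Vertex → Vertex → Bool
  within (lit j s)    (lit j′ s′)    = eqF j j′ ∧ not (same s s′)
  within (lit j s)    (slot j′ r s′) = eqF j j′ ∧ same s s′
  within (slot j r s) (lit j′ s′)    = eqF j j′ ∧ same s s′
  within _            _              = false

  slotSide columnSide : Vertex → Bool
  slotSide (slot _ _ _) = true
  slotSide slotHub      = true
  slotSide _            = false
  columnSide (col _ _)  = true
  columnSide columnHub  = true
  columnSide _          = false

  adjacent : Vertex → Vertex → Bool
  adjacent v w = within v w ∨ (slotSide v ∧ columnSide w) ∨ (columnSide v ∧ slotSide w)

  gadget : List (Slot × Bool ⊎ Bool)
  gadget = map inj₁ (cartesianProduct slots bools) ++ map inj₂ bools

  vertices : List Vertex
  vertices = map inj₁ (cartesianProduct (allFin J) gadget) ++ map inj₂ (map inj₁ (cartesianProduct (allFin M) bools) ++ map inj₂ bools)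

  within-sym : ∀ v w → within v w ≡ within w v
  within-sym (slot _ _ _)  (slot _ _ _)   = refl
  within-sym (slot j _ s)  (lit j′ s′)    = cong₂ _∧_ (eqF-sym j j′) (same-sym s s′)
  within-sym (lit j s)     (slot j′ _ s′) = cong₂ _∧_ (eqF-sym j j′) (same-sym s s′)
  within-sym (lit j s)     (lit j′ s′)    = cong₂ (λ a b → a ∧ not b) (eqF-sym j j′) (same-sym s s′)
  within-sym (slot _ _ _)  (inj₂ _)       = refl
  within-sym (lit _ _)     (inj₂ _)       = refl
  within-sym (inj₂ _)      (slot _ _ _)   = refl
  within-sym (inj₂ _)      (lit _ _)      = refl
  within-sym (inj₂ _)      (inj₂ _)       = refl

  adjacent-sym : ∀ v w → adjacent v w ≡ adjacent w v
  adjacent-sym v w = cong₂ _∨_ (within-sym v w) (trans (∨-comm (slotSide v ∧ columnSide w) _)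
    (cong₂ _∨_ (∧-comm (columnSide v) (slotSide w)) (∧-comm (slotSide v) (columnSide w))))

  adjacent-irr : ∀ v → adjacent v v ≡ false
  adjacent-irr (slot _ _ _)  = refl
  adjacent-irr (lit j false) rewrite eqF-refl j = refl
  adjacent-irr (lit j true)  rewrite eqF-refl j = refl
  adjacent-irr (col _ _)     = refl
  adjacent-irr slotHub       = refl
  adjacent-irr columnHub     = refl

  graph : Graph
  graph = record
    { n = length vertices
    ; adj = λ i j → adjacent (List.lookup vertices i) (List.lookup vertices j)
    ; sym = λ i j → adjacent-sym (List.lookup vertices i) (List.lookup vertices j)
    ; irr = λ i → adjacent-irr (List.lookup vertices i) }

  pairs : List (Fin J × Slot)
  pairs = cartesianProduct (allFin J) slots

  -- Grouped by the kind of vertex, so that in the load of a vertex the kinds without edges to it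
  -- vanish by computation.
  sumV : (Vertex → ℕ) → ℕ
  sumV f = ∑ pairs (λ p → f (slot (proj₁ p) (proj₂ p) false) + f (slot (proj₁ p) (proj₂ p) true))
    + ∑ (allFin J) (λ j → f (lit j false) + f (lit j true))
    + (∑ (allFin M) (λ m → f (col m false) + f (col m true)) + (f slotHub + f columnHub))

  ∑-vertices : ∀ f → ∑ vertices f ≡ sumV f
  ∑-vertices f = trans (∑-++ (map inj₁ (cartesianProduct (allFin J) gadget)) _ f) (cong₂ _+_
    (trans (∑-map inj₁ (cartesianProduct (allFin J) gadget) f) (trans (∑-product (allFin J) gadget (f ∘ inj₁))
      (trans (∑-cong (allFin J) λ j → trans (∑-++ (map inj₁ (cartesianProduct slots bools)) _ _) (cong₂ _+_
          (trans (∑-map inj₁ (cartesianProduct slots bools) _) (trans (∑-product slots bools _) (∑-cong slots λ r → two (λ s → f (slot j r s)))))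
          (two (λ s → f (lit j s)))))
        (trans (∑-+ (allFin J) _ _) (cong (λ x → x + ∑ (allFin J) (λ j → f (lit j false) + f (lit j true)))
          (sym (∑-product (allFin J) slots (λ p → f (slot (proj₁ p) (proj₂ p) false) + f (slot (proj₁ p) (proj₂ p) true)))))))))
    (trans (∑-map inj₂ (map inj₁ (cartesianProduct (allFin M) bools) ++ map inj₂ bools) f) (trans (∑-++ (map inj₁ (cartesianProduct (allFin M) bools)) _ _)
      (cong₂ _+_ (trans (∑-map inj₁ (cartesianProduct (allFin M) bools) _) (trans (∑-product (allFin M) bools _) (∑-cong (allFin M) λ m → two (λ i → f (col m i)))))
        (two (λ i → f (inj₂ (inj₂ i))))))))
    where
    two : ∀ (g : Bool → ℕ) → g false + (g true + 0) ≡ g false + g true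
    two g = cong (λ s → g false + s) (+-identityʳ (g true))

  module Named (slots-unique : Unique slots) (slots-complete : ∀ r → r ∈ slots) where

    bools-unique : Unique bools
    bools-unique = ((λ ()) ∷ []) ∷ ([] ∷ [])

    bools-complete : ∀ b → b ∈ bools
    bools-complete false = here refl
    bools-complete true  = there (here refl)

    sum-unique : ∀ {A B : Set} {xs : List A} {ys : List B} → Unique xs → Unique ys → Unique (map inj₁ xs ++ map inj₂ ys)
    sum-unique {A} {B} {xs} {ys} ux uy = Uniqueₚ.++⁺ (Uniqueₚ.map⁺ (λ { refl → refl }) ux) (Uniqueₚ.map⁺ (λ { refl → refl }) uy) disjoint
      where
      disjoint : ∀ {v : A ⊎ B} → ¬ (v ∈ map inj₁ xs × v ∈ map inj₂ ys)
      disjoint (a , b) with ∈ₚ.∈-map⁻ inj₁ a | ∈ₚ.∈-map⁻ inj₂ b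
      ... | _ , _ , refl | _ , _ , ()

    sum-complete : ∀ {A B : Set} {xs : List A} {ys : List B} → (∀ x → x ∈ xs) → (∀ y → y ∈ ys) → ∀ z → z ∈ map inj₁ xs ++ map inj₂ ys
    sum-complete cx cy (inj₁ x) = ∈ₚ.∈-++⁺ˡ (∈ₚ.∈-map⁺ inj₁ (cx x))
    sum-complete {xs = xs} cx cy (inj₂ y) = ∈ₚ.∈-++⁺ʳ (map inj₁ xs) (∈ₚ.∈-map⁺ inj₂ (cy y))

    vertices-unique : Unique vertices
    vertices-unique = sum-unique (Uniqueₚ.cartesianProduct⁺ (Uniqueₚ.allFin⁺ J) (sum-unique (Uniqueₚ.cartesianProduct⁺ slots-unique bools-unique) bools-unique))
      (sum-unique (Uniqueₚ.cartesianProduct⁺ (Uniqueₚ.allFin⁺ M) bools-unique) bools-unique)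

    vertices-complete : ∀ v → v ∈ vertices
    vertices-complete = sum-complete
      (λ { (j , x) → ∈ₚ.∈-cartesianProduct⁺ (∈ₚ.∈-allFin j) (sum-complete (λ { (r , s) → ∈ₚ.∈-cartesianProduct⁺ (slots-complete r) (bools-complete s) }) bools-complete x) })
      (sum-complete (λ { (m , i) → ∈ₚ.∈-cartesianProduct⁺ (∈ₚ.∈-allFin m) (bools-complete i) }) bools-complete)

    pairs-unique : Unique pairs
    pairs-unique = Uniqueₚ.cartesianProduct⁺ (Uniqueₚ.allFin⁺ J) slots-unique

    pairs-complete : ∀ p → p ∈ pairs
    pairs-complete (j , r) = ∈ₚ.∈-cartesianProduct⁺ (∈ₚ.∈-allFin j) (slots-complete r)

    sumV-∈ : ∀ f v → f v ≤ sumV f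
    sumV-∈ f v = subst (f v ≤_) (∑-vertices f) (∑-∈ f (vertices-complete v))

    number : Vertex → Fin (length vertices)
    number v = index (vertices-complete v)

    vertex-number : ∀ v → List.lookup vertices (number v) ≡ v
    vertex-number v = sym (Anyₚ.lookup-index (vertices-complete v))

    sumV-number : ∀ g → ∑ (allFin (length vertices)) g ≡ sumV (g ∘ number)
    sumV-number g = trans (∑-cong (allFin (length vertices)) (λ i → cong g (sym (lookup-unique vertices-unique _ i (vertex-number (List.lookup vertices i))))))
      (trans (sym (∑-map (List.lookup vertices) (allFin (length vertices)) (g ∘ number)))
        (trans (cong (λ xs → ∑ xs (g ∘ number)) (trans (Listₚ.map-tabulate id (List.lookup vertices)) (Listₚ.tabulate-lookup vertices))) (∑-vertices (g ∘ number))))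

    module _ (cap : Vertex → ℕ) (k : ℕ) where
      instance′ : CVCInstance
      instance′ = record { G = graph ; cap = cap ∘ List.lookup vertices ; k = k }

      -- A solution in terms of vertices instead of their numbers, so that loads can be counted kind
      -- by kind with `sumV`.
      record Cover : Set where
        field
          S           : Vertex → Bool
          h           : Vertex → Vertex → Bool
          small       : sumV (ind ∘ S) ≤ k
          oriented    : ∀ v w → adjacent v w ≡ true → h v w ≡ not (h w v)
          covered     : ∀ v w → adjacent v w ≡ true → h v w ≡ true → S v ≡ true
          capacitated : ∀ v → sumV (λ w → ind (adjacent v w ∧ h v w)) ≤ cap v

      cover⇒yes : Cover → CVCYes instance′
      cover⇒yes c = S ∘ name , (λ i j → h (name i) (name j)) , subst (_≤ k) (sym (count S)) small , (λ i j → oriented (name i) (name j)) ,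
          (λ i j → covered (name i) (name j)) , λ i → subst (_≤ cap (name i)) (sym (count λ w → adjacent (name i) w ∧ h (name i) w)) (capacitated (name i))
        where
        open Cover c
        name = List.lookup vertices
        count : ∀ (P : Vertex → Bool) → countTrue (P ∘ name) ≡ sumV (ind ∘ P)
        count P = trans (sum-map _ (allFin (length vertices))) (trans (sumV-number _) (trans (sym (∑-vertices _))
          (trans (∑-cong vertices (λ v → cong (ind ∘ P) (vertex-number v))) (∑-vertices _))))

      yes⇒cover : CVCYes instance′ → Cover
      yes⇒cover (S , h , small , oriented , covered , capacitated) = record
        { S = S ∘ number ; h = λ v w → h (number v) (number w)
        ; small = subst (_≤ k) (trans (sum-map _ (allFin (length vertices))) (sumV-number _)) small
        ; oriented = λ v w a → oriented (number v) (number w) (trans (names v w) a)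
        ; covered = λ v w a → covered (number v) (number w) (trans (names v w) a)
        ; capacitated = λ v → subst₂ _≤_
            (trans (sum-map _ (allFin (length vertices))) (trans (sumV-number _) (trans (sym (∑-vertices _))
              (trans (∑-cong vertices (λ w → cong (λ a → ind (a ∧ h (number v) (number w))) (names v w))) (∑-vertices _)))))
            (cong cap (vertex-number v)) (capacitated (number v)) }
        where
        names : ∀ v w → adjacent (List.lookup vertices (number v)) (List.lookup vertices (number w)) ≡ adjacent v w
        names v w = cong₂ adjacent (vertex-number v) (vertex-number w)

-- How many of the two vertices of a slot with clause index i leave their edge to a column of clause m to that
-- column, in the orientation for which the capacities are made.
weight : ℕ → ℕ → ℕ
weight zero    zero    = 1
weight zero    (suc m) = 2
weight (suc i) zero    = 0
weight (suc i) (suc m) = weight i m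

pre : ∀ {n} → Fin n → (Fin n → ℕ) → ℕ
pre zero    f = 0
pre (suc m) f = f zero + pre m (f ∘ suc)

pre-mono : ∀ {n} (m : Fin n) {f g} → (∀ i → f i ≤ g i) → pre m f ≤ pre m g
pre-mono zero    le = z≤n
pre-mono (suc m) le = +-mono-≤ (le zero) (pre-mono m (le ∘ suc))

pre-cong : ∀ {n} (m : Fin n) {f g} → (∀ i → f i ≡ g i) → pre m f ≡ pre m g
pre-cong zero    eq = refl
pre-cong (suc m) eq = cong₂ _+_ (eq zero) (pre-cong m (eq ∘ suc))

pre-+ : ∀ {n} (m : Fin n) f g → pre m (λ i → f i + g i) ≡ pre m f + pre m g
pre-+ zero    f g = refl
pre-+ (suc m) f g = trans (cong (λ s → f zero + g zero + s) (pre-+ m _ _)) (interchange {⊤} (f zero) (g zero) _ _)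

pre-const : ∀ {n} (m : Fin n) c → pre m (λ _ → c) ≡ toℕ m * c
pre-const zero    c = refl
pre-const (suc m) c = cong (λ s → c + s) (pre-const m c)

pre-∑ : ∀ {n} (m : Fin n) {A : Set} xs (f : A → Fin n → ℕ) → pre m (λ i → ∑ xs (λ x → f x i)) ≡ ∑ xs (λ x → pre m (f x))
pre-∑ zero    xs f = sym (trans (∑-const xs 0) (*-zeroʳ (length xs)))
pre-∑ (suc m) xs f = trans (cong (λ s → ∑ xs (λ x → f x zero) + s) (pre-∑ m xs (λ x → f x ∘ suc))) (sym (∑-+ xs _ _))

pre-≤ : ∀ {n} (m : Fin n) f → pre m f + f m ≤ ∑ (allFin n) f
pre-≤ {suc n} zero    f = subst (f zero ≤_) (sym (∑-allFin f)) (m≤m+n _ _)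
pre-≤ {suc n} (suc m) f = subst (λ x → f zero + pre m (f ∘ suc) + f (suc m) ≤ x) (sym (∑-allFin f))
  (≤-trans (≤-reflexive (+-assoc (f zero) (pre m (f ∘ suc)) (f (suc m)))) (+-monoʳ-≤ (f zero) (pre-≤ m (f ∘ suc))))

-- The number of edges that a pair of slot vertices with index `i` must leave to the columns up to
-- the first one of clause `m`, if its literal is not true in clause `m`. There are `4 * m + 2` such
-- edges and the pair can take `4 * i + 2`; this gives four times `m - i` for an earlier clause, 1
-- for `m` itself because of the uneven split, and 0 for later clauses.
demand : ℕ → ℕ → ℕ
demand zero    zero    = 1
demand zero    (suc i) = 0
demand (suc m) zero    = 4 + 4 * m
demand (suc m) (suc i) = demand m i

-- Two columns of every earlier clause and one of clause `m`: the weights for which the columns are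
-- dimensioned add up to the demand exactly, which leaves no slack for a violated clause.
pre-weight : ∀ {n} (m : Fin n) i → pre m (λ m′ → 2 * weight i (toℕ m′)) + weight i (toℕ m) ≡ demand (toℕ m) i
pre-weight zero    zero    = refl
pre-weight zero    (suc i) = refl
pre-weight (suc m) zero rewrite pre-const m 4 = arithmetic (toℕ m)
  where
  arithmetic : ∀ m → 2 + m * 4 + 2 ≡ 4 + 4 * m
  arithmetic = solve-∀
pre-weight (suc m) (suc i) = pre-weight m i

demand-< : ∀ {m i} → i < m → demand m i + 4 * i ≡ 4 * m
demand-< {suc m} {zero}  _ = trans (+-identityʳ (4 + 4 * m)) (sym (*-suc 4 m))
demand-< {suc m} {suc i} (s≤s lt) = trans (cong (λ x → demand m i + x) (*-suc 4 i)) (trans (shift4 (demand m i) (4 * i))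
  (trans (cong (λ x → 4 + x) (demand-< lt)) (sym (*-suc 4 m))))
  where
  shift4 : ∀ a b → a + (4 + b) ≡ 4 + (a + b)
  shift4 = solve-∀

demand-≡ : ∀ m → demand m m ≡ 1
demand-≡ zero    = refl
demand-≡ (suc m) = demand-≡ m

demand-> : ∀ {m i} → m < i → demand m i ≡ 0
demand-> {zero}  {suc i} _ = refl
demand-> {suc m} {suc i} (s≤s lt) = demand-> lt

-- Here `a` is the number of edges taken. The bound `4 * m + 2` counts the edges present and
-- `4 * i + 2` is the capacity; only for `i ≡ m`, where the two coincide, is the sharper bound for a
-- false literal called for.
demand-bound : ∀ m i {a} → a ≤ 4 * m + 2 → a ≤ 4 * i + 2 → (i ≡ m → a ≤ 4 * m + 1) → a + demand m i ≤ 4 * m + 2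
demand-bound m i {a} le le′ eq with <-cmp i m
... | tri< lt _ _ = ≤-trans (+-monoˡ-≤ (demand m i) le′) (≤-reflexive (trans (swap (4 * i) (demand m i)) (cong (λ x → x + 2) (demand-< lt))))
  where
  swap : ∀ a d → a + 2 + d ≡ d + a + 2
  swap = solve-∀
... | tri≈ _ refl _ rewrite demand-≡ m = ≤-trans (+-monoˡ-≤ 1 (eq refl)) (≤-reflexive (+-assoc (4 * m) 1 1))
... | tri> _ _ gt rewrite demand-> gt | +-identityʳ a = le

same-refl : ∀ b → same b b ≡ true
same-refl false = refl
same-refl true  = refl

ind-not : ∀ b → ind b + ind (not b) ≡ 1
ind-not false = refl
ind-not true  = refl

ind-≤1 : ∀ b → ind b ≤ 1
ind-≤1 false = z≤n
ind-≤1 true  = ≤-refl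

-- From a cover to a satisfying assignment

module Capacities (J M : ℕ) {Slot : Set} (slots : List Slot) (slots-unique : Unique slots) (slots-complete : ∀ r → r ∈ slots)
  (idx : Fin J → Slot → ℕ) (sgn : Slot → Bool) (active : Fin M → Bool) (base : Fin M → ℕ) where

  open Construction J M slots
  open Named slots-unique slots-complete

  -- A slot vertex spends one unit on `columnHub` and another if its literal vertex is missing;
  -- `2 * idx j r` is for the two columns of each earlier clause. The vertex on the side opposite to
  -- the sign has one unit more: it is the one that lacks its literal vertex when the literal is
  -- true, which evens out the pair. A literal vertex has its degree as capacity. A column spends
  -- one unit on `slotHub`, so in an active clause the first column has room for one edge less than
  -- `base m` and the second for one more, and in an inactive clause each has room for `base m`.
  cap : Vertex → ℕ
  cap (slot j r s)  = 2 * idx j r + 2 + ind (not (same s (sgn r)))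
  cap (lit j s)     = suc (length slots)
  cap (col m false) = base m + ind (not (active m))
  cap (col m true)  = base m + suc (ind (active m))
  cap slotHub       = 1
  cap columnHub     = 0

  -- One literal vertex and two vertices per slot for each variable, two columns for each clause,
  -- and `slotHub`.
  budget : ℕ
  budget = J * suc (2 * length slots) + suc (2 * M)

  Satisfies : (Fin J → Bool) → Set
  Satisfies u = ∀ m → active m ≡ true → Σ[ j ∈ Fin J ] Σ[ r ∈ Slot ] idx j r ≡ toℕ m × u j ≡ sgn r

  module Soundness (base-≡ : ∀ m → base m ≡ ∑ pairs (λ p → weight (idx (proj₁ p) (proj₂ p)) (toℕ m))) (C : Cover cap budget) where
    open Cover C

    load : Vertex → Vertex → ℕ
    load v w = ind (adjacent v w ∧ h v w)

    forced-out : ∀ v w → adjacent v w ≡ true → h v w ≡ false → h w v ≡ true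
    forced-out v w a e = trans (oriented w v (trans (adjacent-sym w v) a)) (cong not e)

    load-zero : ∀ v w → adjacent v w ≡ true → load v w ≡ 0 → h v w ≡ false
    load-zero v w a e with h v w
    ... | false = refl
    ... | true rewrite a with () ← e

    -- Capacity 0 hands every edge of this hub to the other end, so all slot vertices and `slotHub`
    -- are forced into the cover.
    columnHub-free : ∀ w → adjacent columnHub w ≡ true → h w columnHub ≡ true
    columnHub-free w a = forced-out columnHub w a (load-zero columnHub w a (n≤0⇒n≡0 (≤-trans (sumV-∈ (load columnHub) w) (capacitated columnHub))))

    slot-chosen : ∀ j r s → S (slot j r s) ≡ true
    slot-chosen j r s = covered (slot j r s) columnHub refl (columnHub-free (slot j r s) refl)

    -- The edge to `columnHub` already exhausts the capacity 1, so the edges to the columns have to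
    -- be taken by the columns.
    slotHub-free : ∀ m i → h (col m i) slotHub ≡ true
    slotHub-free m i = forced-out slotHub (col m i) refl (load-zero slotHub (col m i) refl (n≤0⇒n≡0 (≤-trans (term i) columns≤0)))
      where
      columns = ∑ (allFin M) (λ m → load slotHub (col m false) + load slotHub (col m true))
      columns≤0 : columns ≤ 0
      columns≤0 = +-cancelʳ-≤ 1 columns 0 (subst (λ x → columns + x ≤ 1) (cong ind (columnHub-free slotHub refl))
        (≤-trans (m≤n+m (columns + load slotHub columnHub) (∑ pairs (λ p → 0) + ∑ (allFin J) (λ j → 0))) (capacitated slotHub)))
      term : ∀ i → load slotHub (col m i) ≤ columns
      term false = ≤-trans (m≤m+n _ _) (∑-∈ (λ m → load slotHub (col m false) + load slotHub (col m true)) (∈ₚ.∈-allFin m))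
      term true  = ≤-trans (m≤n+m _ (load slotHub (col m false))) (∑-∈ (λ m → load slotHub (col m false) + load slotHub (col m true)) (∈ₚ.∈-allFin m))

    col-chosen : ∀ m i → S (col m i) ≡ true
    col-chosen m i = covered (col m i) slotHub refl (slotHub-free m i)

    lit-edge : ∀ j s → adjacent (lit j s) (lit j (not s)) ≡ true
    lit-edge j false rewrite eqF-refl j = refl
    lit-edge j true  rewrite eqF-refl j = refl

    lit-one : ∀ j → 1 ≤ ind (S (lit j false)) + ind (S (lit j true))
    lit-one j with h (lit j false) (lit j true) in eq
    ... | true  rewrite covered (lit j false) (lit j true) (lit-edge j false) eq = s≤s z≤n
    ... | false rewrite covered (lit j true) (lit j false) (lit-edge j true) (forced-out (lit j false) (lit j true) (lit-edge j false) eq) =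
      m≤n+m 1 (ind (S (lit j false)))

    -- The chosen vertices besides the literals exhaust the budget but for one vertex per variable.
    lit-both : ∀ j → ind (S (lit j false)) + ind (S (lit j true)) ≤ 1
    lit-both j = ∑-tight (allFin J) lit-one total (∈ₚ.∈-allFin j)
      where
      lits = ∑ (allFin J) (λ j → ind (S (lit j false)) + ind (S (lit j true)))
      slots-sum : ∑ pairs (λ p → ind (S (slot (proj₁ p) (proj₂ p) false)) + ind (S (slot (proj₁ p) (proj₂ p) true))) ≡ J * (length slots * 2)
      slots-sum = trans (∑-cong pairs (λ { (j , r) → cong₂ _+_ (cong ind (slot-chosen j r false)) (cong ind (slot-chosen j r true)) }))
        (trans (∑-product (allFin J) slots (λ _ → 2)) (trans (∑-cong (allFin J) (λ _ → ∑-const slots 2))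
          (trans (∑-const (allFin J) _) (cong (λ x → x * (length slots * 2)) (length-allFin J)))))
      columns-sum : ∑ (allFin M) (λ m → ind (S (col m false)) + ind (S (col m true))) ≡ M * 2
      columns-sum = trans (∑-cong (allFin M) (λ m → cong₂ _+_ (cong ind (col-chosen m false)) (cong ind (col-chosen m true))))
        (trans (∑-const (allFin M) 2) (cong (λ x → x * 2) (length-allFin M)))
      rearrange : ∀ J R M → J * suc (2 * R) + suc (2 * M) ≡ (J * (R * 2) + J) + (M * 2 + 1)
      rearrange = solve-∀
      bounded : (J * (length slots * 2) + lits) + (M * 2 + 1) ≤ (J * (length slots * 2) + J) + (M * 2 + 1)
      bounded = ≤-trans (+-mono-≤ (≤-reflexive (cong (λ x → x + lits) (sym slots-sum)))
          (+-mono-≤ (≤-reflexive (sym columns-sum)) (≤-trans (≤-reflexive (cong ind (sym (covered slotHub columnHub refl (columnHub-free slotHub refl))))) (m≤m+n _ _))))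
        (≤-trans small (≤-reflexive (rearrange J (length slots) M)))
      total : lits ≤ ∑ (allFin J) (λ _ → 1)
      total = ≤-trans (+-cancelˡ-≤ (J * (length slots * 2)) _ _ (+-cancelʳ-≤ (M * 2 + 1) _ _ bounded))
        (≤-reflexive (sym (trans (∑-const (allFin J) 1) (trans (*-identityʳ _) (length-allFin J)))))

    -- The value names the side of the literal vertex that stays in the cover.
    u : Fin J → Bool
    u j = not (S (lit j false))

    tk un : Fin J → Slot → Bool → Fin M → Bool → ℕ
    tk j r s m i = ind (h (slot j r s) (col m i))
    un j r s m i = ind (h (col m i) (slot j r s))

    tk-un : ∀ j r s m i → tk j r s m i + un j r s m i ≡ 1
    tk-un j r s m i rewrite oriented (col m i) (slot j r s) refl = ind-not (h (slot j r s) (col m i))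

    absent : Fin J → Bool → ℕ
    absent j s = ind (not (S (lit j s)))

    slot-lit : ∀ j r s → adjacent (slot j r s) (lit j s) ≡ true
    slot-lit j r false rewrite eqF-refl j = refl
    slot-lit j r true  rewrite eqF-refl j = refl

    absent-load : ∀ j r s → absent j s ≤ load (slot j r s) (lit j s)
    absent-load j r s rewrite slot-lit j r s with S (lit j s) in eq
    ... | true  = z≤n
    ... | false with h (lit j s) (slot j r s) in e
    ...   | true  = contradiction (trans (sym (covered (lit j s) (slot j r s) (trans (adjacent-sym (lit j s) (slot j r s)) (slot-lit j r s)) e)) eq) λ ()
    ...   | false rewrite oriented (slot j r s) (lit j s) (slot-lit j r s) | e = ≤-refl

    slot-row : ∀ j r s → absent j s + ∑ (allFin M) (λ m → tk j r s m false + tk j r s m true) + 1 ≤ cap (slot j r s)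
    slot-row j r s = ≤-trans (≤-trans (≤-reflexive (+-assoc (absent j s) columns 1)) (+-mono-≤ (≤-trans (absent-load j r s)
        (≤-trans (one s) (≤-trans (∑-∈ lits (∈ₚ.∈-allFin j)) (m≤n+m (∑ (allFin J) lits) others)))) (+-monoʳ-≤ columns hubs)))
      (capacitated (slot j r s))
      where
      columns = ∑ (allFin M) (λ m → tk j r s m false + tk j r s m true)
      others = ∑ pairs (λ p → load (slot j r s) (slot (proj₁ p) (proj₂ p) false) + load (slot j r s) (slot (proj₁ p) (proj₂ p) true))
      hubs : 1 ≤ load (slot j r s) slotHub + load (slot j r s) columnHub
      hubs = ≤-reflexive (cong ind (sym (columnHub-free (slot j r s) refl)))
      lits : Fin J → ℕ
      lits j′ = load (slot j r s) (lit j′ false) + load (slot j r s) (lit j′ true)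
      one : ∀ s′ → load (slot j r s) (lit j s′) ≤ lits j
      one false = m≤m+n _ _
      one true  = m≤n+m _ (load (slot j r s) (lit j false))

    -- These count edges to the first `2 * m + 1` columns: both of every earlier clause, but only
    -- the first of clause `m`. The odd number is what exposes an uneven split.
    taken untaken : Fin M → Fin J → Slot → Bool → ℕ
    taken m j r s = pre m (λ m′ → tk j r s m′ false + tk j r s m′ true) + tk j r s m false
    untaken m j r s = pre m (λ m′ → un j r s m′ false + un j r s m′ true) + un j r s m false

    taken-untaken : ∀ m j r s → taken m j r s + untaken m j r s ≡ toℕ m * 2 + 1
    taken-untaken m j r s = trans (interchange {⊤} (pre m (λ m′ → tk j r s m′ false + tk j r s m′ true)) (tk j r s m false) _ (un j r s m false))
      (cong₂ _+_ (trans (sym (pre-+ m _ _)) (trans (pre-cong m (λ m′ → trans (interchange {⊤} (tk j r s m′ false) _ _ _) (cong₂ _+_ (tk-un j r s m′ false) (tk-un j r s m′ true)))) (pre-const m 2)))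
        (tk-un j r s m false))

    taken-≤ : ∀ m j r s → absent j s + taken m j r s ≤ 2 * idx j r + 1 + ind (not (same s (sgn r)))
    taken-≤ m j r s = +-cancelʳ-≤ 1 _ _ (≤-trans (+-monoˡ-≤ 1 (+-monoʳ-≤ (absent j s) (≤-trans (+-monoʳ-≤ (pre m _) (m≤m+n _ _)) (pre-≤ m _))))
      (≤-trans (slot-row j r s) (≤-reflexive (move (2 * idx j r) (ind (not (same s (sgn r))))))))
      where
      move : ∀ a b → a + 2 + b ≡ a + 1 + b + 1
      move = solve-∀

    absent-one : ∀ j → 1 ≤ absent j false + absent j true
    absent-one j = both (S (lit j false)) (S (lit j true)) (lit-both j)
      where
      both : ∀ a b → ind a + ind b ≤ 1 → 1 ≤ ind (not a) + ind (not b)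
      both false b     _ = s≤s z≤n
      both true  false _ = s≤s z≤n
      both true  true  (s≤s ())

    hi-lo : ∀ b → ind (not (same false b)) + ind (not (same true b)) ≡ 1
    hi-lo false = refl
    hi-lo true  = refl

    -- The pair has capacity `4 * i + 5`, of which two units go to `columnHub` and at least one to a
    -- missing literal vertex; the value of the variable does not matter.
    taken-total : ∀ m j r → taken m j r false + taken m j r true ≤ 4 * idx j r + 2
    taken-total m j r = +-cancelˡ-≤ 1 _ _ (≤-trans (+-monoˡ-≤ _ (absent-one j)) (≤-trans
      (≤-reflexive (interchange {⊤} (absent j false) (absent j true) (taken m j r false) (taken m j r true)))
      (≤-trans (+-mono-≤ (taken-≤ m j r false) (taken-≤ m j r true))
        (≤-reflexive (trans (interchange {⊤} (2 * idx j r + 1) _ (2 * idx j r + 1) _) (trans (cong (λ x → (2 * idx j r + 1) + (2 * idx j r + 1) + x) (hi-lo (sgn r))) (double (idx j r))))))))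
      where
      double : ∀ i → (2 * i + 1) + (2 * i + 1) + 1 ≡ 1 + (4 * i + 2)
      double = solve-∀

    taken-each : ∀ m j r s → taken m j r s ≤ 2 * toℕ m + 1
    taken-each m j r s = ≤-trans (m≤m+n _ (untaken m j r s)) (≤-reflexive (trans (taken-untaken m j r s) (cong (λ x → x + 1) (*-comm (toℕ m) 2))))

    lo-absent : ∀ j r → u j ≢ sgn r → absent j (sgn r) ≡ 1
    lo-absent j r ne = go (sgn r) ne (S (lit j false)) (S (lit j true)) refl refl (lit-both j)
      where
      go : ∀ b → u j ≢ b → ∀ p q → S (lit j false) ≡ p → S (lit j true) ≡ q → ind (S (lit j false)) + ind (S (lit j true)) ≤ 1 → absent j b ≡ 1
      go false ne false q     ep eq le = cong (ind ∘ not) ep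
      go false ne true  q     ep eq le = contradiction (cong not ep) ne
      go true  ne false q     ep eq le = contradiction (cong not ep) ne
      go true  ne true  false ep eq le = cong (ind ∘ not) eq
      go true  ne true  true  ep eq le rewrite ep | eq with s≤s () ← le

    -- For a false literal it is the vertex of smaller capacity that lacks its literal vertex, which
    -- leaves it `2 * m` column edges. The other has room for `2 * m + 2`, but finds only
    -- `2 * m + 1` columns.
    taken-false : ∀ m j r → u j ≢ sgn r → idx j r ≡ toℕ m → taken m j r false + taken m j r true ≤ 4 * toℕ m + 1
    taken-false m j r ne eq = go (sgn r) refl
      where
      lo : taken m j r (sgn r) ≤ 2 * toℕ m
      lo = subst (λ i → taken m j r (sgn r) ≤ 2 * i) eq (+-cancelˡ-≤ 1 _ _ (subst (λ x → x + taken m j r (sgn r) ≤ 1 + 2 * idx j r) (lo-absent j r ne)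
        (≤-trans (taken-≤ m j r (sgn r)) (≤-reflexive (trans (cong (λ b → 2 * idx j r + 1 + ind (not b)) (same-refl (sgn r))) (trans (+-identityʳ _) (+-comm (2 * idx j r) 1)))))))
      double : ∀ m → 2 * m + (2 * m + 1) ≡ 4 * m + 1
      double = solve-∀
      go : ∀ b → sgn r ≡ b → taken m j r false + taken m j r true ≤ 4 * toℕ m + 1
      go false e = ≤-trans (+-mono-≤ (subst (λ b → taken m j r b ≤ 2 * toℕ m) e lo) (taken-each m j r true)) (≤-reflexive (double (toℕ m)))
      go true  e = ≤-trans (+-mono-≤ (taken-each m j r false) (subst (λ b → taken m j r b ≤ 2 * toℕ m) e lo)) (≤-reflexive (trans (+-comm _ (2 * toℕ m)) (double (toℕ m))))

    -- Taken and untaken edges of a pair add up to `4 * m + 2`, so the upper bounds on the former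
    -- turn into a lower bound on the latter.
    untaken-demand : ∀ m j r → (idx j r ≡ toℕ m → u j ≢ sgn r) → demand (toℕ m) (idx j r) ≤ untaken m j r false + untaken m j r true
    untaken-demand m j r ne = +-cancelˡ-≤ (taken m j r false + taken m j r true) _ _ (≤-trans
      (demand-bound (toℕ m) (idx j r) (≤-trans (+-mono-≤ (taken-each m j r false) (taken-each m j r true)) (≤-reflexive (double (toℕ m))))
        (taken-total m j r) (λ e → taken-false m j r (ne e) e))
      (≤-reflexive (sym (trans (interchange {⊤} (taken m j r false) _ (untaken m j r false) _) (trans (cong₂ _+_ (taken-untaken m j r false) (taken-untaken m j r true)) (double′ (toℕ m)))))))
      where
      double : ∀ m → (2 * m + 1) + (2 * m + 1) ≡ 4 * m + 2
      double = solve-∀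
      double′ : ∀ m → (m * 2 + 1) + (m * 2 + 1) ≡ 4 * m + 2
      double′ = solve-∀

    column : Fin M → Bool → ℕ
    column m i = ∑ pairs (λ p → un (proj₁ p) (proj₂ p) false m i + un (proj₁ p) (proj₂ p) true m i)

    column-≤ : ∀ m i → column m i + 1 ≤ cap (col m i)
    column-≤ m i = ≤-trans (+-mono-≤ (m≤m+n (column m i) (∑ (allFin J) (λ j → 0))) (≤-trans hubs (m≤n+m _ (∑ (allFin M) (λ m → 0))))) (capacitated (col m i))
      where
      hubs : 1 ≤ load (col m i) slotHub + load (col m i) columnHub
      hubs = ≤-trans (≤-reflexive (cong ind (sym (slotHub-free m i)))) (m≤m+n _ 0)

    -- Activity only moves a unit between the two columns of a clause, so for the clauses before the
    -- one examined it has no effect.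
    column-both : ∀ m → column m false + column m true ≤ 2 * base m
    column-both m = +-cancelʳ-≤ 2 _ _ (≤-trans (≤-reflexive (interchange′ (column m false) (column m true))) (≤-trans (+-mono-≤ (column-≤ m false) (column-≤ m true))
      (≤-reflexive (split (active m) (base m)))))
      where
      interchange′ : ∀ a b → a + b + 2 ≡ (a + 1) + (b + 1)
      interchange′ = solve-∀
      split : ∀ a b → (b + ind (not a)) + (b + suc (ind a)) ≡ 2 * b + 2
      split false = solve-∀
      split true  = solve-∀

    -- Suppose that no slot of the active clause `m` holds a true literal. Then every pair leaves at
    -- least its demand to the columns up to the first of clause `m`. The demands add up to twice
    -- the bases of the earlier clauses plus `base m`, but these columns can take only one less,
    -- because the first column of an active clause pays for `slotHub` out of `base m`.
    satisfied : Satisfies u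
    satisfied m act with search (λ p → does (idx (proj₁ p) (proj₂ p) ≟ toℕ m) ∧ same (u (proj₁ p)) (sgn (proj₂ p))) pairs
    ... | inj₁ ((j , r) , e) = j , r , decided (idx j r ≟ toℕ m) e
      where
      same-≡ : ∀ a b → same a b ≡ true → a ≡ b
      same-≡ false false _ = refl
      same-≡ true  true  _ = refl
      decided : ∀ {X : Set} (d : Dec X) → does d ∧ same (u j) (sgn r) ≡ true → X × u j ≡ sgn r
      decided (yes x) e = x , same-≡ (u j) (sgn r) e
    ... | inj₂ none = contradiction (≤-trans enough counted) (<-irrefl refl)
      where
      unsatisfied : ∀ j r → idx j r ≡ toℕ m → u j ≢ sgn r
      unsatisfied j r e e′ with none (pairs-complete (j , r))
      ... | n rewrite dec-true (idx j r ≟ toℕ m) e | e′ = contradiction (trans (sym n) (same-refl (sgn r))) λ ()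
      enough : suc (∑ pairs (λ p → demand (toℕ m) (idx (proj₁ p) (proj₂ p)))) ≤ suc (∑ pairs (λ p → untaken m (proj₁ p) (proj₂ p) false + untaken m (proj₁ p) (proj₂ p) true))
      enough = s≤s (∑-mono pairs λ { (j , r) → untaken-demand m j r (unsatisfied j r) })
      regroup : ∀ j r → untaken m j r false + untaken m j r true ≡
        pre m (λ m′ → (un j r false m′ false + un j r true m′ false) + (un j r false m′ true + un j r true m′ true)) + (un j r false m false + un j r true m false)
      regroup j r = trans (interchange {⊤} (pre m _) (un j r false m false) (pre m _) (un j r true m false))
        (cong (λ x → x + (un j r false m false + un j r true m false)) (trans (sym (pre-+ m _ _)) (pre-cong m λ m′ → interchange {⊤} (un j r false m′ false) _ _ _)))
      counted : suc (∑ pairs (λ p → untaken m (proj₁ p) (proj₂ p) false + untaken m (proj₁ p) (proj₂ p) true)) ≤ ∑ pairs (λ p → demand (toℕ m) (idx (proj₁ p) (proj₂ p)))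
      counted = ≤-trans (≤-reflexive (cong suc (trans (∑-cong pairs (λ { (j , r) → regroup j r })) (trans (∑-+ pairs _ _)
          (cong (λ x → x + column m false) (trans (sym (pre-∑ m pairs _)) (pre-cong m (λ m′ → ∑-+ pairs _ _))))))))
        (≤-trans (≤-trans (≤-reflexive (trans (sym (+-suc _ _)) (cong (λ x → pre m (λ m′ → column m′ false + column m′ true) + x) (+-comm 1 (column m false)))))
          (+-mono-≤ (pre-mono m column-both) (≤-trans (column-≤ m false) (≤-reflexive (trans (cong (λ a → base m + ind (not a)) act) (+-identityʳ _))))))
        (≤-reflexive (trans (cong₂ _+_ (trans (pre-cong m (λ m′ → trans (cong (2 *_) (base-≡ m′)) (∑-double pairs _))) (pre-∑ m pairs _)) (base-≡ m))
          (trans (sym (∑-+ pairs _ _)) (∑-cong pairs (λ { (j , r) → pre-weight m (idx j r) }))))))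
        where
        ∑-double : ∀ {A : Set} (xs : List A) f → 2 * ∑ xs f ≡ ∑ xs (λ x → 2 * f x)
        ∑-double xs f = trans (cong (λ x → ∑ xs f + x) (+-identityʳ _)) (trans (sym (∑-+ xs f f)) (∑-cong xs (λ x → cong (λ y → f x + y) (sym (+-identityʳ (f x))))))

-- From a satisfying assignment to a cover

take : ℕ → ℕ → Bool → Bool
take zero    zero    b = b
take zero    (suc m) b = false
take (suc i) zero    b = true
take (suc i) (suc m) b = take i m b

-- Which columns of its own clause a slot vertex takes, given whether it has the larger capacity of its pair,
-- whether the literal is true, and whether it is the literal chosen to satisfy the clause.
own : (larger good chosen : Bool) → Bool → Bool
own true  g w false = w ∨ not g
own true  g w true  = not w
own false g w false = g
own false g w true  = false

-- What remains for the two columns of its own clause once a slot vertex has paid for `columnHub`,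
-- for the earlier columns and, if it is missing, for its literal vertex.
ownMax : Bool → Bool → ℕ
ownMax true  g = suc (ind (not g))
ownMax false g = ind g

own-≤ : ∀ l g w → (w ≡ true → g ≡ true) → ind (own l g w false) + ind (own l g w true) ≤ ownMax l g
own-≤ true  true  false _ = ≤-refl
own-≤ true  true  true  _ = ≤-refl
own-≤ true  false false _ = ≤-refl
own-≤ true  false true  h = contradiction (h refl) λ ()
own-≤ false true  w     _ = ≤-refl
own-≤ false false w     _ = ≤-refl

∑-zero : ∀ {A : Set} (xs : List A) → ∑ xs (λ _ → 0) ≡ 0
∑-zero xs = trans (∑-const xs 0) (*-zeroʳ (length xs))

take-sum : ∀ n i (b c : Fin n → Bool) e → (∀ m → ind (b m) + ind (c m) ≤ e) →
  ∑ (allFin n) (λ m → ind (take i (toℕ m) (b m)) + ind (take i (toℕ m) (c m))) ≤ 2 * i + e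
take-sum zero    i       b c e le = z≤n
take-sum (suc n) zero    b c e le = subst (_≤ e) (sym (trans (∑-allFin (λ m → ind (take 0 (toℕ m) (b m)) + ind (take 0 (toℕ m) (c m))))
  (trans (cong (λ x → ind (b zero) + ind (c zero) + x) (∑-zero (allFin n))) (+-identityʳ _)))) (le zero)
take-sum (suc n) (suc i) b c e le = subst (_≤ 2 * suc i + e) (sym (∑-allFin (λ m → ind (take (suc i) (toℕ m) (b m)) + ind (take (suc i) (toℕ m) (c m)))))
  (≤-trans (+-monoʳ-≤ 2 (take-sum n i (b ∘ suc) (c ∘ suc) e (le ∘ suc))) (≤-reflexive (cong (_+ e) (sym (*-suc 2 i)))))

row-fits : ∀ s u b i → ind (not (same s u)) + (2 * i + ownMax (not (same s b)) (same u b)) + 1 ≤ 2 * i + 2 + ind (not (same s b))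
row-fits s u b i = ≤-trans (≤-reflexive (out-of (ind (not (same s u))) (2 * i) (ownMax (not (same s b)) (same u b))))
    (≤-trans (+-monoʳ-≤ (2 * i) (check s u b)) (≤-reflexive (sym (+-assoc (2 * i) 2 _))))
  where
  out-of : ∀ a i e → a + (i + e) + 1 ≡ i + (a + e + 1)
  out-of = solve-∀
  check : ∀ s u b → ind (not (same s u)) + ownMax (not (same s b)) (same u b) + 1 ≤ 2 + ind (not (same s b))
  check false false false = ≤-refl
  check false false true  = ≤-refl
  check false true  false = ≤-refl
  check false true  true  = ≤-refl
  check true  false false = ≤-refl
  check true  false true  = ≤-refl
  check true  true  false = ≤-refl
  check true  true  true  = ≤-refl

-- In its own clause an unchosen pair leaves one edge to each column: a true one since its vertices
-- take one column each, a false one since the larger takes both columns and the smaller none. A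
-- chosen pair takes both edges to the first column and leaves both to the second, which is the
-- shift of one unit that an active clause asks for.
first-column : ∀ i m b g w → (w ≡ true → i ≡ m × g ≡ true) →
  ind (not (take i m (own (not (same false b)) g w false))) + ind (not (take i m (own (not (same true b)) g w false))) + ind w ≡ weight i m
first-column i       m       b     true  true  f with refl ← proj₁ (f refl) = same-clause i b
  where
  same-clause : ∀ i b → ind (not (take i i (own (not (same false b)) true true false))) + ind (not (take i i (own (not (same true b)) true true false))) + 1 ≡ weight i i
  same-clause zero    false = refl
  same-clause zero    true  = refl
  same-clause (suc i) b     = same-clause i b
first-column i       m       b     false true  f = contradiction (proj₂ (f refl)) λ ()
first-column zero    zero    false false false f = refl
first-column zero    zero    false true  false f = refl
first-column zero    zero    true  false false f = refl
first-column zero    zero    true  true  false f = refl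
first-column zero    (suc m) b     g     false f = refl
first-column (suc i) zero    b     g     false f = refl
first-column (suc i) (suc m) b     g     false f = first-column i m b g false λ ()

second-column : ∀ i m b g w → (w ≡ true → i ≡ m × g ≡ true) →
  ind (not (take i m (own (not (same false b)) g w true))) + ind (not (take i m (own (not (same true b)) g w true))) ≡ weight i m + ind w
second-column i       m       b     true  true  f with refl ← proj₁ (f refl) = same-clause i b
  where
  same-clause : ∀ i b → ind (not (take i i (own (not (same false b)) true true true))) + ind (not (take i i (own (not (same true b)) true true true))) ≡ weight i i + 1
  same-clause zero    false = refl
  same-clause zero    true  = refl
  same-clause (suc i) b     = same-clause i b
second-column i       m       b     false true  f = contradiction (proj₂ (f refl)) λ ()
second-column zero    zero    false g     false f = refl
second-column zero    zero    true  g     false f = refl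
second-column zero    (suc m) b     g     false f = refl
second-column (suc i) zero    b     g     false f = refl
second-column (suc i) (suc m) b     g     false f = second-column i m b g false λ ()

module Completeness (J M : ℕ) {Slot : Set} (slots : List Slot) (slots-unique : Unique slots) (slots-complete : ∀ r → r ∈ slots)
  (idx : Fin J → Slot → ℕ) (sgn : Slot → Bool) (active : Fin M → Bool) (base : Fin M → ℕ)
  (_≟ₛ_ : (r r′ : Slot) → Dec (r ≡ r′)) where

  open Construction J M slots
  open Named slots-unique slots-complete
  open Capacities J M slots slots-unique slots-complete idx sgn active base

  module _ (base-≡ : ∀ m → base m ≡ ∑ pairs (λ p → weight (idx (proj₁ p) (proj₂ p)) (toℕ m))) (u : Fin J → Bool) (sat : Satisfies u) where

    good : Fin J × Slot → Bool
    good (j , r) = same (u j) (sgn r)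

    -- The equation is passed along because `sat` names a true literal only when given the proof
    -- that the clause is active.
    chosen-if : ∀ m b → active m ≡ b → Fin J × Slot → Bool
    chosen-if m false _ p = false
    chosen-if m true  e p = does (Productₚ.≡-dec Fin._≟_ _≟ₛ_ p (proj₁ (sat m e) , proj₁ (proj₂ (sat m e))))

    chosen : Fin M → Fin J × Slot → Bool
    chosen m = chosen-if m (active m) refl

    chosen-good : ∀ m p → chosen m p ≡ true → idx (proj₁ p) (proj₂ p) ≡ toℕ m × good p ≡ true
    chosen-good m p = go (active m) refl
      where
      go : ∀ b e → chosen-if m b e p ≡ true → idx (proj₁ p) (proj₂ p) ≡ toℕ m × good p ≡ true
      go true e c with Productₚ.≡-dec Fin._≟_ _≟ₛ_ p (proj₁ (sat m e) , proj₁ (proj₂ (sat m e)))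
      ... | yes refl = proj₁ (proj₂ (proj₂ (sat m e))) , trans (cong (λ b → same b (sgn (proj₂ p))) (proj₂ (proj₂ (proj₂ (sat m e))))) (same-refl (sgn (proj₂ p)))

    chosen-count : ∀ m → ∑ pairs (ind ∘ chosen m) ≡ ind (active m)
    chosen-count m = go (active m) refl
      where
      go : ∀ b e → ∑ pairs (ind ∘ chosen-if m b e) ≡ ind b
      go false e = ∑-zero pairs
      go true  e = trans (∑-single {x = w} (ind ∘ chosen-if m true e) pairs-unique (pairs-complete _) (λ y ne → cong ind (dec-false (Productₚ.≡-dec Fin._≟_ _≟ₛ_ y _) ne)))
          (cong ind (dec-true (Productₚ.≡-dec Fin._≟_ _≟ₛ_ w w) refl))
        where
        w = proj₁ (sat m e) , proj₁ (proj₂ (sat m e))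

    S : Vertex → Bool
    S (lit j s) = same s (u j)
    S columnHub = false
    S _         = true

    takes : Fin J → Slot → Bool → Fin M → Bool → Bool
    takes j r s m i = take (idx j r) (toℕ m) (own (not (same s (sgn r))) (good (j , r)) (chosen m (j , r)) i)

    h : Vertex → Vertex → Bool
    h (slot j r s) (col m i)     = takes j r s m i
    h (slot j r s) (lit j′ s′)   = not (same s′ (u j′))
    h (slot j r s) columnHub     = true
    -- A literal vertex in the cover takes all its edges, as its capacity is its degree; one outside
    -- takes none.
    h (lit j s)    _             = same s (u j)
    h (col m i)    (slot j r s)  = not (takes j r s m i)
    h (col m i)    slotHub       = true
    h slotHub      columnHub     = true
    h _            _             = false

    ∨-falses : ∀ a → a ∨ false ≡ true → a ≡ true
    ∨-falses true _ = refl

    eqF-≡ : ∀ (i j : Fin J) b → (eqF i j ∧ b) ∨ false ≡ true → i ≡ j × b ≡ true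
    eqF-≡ i j b e with i Fin.≟ j
    ... | yes i≡j = i≡j , ∨-falses b e

    lits-differ : ∀ s s′ b → not (same s s′) ≡ true → same s b ≡ not (same s′ b)
    lits-differ false true  b _ = refl
    lits-differ true  false b _ = sym (not-involutive b)

    oriented : ∀ v w → adjacent v w ≡ true → h v w ≡ not (h w v)
    oriented (slot _ _ _)  (slot _ _ _)  ()
    oriented (slot j r s)  (lit j′ s′)   a = refl
    oriented (slot _ _ _)  (col _ _)     a = sym (not-involutive _)
    oriented (slot _ _ _)  slotHub       ()
    oriented (slot _ _ _)  columnHub     a = refl
    oriented (lit j s)     (slot j′ r s′) a = sym (not-involutive _)
    oriented (lit j s)     (lit j′ s′)   a with refl , e ← eqF-≡ j j′ (not (same s s′)) a = lits-differ s s′ (u j) e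
    oriented (lit _ _)     (col _ _)     ()
    oriented (lit _ _)     slotHub       ()
    oriented (lit _ _)     columnHub     ()
    oriented (col _ _)     (slot _ _ _)  a = refl
    oriented (col _ _)     (lit _ _)     ()
    oriented (col _ _)     (col _ _)     ()
    oriented (col _ _)     slotHub       a = refl
    oriented (col _ _)     columnHub     ()
    oriented slotHub       (slot _ _ _)  ()
    oriented slotHub       (lit _ _)     ()
    oriented slotHub       (col _ _)     a = refl
    oriented slotHub       slotHub       ()
    oriented slotHub       columnHub     a = refl
    oriented columnHub     (slot _ _ _)  a = refl
    oriented columnHub     (lit _ _)     ()
    oriented columnHub     (col _ _)     ()
    oriented columnHub     slotHub       a = refl
    oriented columnHub     columnHub     ()

    covered : ∀ v w → adjacent v w ≡ true → h v w ≡ true → S v ≡ true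
    covered (slot _ _ _) w a e = refl
    covered (lit _ _)    w a e = e
    covered (col _ _)    w a e = refl
    covered slotHub      w a e = refl
    covered columnHub    w a ()

    load : Vertex → Vertex → ℕ
    load v w = ind (adjacent v w ∧ h v w)

    own-lit : ∀ j r s → load (slot j r s) (lit j false) + load (slot j r s) (lit j true) ≡ ind (not (same s (u j)))
    own-lit j r false rewrite eqF-refl j = +-identityʳ _
    own-lit j r true  rewrite eqF-refl j = refl

    other-lit : ∀ j r s j′ → j′ ≢ j → load (slot j r s) (lit j′ false) + load (slot j r s) (lit j′ true) ≡ 0
    other-lit j r s j′ ne rewrite eqF-≢ (ne ∘ sym) = refl

    column : Fin M → Bool → ℕ
    column m i = ∑ pairs (λ p → load (col m i) (slot (proj₁ p) (proj₂ p) false) + load (col m i) (slot (proj₁ p) (proj₂ p) true))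

    first-sum : ∀ m → column m false + ind (active m) ≡ base m
    first-sum m = trans (cong (λ x → column m false + x) (sym (chosen-count m))) (trans (sym (∑-+ pairs _ _))
      (trans (∑-cong pairs (λ { (j , r) → first-column (idx j r) (toℕ m) (sgn r) (good (j , r)) (chosen m (j , r)) (chosen-good m (j , r)) })) (sym (base-≡ m))))

    second-sum : ∀ m → column m true ≡ base m + ind (active m)
    second-sum m = trans (∑-cong pairs (λ { (j , r) → second-column (idx j r) (toℕ m) (sgn r) (good (j , r)) (chosen m (j , r)) (chosen-good m (j , r)) }))
      (trans (∑-+ pairs _ _) (cong₂ _+_ (sym (base-≡ m)) (chosen-count m)))

    column-≤ : ∀ m i → column m i + 1 ≤ cap (col m i)
    column-≤ m true  = ≤-reflexive (trans (cong (_+ 1) (second-sum m)) (trans (+-assoc (base m) _ 1) (cong (λ x → base m + x) (+-comm (ind (active m)) 1))))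
    column-≤ m false = +-cancelˡ-≤ (ind (active m)) _ _ (≤-reflexive (trans (sym (+-assoc (ind (active m)) _ 1)) (trans (cong (_+ 1) (trans (+-comm (ind (active m)) _) (first-sum m)))
      (trans (cong (λ x → base m + x) (sym (ind-not (active m)))) (swap (base m) (ind (active m)) _)))))
      where
      swap : ∀ a b c → a + (b + c) ≡ b + (a + c)
      swap = solve-∀

    gadget-lit : ∀ j s j′ r → load (lit j s) (slot j′ r false) + load (lit j s) (slot j′ r true) ≤ ind (eqF j j′)
    gadget-lit j s j′ r with eqF j j′ | s
    ... | false | _     = z≤n
    ... | true  | false = ≤-trans (≤-reflexive (+-identityʳ _)) (ind-≤1 _)
    ... | true  | true  = ind-≤1 _

    edge-lit : ∀ j s j′ → load (lit j s) (lit j′ false) + load (lit j s) (lit j′ true) ≤ ind (eqF j j′)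
    edge-lit j s j′ with eqF j j′ | s
    ... | false | _     = z≤n
    ... | true  | false = ind-≤1 _
    ... | true  | true  = ≤-trans (≤-reflexive (+-identityʳ _)) (ind-≤1 _)

    one-gadget : ∀ j c → ∑ (allFin J) (λ j′ → ind (eqF j j′) * c) ≡ c
    one-gadget j c = trans (∑-single {x = j} _ (Uniqueₚ.allFin⁺ J) (∈ₚ.∈-allFin j) (λ y ne → cong (λ b → ind b * c) (eqF-≢ (ne ∘ sym))))
      (trans (cong (λ b → ind b * c) (eqF-refl j)) (+-identityʳ c))

    capacitated : ∀ v → sumV (load v) ≤ cap v
    capacitated (slot j r s) = ≤-trans (≤-reflexive (trans (cong (λ x → x + lits + (columns + 1)) (∑-zero pairs))
        (trans (cong (λ x → x + (columns + 1)) one) (sym (+-assoc _ columns 1)))))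
      (≤-trans (+-monoˡ-≤ 1 (+-monoʳ-≤ (ind (not (same s (u j)))) (take-sum M (idx j r) _ _ (ownMax (not (same s (sgn r))) (good (j , r)))
        λ m → own-≤ (not (same s (sgn r))) (good (j , r)) (chosen m (j , r)) (proj₂ ∘ chosen-good m (j , r)))))
        (row-fits s (u j) (sgn r) (idx j r)))
      where
      lits = ∑ (allFin J) (λ j′ → load (slot j r s) (lit j′ false) + load (slot j r s) (lit j′ true))
      columns = ∑ (allFin M) (λ m → load (slot j r s) (col m false) + load (slot j r s) (col m true))
      one : lits ≡ ind (not (same s (u j)))
      one = trans (∑-single {x = j} _ (Uniqueₚ.allFin⁺ J) (∈ₚ.∈-allFin j) (other-lit j r s)) (own-lit j r s)
    capacitated (lit j s) = ≤-trans (+-mono-≤ (+-mono-≤ slots≤ lits≤) (≤-reflexive (trans (+-identityʳ _) (∑-zero (allFin M)))))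
        (≤-reflexive (trans (+-identityʳ _) (+-comm (length slots) 1)))
      where
      slots≤ : ∑ pairs (λ p → load (lit j s) (slot (proj₁ p) (proj₂ p) false) + load (lit j s) (slot (proj₁ p) (proj₂ p) true)) ≤ length slots
      slots≤ = ≤-trans (∑-mono pairs (λ { (j′ , r) → gadget-lit j s j′ r })) (≤-reflexive (trans (∑-product (allFin J) slots (λ p → ind (eqF j (proj₁ p))))
        (trans (∑-cong (allFin J) (λ j′ → trans (∑-const slots _) (*-comm (length slots) _))) (one-gadget j (length slots)))))
      lits≤ : ∑ (allFin J) (λ j′ → load (lit j s) (lit j′ false) + load (lit j s) (lit j′ true)) ≤ 1
      lits≤ = ≤-trans (∑-mono (allFin J) (edge-lit j s)) (≤-reflexive (trans (∑-cong (allFin J) (λ j′ → sym (*-identityʳ _))) (one-gadget j 1)))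
    capacitated (col m i) = ≤-trans (≤-reflexive (cong₂ (λ x y → column m i + x + (y + 1)) (∑-zero (allFin J)) (∑-zero (allFin M))))
      (≤-trans (≤-reflexive (cong (_+ 1) (+-identityʳ (column m i)))) (column-≤ m i))
    capacitated slotHub = ≤-reflexive (cong₂ (λ x y → x + (y + 1)) (cong₂ _+_ (∑-zero pairs) (∑-zero (allFin J))) (∑-zero (allFin M)))
    capacitated columnHub = ≤-reflexive (cong₂ (λ x y → x + (y + 0)) (cong₂ _+_ (∑-zero pairs) (∑-zero (allFin J))) (∑-zero (allFin M)))

    small : sumV (ind ∘ S) ≤ budget
    small = ≤-reflexive (trans (cong₂ _+_ (cong₂ _+_ (trans (∑-product (allFin J) slots (λ _ → 2)) (trans (∑-cong (allFin J) (λ _ → ∑-const slots 2))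
          (trans (∑-const (allFin J) _) (cong (λ x → x * (length slots * 2)) (length-allFin J)))))
        (trans (∑-cong (allFin J) (λ j → trans (+-comm (ind (not (u j))) (ind (u j))) (ind-not (u j)))) (trans (∑-const (allFin J) 1) (trans (*-identityʳ _) (length-allFin J)))))
        (cong (_+ 1) (trans (∑-const (allFin M) 2) (cong (λ x → x * 2) (length-allFin M)))))
      (rearrange J (length slots) M))
      where
      rearrange : ∀ J R M → (J * (R * 2) + J) + (M * 2 + 1) ≡ J * suc (2 * R) + suc (2 * M)
      rearrange = solve-∀

    cover : Cover cap budget
    cover = record { S = S ; h = h ; small = small ; oriented = oriented ; covered = covered ; capacitated = capacitated }

-- Linear clique-width

-- Labels and adjacency are functions, so the graph that an expression evaluates to can be compared
-- with the intended one only pointwise.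
data _≈ᴸ_ {w : ℕ} : LGraph w → LGraph w → Set where
  alike : ∀ {n lab lab′ ad ad′} → (∀ u → lab u ≡ lab′ u) → (∀ u v → ad u v ≡ ad′ u v) → lgraph n lab ad ≈ᴸ lgraph n lab′ ad′

≈ᴸ-trans : ∀ {w} {f g h : LGraph w} → f ≈ᴸ g → g ≈ᴸ h → f ≈ᴸ h
≈ᴸ-trans (alike a b) (alike c d) = alike (λ u → trans (a u) (c u)) (λ u v → trans (b u v) (d u v))

applyOp-≈ : ∀ {w} (o : Op w) {g h} → g ≈ᴸ h → applyOp o g ≈ᴸ applyOp o h
applyOp-≈ (intro a) (alike l e) = alike (λ { zero → refl ; (suc u) → l u })
  (λ { zero zero → refl ; zero (suc v) → refl ; (suc u) zero → refl ; (suc u) (suc v) → e u v })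
applyOp-≈ (join a b _) (alike l e) = alike l λ u v → cong₂ _∨_ (e u v)
  (cong₂ (λ x y → (eqF x a ∧ eqF y b) ∨ (eqF x b ∧ eqF y a)) (l u) (l v))
applyOp-≈ (relabel a b) (alike l e) = alike (λ u → cong (λ x → if eqF x a then b else x) (l u)) e

evalOps-≈ : ∀ {w} (os : List (Op w)) {g h} → g ≈ᴸ h → evalOps os g ≈ᴸ evalOps os h
evalOps-≈ []       e = e
evalOps-≈ (o ∷ os) e = evalOps-≈ os (applyOp-≈ o e)

evalOps-++ : ∀ {w} (os ps : List (Op w)) g → evalOps (os ++ ps) g ≡ evalOps ps (evalOps os g)
evalOps-++ []       ps g = refl
evalOps-++ (o ∷ os) ps g = evalOps-++ os ps (applyOp o g)

module LinearCliqueWidth (J M : ℕ) {Slot : Set} (slots : List Slot) where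
  open Construction J M slots

  pattern old      = zero
  pattern slotᴸ    = suc zero
  pattern columnᴸ  = suc (suc zero)
  pattern falseᴸ   = suc (suc (suc zero))
  pattern trueᴸ    = suc (suc (suc (suc zero)))
  pattern fresh    = suc (suc (suc (suc (suc zero))))

  litLabel : Bool → Fin 6
  litLabel false = falseᴸ
  litLabel true  = trueᴸ

  -- A slot vertex enters as `fresh` and is joined to its literal vertex before it becomes `slotᴸ`;
  -- otherwise the join would also catch earlier slot vertices. The literals of the previous
  -- variable retire to `old` just before the next pair enters.
  operations : Vertex → List (Op 6)
  operations (slot j r false) = intro fresh ∷ join fresh falseᴸ (λ ()) ∷ relabel fresh slotᴸ ∷ []
  operations (slot j r true)  = intro fresh ∷ join fresh trueᴸ (λ ()) ∷ relabel fresh slotᴸ ∷ []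
  operations (lit j false)    = intro falseᴸ ∷ join falseᴸ trueᴸ (λ ()) ∷ []
  operations (lit j true)     = relabel falseᴸ old ∷ relabel trueᴸ old ∷ intro trueᴸ ∷ []
  operations (col m i)        = intro columnᴸ ∷ []
  operations slotHub          = intro slotᴸ ∷ []
  operations columnHub        = intro columnᴸ ∷ []

  -- The first vertex of the list is introduced last.
  build : List Vertex → List (Op 6)
  build []       = []
  build (v ∷ vs) = build vs ++ operations v

  -- Only the literals of the variable whose gadget is under construction have labels of their own.
  label : Maybe (Fin J) → Vertex → Fin 6
  label c        (slot _ _ _) = slotᴸ
  label nothing  (lit _ _)    = old
  label (just j) (lit j′ s)   = if eqF j j′ then litLabel s else old
  label c        (col _ _)    = columnᴸ
  label c        slotHub      = slotᴸ
  label c        columnHub    = columnᴸ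

  picture : Maybe (Fin J) → List Vertex → LGraph 6
  picture c vs = lgraph (length vs) (label c ∘ List.lookup vs) (λ u v → within (List.lookup vs u) (List.lookup vs v))

  Built : Maybe (Fin J) → List Vertex → Set
  Built c vs = evalOps (build vs) emptyLG ≈ᴸ picture c vs

  extend : ∀ {c c′ vs} v → Built c vs → evalOps (operations v) (picture c vs) ≈ᴸ picture c′ (v ∷ vs) → Built c′ (v ∷ vs)
  extend {c} {c′} {vs} v b e = subst (_≈ᴸ picture c′ (v ∷ vs)) (sym (evalOps-++ (build vs) (operations v) emptyLG)) (≈ᴸ-trans (evalOps-≈ (operations v) b) e)

  not-fresh : ∀ c v → eqF (label c v) fresh ≡ false
  not-fresh c        (slot _ _ _) = refl
  not-fresh nothing  (lit _ _)    = refl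
  not-fresh (just j) (lit j′ s) with eqF j j′ | s
  ... | false | _     = refl
  ... | true  | false = refl
  ... | true  | true  = refl
  not-fresh c        (col _ _)    = refl
  not-fresh c        slotHub      = refl
  not-fresh c        columnHub    = refl

  slot-joined : ∀ j r s w → eqF (label (just j) w) (litLabel s) ≡ within (slot j r s) w
  slot-joined j r false (slot _ _ _) = refl
  slot-joined j r true  (slot _ _ _) = refl
  slot-joined j r s     (lit j′ s′) with eqF j j′ | s | s′
  ... | false | false | _     = refl
  ... | false | true  | _     = refl
  ... | true  | false | false = refl
  ... | true  | false | true  = refl
  ... | true  | true  | false = refl
  ... | true  | true  | true  = refl
  slot-joined j r false (col _ _)    = refl
  slot-joined j r true  (col _ _)    = refl
  slot-joined j r false slotHub      = refl
  slot-joined j r true  slotHub      = refl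
  slot-joined j r false columnHub    = refl
  slot-joined j r true  columnHub    = refl

  build-slot : ∀ {j vs} r s → Built (just j) vs → Built (just j) (slot j r s ∷ vs)
  build-slot {j} {vs} r s b = extend (slot j r s) b (step-slot s)
    where
    at-vs : Fin (length vs) → Vertex
    at-vs = List.lookup vs
    relabelled : ∀ u → (if eqF (label (just j) (at-vs u)) fresh then slotᴸ else label (just j) (at-vs u)) ≡ label (just j) (at-vs u)
    relabelled u rewrite not-fresh (just j) (at-vs u) = refl
    to-new : ∀ s u → (eqF (label (just j) (at-vs u)) fresh ∧ false) ∨ (eqF (label (just j) (at-vs u)) (litLabel s) ∧ true) ≡ within (at-vs u) (slot j r s)
    to-new s u rewrite not-fresh (just j) (at-vs u) = trans (∧-comm _ true) (trans (slot-joined j r s (at-vs u)) (within-sym (slot j r s) (at-vs u)))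
    among : ∀ s u v → within (at-vs u) (at-vs v) ∨ (eqF (label (just j) (at-vs u)) fresh ∧ eqF (label (just j) (at-vs v)) (litLabel s))
      ∨ (eqF (label (just j) (at-vs u)) (litLabel s) ∧ eqF (label (just j) (at-vs v)) fresh) ≡ within (at-vs u) (at-vs v)
    among s u v rewrite not-fresh (just j) (at-vs u) | not-fresh (just j) (at-vs v) =
      trans (cong (within (at-vs u) (at-vs v) ∨_) (∧-zeroʳ (eqF (label (just j) (at-vs u)) (litLabel s)))) (∨-identityʳ _)
    step-slot : ∀ s → evalOps (operations (slot j r s)) (picture (just j) vs) ≈ᴸ picture (just j) (slot j r s ∷ vs)
    step-slot false = alike (λ { zero → refl ; (suc u) → relabelled u })
      (λ { zero zero → refl ; zero (suc v) → trans (∨-identityʳ _) (slot-joined j r false (at-vs v)) ; (suc u) zero → to-new false u ; (suc u) (suc v) → among false u v })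
    step-slot true  = alike (λ { zero → refl ; (suc u) → relabelled u })
      (λ { zero zero → refl ; zero (suc v) → trans (∨-identityʳ _) (slot-joined j r true (at-vs v)) ; (suc u) zero → to-new true u ; (suc u) (suc v) → among true u v })

  Apart : Fin J → Vertex → Set
  Apart j w = ∀ {x} → w ≢ inj₁ (j , x)

  apart-label : ∀ {j} w → Apart j w → label (just j) w ≡ label nothing w
  apart-label (slot _ _ _) ap = refl
  apart-label {j} (lit j′ s) ap rewrite eqF-≢ {i = j} {j′} (λ { refl → ap refl }) = refl
  apart-label (col _ _)    ap = refl
  apart-label slotHub      ap = refl
  apart-label columnHub    ap = refl

  apart-within : ∀ {j} s w → Apart j w → within (lit j s) w ≡ false
  apart-within {j} s (slot j′ _ _) ap rewrite eqF-≢ {i = j} {j′} (λ { refl → ap refl }) = refl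
  apart-within {j} s (lit j′ _) ap rewrite eqF-≢ {i = j} {j′} (λ { refl → ap refl }) = refl
  apart-within s (inj₂ _)      ap = refl

  not-literal : ∀ w s → eqF (label nothing w) (litLabel s) ≡ false
  not-literal (slot _ _ _) false = refl
  not-literal (slot _ _ _) true  = refl
  not-literal (lit _ _)    false = refl
  not-literal (lit _ _)    true  = refl
  not-literal (col _ _)    false = refl
  not-literal (col _ _)    true  = refl
  not-literal slotHub      false = refl
  not-literal slotHub      true  = refl
  not-literal columnHub    false = refl
  not-literal columnHub    true  = refl

  relabel-literals : ∀ c w → (if eqF (if eqF (label c w) falseᴸ then old else label c w) trueᴸ then old
    else (if eqF (label c w) falseᴸ then old else label c w)) ≡ label nothing w
  relabel-literals c        (slot _ _ _) = refl
  relabel-literals nothing  (lit _ _)    = refl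
  relabel-literals (just j) (lit j′ s) with eqF j j′ | s
  ... | false | _     = refl
  ... | true  | false = refl
  ... | true  | true  = refl
  relabel-literals c        (col _ _)    = refl
  relabel-literals c        slotHub      = refl
  relabel-literals c        columnHub    = refl

  -- After both literal labels have been retired they belong to variable `j` alone, so the join that
  -- follows creates the edge between the two literal vertices and nothing else.
  build-literals : ∀ {c j vs} → (∀ {w} → w ∈ vs → Apart j w) → Built c vs → Built (just j) (lit j false ∷ lit j true ∷ vs)
  build-literals {c} {j} {vs} apart b = extend (lit j false) (extend (lit j true) b step-true) step-false
    where
    at-vs : Fin (length vs) → Vertex
    at-vs = List.lookup vs
    ap : ∀ u → Apart j (at-vs u)
    ap u = apart (∈ₚ.∈-lookup u)
    self : ∀ s → label (just j) (lit j s) ≡ litLabel s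
    self s rewrite eqF-refl j = refl
    step-true : evalOps (operations (lit j true)) (picture c vs) ≈ᴸ picture (just j) (lit j true ∷ vs)
    step-true = alike (λ { zero → sym (self true) ; (suc u) → trans (relabel-literals c (at-vs u)) (sym (apart-label (at-vs u) (ap u))) })
      (λ { zero zero → sym (adjacent-self true) ; zero (suc v) → sym (apart-within true (at-vs v) (ap v))
         ; (suc u) zero → sym (trans (within-sym (at-vs u) (lit j true)) (apart-within true (at-vs u) (ap u))) ; (suc u) (suc v) → refl })
      where
      adjacent-self : ∀ s → within (lit j s) (lit j s) ≡ false
      adjacent-self s rewrite same-refl s = ∧-zeroʳ (eqF j j)
    ws = lit j true ∷ vs
    not-false : ∀ u → eqF (label (just j) (List.lookup ws u)) falseᴸ ≡ false
    not-false zero    rewrite self true = refl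
    not-false (suc u) rewrite apart-label (at-vs u) (ap u) = not-literal (at-vs u) false
    joins : ∀ u → eqF (label (just j) (List.lookup ws u)) trueᴸ ≡ within (lit j false) (List.lookup ws u)
    joins zero    rewrite self true | eqF-refl j = refl
    joins (suc u) rewrite apart-label (at-vs u) (ap u) = trans (not-literal (at-vs u) true) (sym (apart-within false (at-vs u) (ap u)))
    step-false : evalOps (operations (lit j false)) (picture (just j) ws) ≈ᴸ picture (just j) (lit j false ∷ ws)
    step-false = alike (λ { zero → sym (self false) ; (suc u) → refl })
      (λ { zero zero → sym (∧-zeroʳ (eqF j j)) ; zero (suc v) → trans (∨-identityʳ _) (joins v) ; (suc u) zero → to-new u ; (suc u) (suc v) → among u v })
      where
      to-new : ∀ u → (eqF (label (just j) (List.lookup ws u)) falseᴸ ∧ false) ∨ (eqF (label (just j) (List.lookup ws u)) trueᴸ ∧ true) ≡ within (List.lookup ws u) (lit j false)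
      to-new u rewrite not-false u = trans (∧-comm _ true) (trans (joins u) (within-sym (lit j false) (List.lookup ws u)))
      among : ∀ u v → within (List.lookup ws u) (List.lookup ws v) ∨ (eqF (label (just j) (List.lookup ws u)) falseᴸ ∧ eqF (label (just j) (List.lookup ws v)) trueᴸ)
        ∨ (eqF (label (just j) (List.lookup ws u)) trueᴸ ∧ eqF (label (just j) (List.lookup ws v)) falseᴸ) ≡ within (List.lookup ws u) (List.lookup ws v)
      among u v rewrite not-false u | not-false v = trans (cong (within (List.lookup ws u) (List.lookup ws v) ∨_) (∧-zeroʳ (eqF (label (just j) (List.lookup ws u)) trueᴸ))) (∨-identityʳ _)

  build-isolated : ∀ {c vs} x → Built c vs → Built c (inj₂ x ∷ vs)
  build-isolated {c} {vs} x b = extend (inj₂ x) b (isolated x)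
    where
    isolated : ∀ x → evalOps (operations (inj₂ x)) (picture c vs) ≈ᴸ picture c (inj₂ x ∷ vs)
    isolated (inj₁ p) = alike (λ { zero → refl ; (suc u) → refl })
      (λ { zero zero → refl ; zero (suc v) → refl ; (suc u) zero → sym (within-sym (List.lookup vs u) (inj₂ (inj₁ p))) ; (suc u) (suc v) → refl })
    isolated (inj₂ false) = alike (λ { zero → refl ; (suc u) → refl })
      (λ { zero zero → refl ; zero (suc v) → refl ; (suc u) zero → sym (within-sym (List.lookup vs u) (inj₂ (inj₂ false))) ; (suc u) (suc v) → refl })
    isolated (inj₂ true) = alike (λ { zero → refl ; (suc u) → refl })
      (λ { zero zero → refl ; zero (suc v) → refl ; (suc u) zero → sym (within-sym (List.lookup vs u) (inj₂ (inj₂ true))) ; (suc u) (suc v) → refl })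

  build-all-isolated : ∀ {c vs} xs → Built c vs → Built c (map inj₂ xs ++ vs)
  build-all-isolated []       b = b
  build-all-isolated (x ∷ xs) b = build-isolated x (build-all-isolated xs b)

  build-slots : ∀ {j vs} rs → Built (just j) vs → Built (just j) (map (λ x → inj₁ (j , inj₁ x)) rs ++ vs)
  build-slots []             b = b
  build-slots ((r , s) ∷ rs) b = build-slot r s (build-slots rs b)

  sinks : List Vertex
  sinks = map inj₂ (map inj₁ (cartesianProduct (allFin M) bools) ++ map inj₂ bools)

  -- The index `c` is the variable whose gadget came last, or `nothing`. Its literals still carry
  -- labels of their own, which the final join of slots and columns does not touch.
  build-gadgets : ∀ js → Unique js → Σ[ c ∈ Maybe (Fin J) ] Built c (map inj₁ (cartesianProduct js gadget) ++ sinks)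
  build-gadgets []       un = nothing , subst (Built nothing) (Listₚ.++-identityʳ sinks) (build-all-isolated {nothing} {[]} (map inj₁ (cartesianProduct (allFin M) bools) ++ map inj₂ bools) (alike (λ ()) (λ ())))
  build-gadgets (j ∷ js) (j∉ ∷ un) = just j , subst (Built (just j)) shape
      (build-slots (cartesianProduct slots bools) (build-literals apart (proj₂ (build-gadgets js un))))
    where
    rest = map inj₁ (cartesianProduct js gadget) ++ sinks
    apart : ∀ {w} → w ∈ rest → Apart j w
    apart w∈ refl with ∈ₚ.∈-++⁻ (map inj₁ (cartesianProduct js gadget)) w∈
    ... | inj₁ a with ∈ₚ.∈-map⁻ inj₁ a
    ...   | _ , p , refl = All.lookup j∉ (proj₁ (∈ₚ.∈-cartesianProduct⁻ js gadget p)) refl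
    apart w∈ refl | inj₂ a with ∈ₚ.∈-map⁻ inj₂ a
    ...   | _ , _ , ()
    shape : map (λ x → inj₁ (j , inj₁ x)) (cartesianProduct slots bools) ++ (lit j false ∷ lit j true ∷ rest) ≡ map inj₁ (cartesianProduct (j ∷ js) gadget) ++ sinks
    shape = trans (sym (Listₚ.++-assoc (map (λ x → inj₁ (j , inj₁ x)) (cartesianProduct slots bools)) (lit j false ∷ lit j true ∷ []) rest))
      (trans (cong (_++ rest) (sym (trans (Listₚ.map-++ (λ x → inj₁ (j , x)) (map inj₁ (cartesianProduct slots bools)) (map inj₂ bools))
          (cong (_++ (lit j false ∷ lit j true ∷ [])) (sym (Listₚ.map-∘ (cartesianProduct slots bools)))))))
        (trans (sym (Listₚ.++-assoc (map (λ x → inj₁ (j , x)) gadget) (map inj₁ (cartesianProduct js gadget)) sinks))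
          (cong (_++ sinks) (trans (cong (_++ map inj₁ (cartesianProduct js gadget)) (Listₚ.map-∘ gadget))
            (sym (Listₚ.map-++ inj₁ (map (λ x → j , x) gadget) (cartesianProduct js gadget)))))))

  is-slotSide : ∀ c v → eqF (label c v) slotᴸ ≡ slotSide v
  is-slotSide c        (slot _ _ _) = refl
  is-slotSide nothing  (lit _ _)    = refl
  is-slotSide (just j) (lit j′ s) with eqF j j′ | s
  ... | false | _     = refl
  ... | true  | false = refl
  ... | true  | true  = refl
  is-slotSide c        (col _ _)    = refl
  is-slotSide c        slotHub      = refl
  is-slotSide c        columnHub    = refl

  is-columnSide : ∀ c v → eqF (label c v) columnᴸ ≡ columnSide v
  is-columnSide c        (slot _ _ _) = refl
  is-columnSide nothing  (lit _ _)    = refl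
  is-columnSide (just j) (lit j′ s) with eqF j j′ | s
  ... | false | _     = refl
  ... | true  | false = refl
  ... | true  | true  = refl
  is-columnSide c        (col _ _)    = refl
  is-columnSide c        slotHub      = refl
  is-columnSide c        columnHub    = refl

  isomorphic : ∀ {c} {g : LGraph 6} → g ≈ᴸ lgraph (length vertices) (label c ∘ List.lookup vertices) (Graph.adj graph) → IsoTo graph g
  isomorphic (alike _ e) = mk↔ₛ′ id id (λ _ → refl) (λ _ → refl) , λ i j → sym (e i j)

  linearCliqueWidth : LinCWAtMost 6 graph
  linearCliqueWidth = build vertices ++ last , isomorphic
      (subst (_≈ᴸ lgraph (length vertices) (label c ∘ List.lookup vertices) (Graph.adj graph)) (sym (evalOps-++ (build vertices) last emptyLG))
        (≈ᴸ-trans (evalOps-≈ last (proj₂ built)) (alike (λ _ → refl) λ u v → cong (λ x → within (at-vs u) (at-vs v) ∨ x)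
          (cong₂ _∨_ (cong₂ _∧_ (is-slotSide c (at-vs u)) (is-columnSide c (at-vs v))) (cong₂ _∧_ (is-columnSide c (at-vs u)) (is-slotSide c (at-vs v)))))))
    where
    last : List (Op 6)
    last = join slotᴸ columnᴸ (λ ()) ∷ []
    built = build-gadgets (allFin J) (Uniqueₚ.allFin⁺ J)
    c = proj₁ built
    at-vs = List.lookup vertices

-- The tableau of a computation

nth-beyond : ∀ xs i → length xs ≤ i → nth xs i ≡ nothing
nth-beyond []       i       le = refl
nth-beyond (x ∷ xs) (suc i) (s≤s le) = nth-beyond xs i le

nth-skip : ∀ n xs i → nth (replicate n nothing ++ xs) (i + n) ≡ nth xs i
nth-skip zero    xs i = cong (nth xs) (+-identityʳ i)
nth-skip (suc n) xs i rewrite +-suc i n = nth-skip n xs i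

nth-padding : ∀ n xs i → i < n → nth (replicate n nothing ++ xs) i ≡ nothing
nth-padding (suc n) xs zero    _        = refl
nth-padding (suc n) xs (suc i) (s≤s lt) = nth-padding n xs i lt

rightOf-positive : ∀ i n → rightOf i (+ n) ≡ + (i + n)
rightOf-positive i n = rightOf-+ i (+ n)

module Tableau (M : TM) where
  open TM M using (Q; δ; halt) renaming (start to start-state)

  -- The control nothing precedes the start state; it steps from the blank in front of the input onto the input.
  Control : Set
  Control = Maybe (Fin Q)

  Γ : Set
  Γ = Symbol × Maybe Control

  action : Control → Symbol → Control × Symbol × Move
  action nothing  s = just start-state , s , moveR
  action (just q) s = if does (q Fin.≟ halt) then (just q , s , stay)
    else (just (proj₁ (δ q s)) , proj₁ (proj₂ (δ q s)) , proj₂ (proj₂ (δ q s)))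

  record Snapshot : Set where
    constructor snap
    field
      control  : Control
      position : ℤ
      tape     : Tape
  open Snapshot

  next : Snapshot → Snapshot
  next (snap q h c) = snap (proj₁ a) (shift (proj₂ (proj₂ a)) h) (write c h (proj₁ (proj₂ a)))
    where a = action q (c h)

  headAt : ℤ → ℤ → Control → Maybe Control
  headAt z h q = if does (z ℤ.≟ h) then just q else nothing

  headAt-yes : ∀ z h q → z ≡ h → headAt z h q ≡ just q
  headAt-yes z h q e = cong (λ b → if b then just q else nothing) (dec-true (z ℤ.≟ h) e)

  headAt-no : ∀ z h q → z ≢ h → headAt z h q ≡ nothing
  headAt-no z h q ne = cong (λ b → if b then just q else nothing) (dec-false (z ℤ.≟ h) ne)

  cell : Snapshot → ℕ → Γ
  cell (snap q h c) y = c (+ y) , headAt (+ y) h q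

  stays : Control × Symbol × Move → Maybe Control
  stays (q , _ , stay) = just q
  stays (q , _ , _)    = nothing

  goesRight goesLeft : Control × Symbol × Move → Maybe Control
  goesRight (q , _ , moveR) = just q
  goesRight (q , _ , _)     = nothing
  goesLeft (q , _ , moveL)  = just q
  goesLeft (q , _ , _)      = nothing

  -- There is a single head, so a head at the left neighbour settles the matter without a look at
  -- the right one.
  arrives : Γ → Γ → Maybe Control
  arrives (l , just q)  _            = goesRight (action q l)
  arrives (l , nothing) (r , just q) = goesLeft (action q r)
  arrives (l , nothing) (r , nothing) = nothing

  evolve : Γ → Γ → Γ → Γ
  evolve l (s , just q)  r = proj₁ (proj₂ (action q s)) , stays (action q s)
  evolve l (s , nothing) r = s , arrives l r

  +-≢ : ∀ {m n} → m ≢ n → + m ≢ + n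
  +-≢ ne e = ne (ℤₚ.+-injective e)

  cell-local : ∀ k y → cell (next k) (suc y) ≡ evolve (cell k y) (cell k (suc y)) (cell k (suc (suc y)))
  cell-local (snap q h c) y = by-position (+ suc y ℤ.≟ h)
    where
    around : Maybe Control → Γ
    around m = evolve (cell (snap q h c) y) (c (+ suc y) , m) (cell (snap q h c) (suc (suc y)))
    after : ∀ a → headAt (+ suc y) (shift (proj₂ (proj₂ a)) (+ suc y)) (proj₁ a) ≡ stays a
    after (q′ , _ , moveL) = headAt-no (+ suc y) (+ y) q′ (+-≢ λ ())
    after (q′ , _ , moveR) = headAt-no (+ suc y) (+ suc (suc y)) q′ (+-≢ λ ())
    after (q′ , _ , stay)  = headAt-yes (+ suc y) (+ suc y) q′ refl
    a = action q (c h)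
    from-left : h ≡ + y → ∀ a → headAt (+ suc y) (shift (proj₂ (proj₂ a)) h) (proj₁ a) ≡ goesRight a
    from-left refl (q′ , _ , moveL) = headAt-no (+ suc y) (predℤ (+ y)) q′ λ e → absurd y e
      where
      absurd : ∀ y → + suc y ≢ predℤ (+ y)
      absurd zero    ()
      absurd (suc y) e = 2+n≢n (ℤₚ.+-injective e)
        where
        2+n≢n : ∀ {n} → suc (suc n) ≢ n
        2+n≢n {suc n} e = 2+n≢n (suc-injective e)
    from-left refl (q′ , _ , moveR) = headAt-yes (+ suc y) (+ suc y) q′ refl
    from-left refl (q′ , _ , stay)  = headAt-no (+ suc y) (+ y) q′ (+-≢ λ ())
    from-right : h ≡ + suc (suc y) → ∀ a → headAt (+ suc y) (shift (proj₂ (proj₂ a)) h) (proj₁ a) ≡ goesLeft a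
    from-right refl (q′ , _ , moveL) = headAt-yes (+ suc y) (+ suc y) q′ refl
    from-right refl (q′ , _ , moveR) = headAt-no (+ suc y) (+ suc (suc (suc y))) q′ (+-≢ λ ())
    from-right refl (q′ , _ , stay)  = headAt-no (+ suc y) (+ suc (suc y)) q′ (+-≢ λ ())
    elsewhere : + suc y ≢ h → + y ≢ h → + suc (suc y) ≢ h → ∀ m → + suc y ≢ shift m h
    elsewhere ≢h ne ne′ moveL e = ne′ (trans (cong sucℤ e) (sucℤ-predℤ h))
    elsewhere ≢h ne ne′ moveR e = ne (trans (cong predℤ e) (predℤ-sucℤ h))
    elsewhere ≢h ne ne′ stay  e = ≢h e
    arrival : + suc y ≢ h → Dec (+ y ≡ h) → Dec (+ suc (suc y) ≡ h) → headAt (+ suc y) (shift (proj₂ (proj₂ a)) h) (proj₁ a) ≡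
      arrives (c (+ y) , headAt (+ y) h q) (c (+ suc (suc y)) , headAt (+ suc (suc y)) h q)
    arrival _  (yes e) _ = trans (from-left (sym e) a) (sym (trans (cong (λ m → arrives (c (+ y) , m) (c (+ suc (suc y)) , headAt (+ suc (suc y)) h q)) (headAt-yes (+ y) h q e)) (cong (λ z → goesRight (action q (c z))) e)))
    arrival _  (no ne) (yes e) = trans (from-right (sym e) a) (sym (trans (cong₂ (λ m m′ → arrives (c (+ y) , m) (c (+ suc (suc y)) , m′)) (headAt-no (+ y) h q ne) (headAt-yes (+ suc (suc y)) h q e))
      (cong (λ z → goesLeft (action q (c z))) e)))
    arrival ≢h (no ne) (no ne′) = trans (headAt-no (+ suc y) (shift (proj₂ (proj₂ a)) h) (proj₁ a) (elsewhere ≢h ne ne′ (proj₂ (proj₂ a)))) (sym (cong₂ (λ m m′ → arrives (c (+ y) , m) (c (+ suc (suc y)) , m′)) (headAt-no (+ y) h q ne) (headAt-no (+ suc (suc y)) h q ne′)))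

    by-position : Dec (+ suc y ≡ h) → cell (next (snap q h c)) (suc y) ≡ around (headAt (+ suc y) h q)
    by-position (yes refl) = trans (cong₂ _,_ (write-same c (+ suc y) (proj₁ (proj₂ a))) (after a)) (sym (cong around (headAt-yes (+ suc y) (+ suc y) q refl)))
    by-position (no ≢h)    = trans (cong₂ _,_ (write-other c h (proj₁ (proj₂ a)) ≢h) (arrival ≢h (+ y ℤ.≟ h) (+ suc (suc y) ℤ.≟ h))) (sym (cong around (headAt-no (+ suc y) h q ≢h)))

  blank : Γ
  blank = nothing , nothing

  module History (k₀ : Snapshot) where
    at-time : ℕ → Snapshot
    at-time zero    = k₀
    at-time (suc t) = next (at-time t)

    blank-next : ∀ t y → cell (at-time t) y ≡ blank → cell (at-time t) (suc y) ≡ blank → cell (at-time t) (suc (suc y)) ≡ blank →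
      cell (at-time (suc t)) (suc y) ≡ blank
    blank-next t y a b c rewrite cell-local (at-time t) y | a | b | c = refl

    blank-right : ∀ {R} → (∀ y → R ≤ y → cell k₀ y ≡ blank) → ∀ t y → R + t ≤ y → cell (at-time t) y ≡ blank
    blank-right {R} b zero    y le = b y (subst (_≤ y) (+-identityʳ R) le)
    blank-right {R} b (suc t) zero le = contradiction (subst (_≤ 0) (+-suc R t) le) λ ()
    blank-right {R} b (suc t) (suc y) le = blank-next t y (blank-right b t y le′) (blank-right b t (suc y) (m≤n⇒m≤1+n le′))
        (blank-right b t (suc (suc y)) (m≤n⇒m≤1+n (m≤n⇒m≤1+n le′)))
      where
      le′ : R + t ≤ y
      le′ = s≤s⁻¹ (subst (_≤ suc y) (+-suc R t) le)

    -- The head comes nearer by at most one cell in a step, so one cell at the right end of the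
    -- blank stretch is given up each time. The condition `t ≤ y` is there because `cell-local`
    -- speaks of cells with a left neighbour in the natural numbers, and each step back in time uses
    -- one up.
    blank-left : ∀ {R} → (∀ y → y < R → cell k₀ y ≡ blank) → ∀ t y → t ≤ y → y + t < R → cell (at-time t) y ≡ blank
    blank-left {R} b zero    y le lt = b y (subst (_< R) (+-identityʳ y) lt)
    blank-left {R} b (suc t) (suc y) (s≤s le) lt = blank-next t y (blank-left b t y le (<-trans (n<1+n _) (<-trans (n<1+n _) lt′)))
        (blank-left b t (suc y) (m≤n⇒m≤1+n le) (<-trans (n<1+n _) lt′)) (blank-left b t (suc (suc y)) (m≤n⇒m≤1+n (m≤n⇒m≤1+n le)) lt′)
      where
      lt′ : suc (suc y) + t < R
      lt′ = subst (_< R) (cong ℕ.suc (+-suc y t)) lt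

    -- Row t of the tableau shows the tape from cell t on, so that a window determines the cell w places further on.
    module Rows (w′ : ℕ) where
      w = suc w′

      string : ℕ → Γ
      string p = cell (at-time (p / w)) (p % w + p / w)

      string-row : ∀ t i → i < w → string (i + t * w) ≡ cell (at-time t) (i + t)
      string-row t i lt = cong₂ (λ d r → cell (at-time d) (r + d)) quotient (trans ([m+kn]%n≡m%n i t w) (m<n⇒m%n≡m lt))
        where
        quotient : (i + t * w) / w ≡ t
        quotient = trans (+-distrib-/-∣ʳ i (divides t refl)) (cong₂ _+_ (m<n⇒m/n≡0 lt) (m*n/n≡m t w))

      module Padded {R off : ℕ} (1<w : 1 < w) (R≤w : R ≤ w) (right : ∀ y → R ≤ y → cell k₀ y ≡ blank) (left : ∀ y → y < off → cell k₀ y ≡ blank) where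

        next-row : ∀ t i → i < 2 → i + suc t + suc t < off → string (i + w + t * w) ≡ cell (at-time t) (i + w + t)
        next-row t i i<2 lt = trans (cong string (+-assoc i w (t * w))) (trans (string-row (suc t) i (<-≤-trans i<2 1<w))
          (trans (blank-left left (suc t) (i + suc t) (m≤n+m (suc t) i) lt) (sym (blank-right right t (i + w + t) (+-monoˡ-≤ t (≤-trans R≤w (m≤n+m w i)))))))

        -- The last windows of a row run over into the next row. They read its first two cells
        -- instead of the two tape cells past the right end: the former are blank because the head
        -- cannot have come so far to the left, the latter because it cannot have gone so far to the
        -- right.
        string-wide : ∀ t i → suc (suc (t + t)) + 1 < off → i < 2 + w → string (i + t * w) ≡ cell (at-time t) (i + t)
        string-wide t i lt i< with i <? w
        ... | yes i<w = string-row t i i<w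
        ... | no i≮w = subst (λ i → string (i + t * w) ≡ cell (at-time t) (i + t)) i≡ (next-row t (i ∸ w) d<2
            (<-≤-trans (s≤s (≤-trans (+-monoˡ-≤ (suc t) (+-monoˡ-≤ (suc t) (s≤s⁻¹ d<2))) (≤-reflexive (shape t)))) lt))
          where
          i≡ : i ∸ w + w ≡ i
          i≡ = m∸n+n≡m (≮⇒≥ i≮w)
          d<2 : i ∸ w < 2
          d<2 = +-cancelʳ-< w _ 2 (subst (_< 2 + w) (sym i≡) i<)
          shape : ∀ t → 1 + suc t + suc t ≡ suc (suc (t + t)) + 1
          shape = solve-∀

        string-window : ∀ t i → i < w → suc (suc (t + t)) + 1 < off →
          string (i + t * w + w) ≡ evolve (string (i + t * w)) (string (suc (i + t * w))) (string (suc (suc (i + t * w))))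
        string-window t i i<w lt = trans (cong string (trans (+-assoc i (t * w) w) (cong (λ x → i + x) (+-comm (t * w) w))))
          (trans (string-row (suc t) i i<w) (trans (cong (cell (at-time (suc t))) (+-suc i t)) (trans (cell-local (at-time t) (i + t))
            (sym (trans (cong (λ c → evolve c (string (suc (i + t * w))) (string (suc (suc (i + t * w))))) (string-row t i i<w))
              (cong₂ (evolve (cell (at-time t) (i + t))) (string-wide t (suc i) lt (s≤s (m≤n⇒m≤1+n i<w))) (string-wide t (suc (suc i)) lt (s≤s (s≤s i<w)))))))))

  Follows : Snapshot → Config Q → Set
  Follows (snap q h c) k = q ≡ just (Config.state k) × Shows k h c

  follows-next : ∀ k (m : Config Q) → Follows k m → Follows (next k) (step M m)
  follows-next (snap q h c) (conf p ls s rs) (refl , sh@(shows a _ _)) with p Fin.≟ halt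
  ... | yes _ = refl , shows (trans (unchanged h) a) (λ i → trans (unchanged _) (Shows.at-right sh i)) (λ i → trans (unchanged _) (Shows.at-left sh i))
    where
    unchanged : ∀ z → write c h (c h) z ≡ c z
    unchanged z with z ℤ.≟ h
    ... | yes refl = refl
    ... | no _     = refl
  ... | no _ rewrite a = cong just (sym (moveHead-state q′ ls s′ rs m)) , shows-move m (shows-write {q′ = q′} s′ sh)
    where
    q′ = proj₁ (δ p s)
    s′ = proj₁ (proj₂ (δ p s))
    m = proj₂ (proj₂ (δ p s))

  run-suc : ∀ t k → run M (suc t) k ≡ step M (run M t k)
  run-suc zero    k = refl
  run-suc (suc t) k = run-suc t (step M k)

  run-halted : ∀ d k → Config.state k ≡ halt → run M d k ≡ k
  run-halted zero    k e = refl
  run-halted (suc d) k e = trans (cong (run M d) (halted k e)) (run-halted d k e)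
    where
    halted : ∀ k → Config.state k ≡ halt → step M k ≡ k
    halted (conf p ls s rs) e rewrite dec-true (p Fin.≟ halt) e = refl

  module Computation (off : ℕ) (z : List Bool) where
    initial-tape : Tape
    initial-tape (+ y)    = nth (replicate (suc off) nothing ++ map just z) y
    initial-tape -[1+ _ ] = nothing

    open History (snap nothing (+ off) initial-tape) public

    tape-skip : ∀ i → initial-tape (+ (i + suc off)) ≡ nth (map just z) i
    tape-skip i = nth-skip (suc off) (map just z) i

    tape-left : ∀ i n → n ≤ off → initial-tape (leftOf i (+ n)) ≡ nothing
    tape-left zero    n       le = nth-padding (suc off) (map just z) n (s≤s le)
    tape-left (suc i) zero    le = cong initial-tape (leftOf-negative i 0)
    tape-left (suc i) (suc n) le = tape-left i n (<⇒≤ le)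

    cell-right : ∀ y → suc off + length z ≤ y → cell (at-time 0) y ≡ blank
    cell-right y le = cong₂ _,_ (nth-beyond (replicate (suc off) nothing ++ map just z) y (subst (_≤ y)
        (sym (trans (Listₚ.length-++ (replicate (suc off) nothing)) (cong₂ _+_ (Listₚ.length-replicate (suc off)) (Listₚ.length-map just z)))) le))
      (headAt-no (+ y) (+ off) nothing (+-≢ λ { refl → <-irrefl refl (≤-trans (m≤m+n (suc off) _) le) }))

    cell-left : ∀ y → y < off → cell (at-time 0) y ≡ blank
    cell-left y lt = cong₂ _,_ (nth-padding (suc off) (map just z) y (m≤n⇒m≤1+n lt)) (headAt-no (+ y) (+ off) nothing (+-≢ (<⇒≢ lt)))

    -- The two clocks differ by one, because the step from the cell before the input into the start
    -- state comes first.
    follows : ∀ t → Follows (at-time (suc t)) (run M t (initConf M z))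
    follows zero = begins z refl
      where
      same-tape : ∀ y → write initial-tape (+ off) (initial-tape (+ off)) y ≡ initial-tape y
      same-tape y with y ℤ.≟ + off
      ... | yes refl = refl
      ... | no _     = refl
      sh : ∀ {s rs} → (∀ i → nth (s ∷ rs) i ≡ nth (map just z) i) → Shows (conf start-state [] s rs) (+ suc off) (write initial-tape (+ off) (initial-tape (+ off)))
      sh eq = shows (trans (same-tape (+ suc off)) (trans (tape-skip 0) (sym (eq 0))))
        (λ i → trans (same-tape (rightOf i (+ suc (suc off)))) (trans (cong initial-tape (trans (rightOf-positive i (suc (suc off))) (cong +_ (+-suc i (suc off))))) (trans (tape-skip (suc i)) (sym (eq (suc i))))))
        (λ i → trans (same-tape (leftOf i (+ off))) (tape-left i off ≤-refl))
      begins : ∀ y → y ≡ z → Follows (at-time 1) (initConf M y)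
      begins []       refl = refl , sh (λ { zero → refl ; (suc i) → refl })
      begins (b ∷ bs) refl = refl , sh (λ i → refl)
    follows (suc t) rewrite run-suc t (initConf M z) = follows-next (at-time (suc t)) _ (follows t)

    -- The additional time `d` fills up the fixed number of rows; a halted machine idles, so the
    -- answer stays under the head.
    answer : ∀ {t b} d → RunsTo M z t (b ∷ []) → control (at-time (suc (t + d))) ≡ just halt × tape (at-time (suc (t + d))) (position (at-time (suc (t + d)))) ≡ just b
    answer {t} {b} d (h , o) with follows (t + d)
    ... | e , sh = trans e (cong just (trans (cong Config.state stopped) h)) , trans (Shows.at-head sh) (trans (cong Config.head stopped) (first (run M t (initConf M z)) o))
      where
      stopped : run M (t + d) (initConf M z) ≡ run M t (initConf M z)
      stopped = trans (run-+ M t d _) (run-halted d _ h)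
      first : ∀ k → output k ≡ b ∷ [] → Config.head k ≡ just b
      first (conf _ _ (just b′) rs) e = cong just (Listₚ.∷-injectiveˡ e)

    position-bound : ∀ t → t ≤ off → Σ[ y ∈ ℕ ] position (at-time t) ≡ + y × off ≤ y + t × y ≤ off + t
    position-bound zero    _  = off , refl , m≤m+n off 0 , m≤m+n off 0
    position-bound (suc t) le with position-bound t (<⇒≤ le)
    ... | y , e , lo , hi = moved (proj₂ (proj₂ (action (control (at-time t)) (tape (at-time t) (position (at-time t)))))) y e lo hi
      where
      moved : ∀ m y → position (at-time t) ≡ + y → off ≤ y + t → y ≤ off + t →
        Σ[ y′ ∈ ℕ ] shift m (position (at-time t)) ≡ + y′ × off ≤ y′ + suc t × y′ ≤ off + suc t
      moved stay  y       e lo hi = y , e , ≤-trans lo (+-monoʳ-≤ y (n≤1+n t)) , ≤-trans hi (+-monoʳ-≤ off (n≤1+n t))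
      moved moveR y       e lo hi = suc y , cong sucℤ e , ≤-trans lo (≤-trans (+-monoʳ-≤ y (n≤1+n t)) (n≤1+n _)) , ≤-trans (s≤s hi) (≤-reflexive (sym (+-suc off t)))
      moved moveL zero    e lo hi = contradiction (≤-trans le lo) (<-irrefl refl)
      moved moveL (suc y) e lo hi = y , cong predℤ e , ≤-trans lo (≤-reflexive (sym (+-suc y t))) , ≤-trans (n≤1+n y) (≤-trans hi (+-monoʳ-≤ off (n≤1+n t)))

nthOr : ∀ {A : Set} → A → List A → ℕ → A
nthOr d []       _       = d
nthOr d (x ∷ xs) zero    = x
nthOr d (x ∷ xs) (suc n) = nthOr d xs n

module _ {A : Set} (d : A) where
  nthOr-++ˡ : ∀ xs ys {i} → i < length xs → nthOr d (xs ++ ys) i ≡ nthOr d xs i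
  nthOr-++ˡ (x ∷ xs) ys {zero}  _        = refl
  nthOr-++ˡ (x ∷ xs) ys {suc i} (s≤s lt) = nthOr-++ˡ xs ys lt

  nthOr-++ʳ : ∀ xs ys i → nthOr d (xs ++ ys) (length xs + i) ≡ nthOr d ys i
  nthOr-++ʳ []       ys i = refl
  nthOr-++ʳ (x ∷ xs) ys i = nthOr-++ʳ xs ys i

  nthOr-replicate : ∀ n x {i} → i < n → nthOr d (replicate n x) i ≡ x
  nthOr-replicate (suc n) x {zero}  _        = refl
  nthOr-replicate (suc n) x {suc i} (s≤s lt) = nthOr-replicate n x lt

  nthOr-map : ∀ {B : Set} (e : B) (f : B → A) xs {i} → i < length xs → nthOr d (map f xs) i ≡ f (nthOr e xs i)
  nthOr-map e f (x ∷ xs) {zero}  _        = refl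
  nthOr-map e f (x ∷ xs) {suc i} (s≤s lt) = nthOr-map e f xs lt

  nthOr-beyond : ∀ xs i → length xs ≤ i → nthOr d xs i ≡ d
  nthOr-beyond []       i       le       = refl
  nthOr-beyond (x ∷ xs) (suc i) (s≤s le) = nthOr-beyond xs i le

-- The clauses that describe the tableau

module Formula (M : TM) where
  open Tableau M
  open TM M using (Q; halt)

  symbols : List Symbol
  symbols = nothing ∷ just false ∷ just true ∷ []

  symbols-complete : ∀ s → s ∈ symbols
  symbols-complete nothing      = here refl
  symbols-complete (just false) = there (here refl)
  symbols-complete (just true)  = there (there (here refl))

  heads : List (Maybe Control)
  heads = nothing ∷ just nothing ∷ map (just ∘ just) (allFin Q)

  heads-complete : ∀ m → m ∈ heads
  heads-complete nothing         = here refl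
  heads-complete (just nothing)  = there (here refl)
  heads-complete (just (just q)) = there (there (∈ₚ.∈-map⁺ (just ∘ just) (∈ₚ.∈-allFin q)))

  -- The enumerations are abstract so that their lengths are never unfolded.
  abstract
    alphabet : List Γ
    alphabet = cartesianProduct symbols heads

    alphabet-complete : ∀ γ → γ ∈ alphabet
    alphabet-complete (s , m) = ∈ₚ.∈-cartesianProduct⁺ (symbols-complete s) (heads-complete m)

  g : ℕ
  g = length alphabet

  letter : Fin g → Γ
  letter = List.lookup alphabet

  code : Γ → Fin g
  code γ = index (alphabet-complete γ)

  letter-code : ∀ γ → letter (code γ) ≡ γ
  letter-code γ = sym (Anyₚ.lookup-index (alphabet-complete γ))

  _≟Γ_ : (γ γ′ : Γ) → Dec (γ ≡ γ′)
  _≟Γ_ = Productₚ.≡-dec (Maybeₚ.≡-dec Bool._≟_) (Maybeₚ.≡-dec (Maybeₚ.≡-dec Fin._≟_))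

  -- Every position carries one clause of each kind, so the number of a clause is `C` times the
  -- position plus the kind. The description of the rows only decides which of these clauses are
  -- active.
  data Kind : Set where
    unit       : Fin g → Kind
    free chain : Kind
    final      : Fin g → Kind
    prop       : (a b c : Fin g) → Kind

  abstract
    kinds : List Kind
    kinds = map unit (allFin g) ++ free ∷ chain ∷ map final (allFin g) ++
      map (λ t → prop (proj₁ t) (proj₁ (proj₂ t)) (proj₂ (proj₂ t))) (cartesianProduct (allFin g) (cartesianProduct (allFin g) (allFin g)))

    kinds-complete : ∀ κ → κ ∈ kinds
    kinds-complete (unit a)     = ∈ₚ.∈-++⁺ˡ (∈ₚ.∈-map⁺ unit (∈ₚ.∈-allFin a))
    kinds-complete free         = ∈ₚ.∈-++⁺ʳ (map unit (allFin g)) (here refl)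
    kinds-complete chain        = ∈ₚ.∈-++⁺ʳ (map unit (allFin g)) (there (here refl))
    kinds-complete (final a)    = ∈ₚ.∈-++⁺ʳ (map unit (allFin g)) (there (there (∈ₚ.∈-++⁺ˡ (∈ₚ.∈-map⁺ final (∈ₚ.∈-allFin a)))))
    kinds-complete (prop a b c) = ∈ₚ.∈-++⁺ʳ (map unit (allFin g)) (there (there (∈ₚ.∈-++⁺ʳ (map final (allFin g))
      (∈ₚ.∈-map⁺ (λ t → prop (proj₁ t) (proj₁ (proj₂ t)) (proj₂ (proj₂ t)))
        (∈ₚ.∈-cartesianProduct⁺ (∈ₚ.∈-allFin a) (∈ₚ.∈-cartesianProduct⁺ (∈ₚ.∈-allFin b) (∈ₚ.∈-allFin c)))))))

  C : ℕ
  C = length kinds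

  kind : Fin C → Kind
  kind = List.lookup kinds

  -- The offset of the cell from the position of the clause: 0, 1, 2, or the width of a row.
  data Offset : Set where
    o0 o1 o2 ow : Offset

  bitCell : Bool → Γ
  bitCell b = just b , nothing

  -- Clauses with fewer than four literals repeat one of them.
  literal : Kind → Fin 4 → Offset × Fin g × Bool
  literal (unit a)     _                      = o0 , a , true
  literal free         zero                   = o0 , code (bitCell false) , true
  literal free         (suc zero)             = o0 , code (bitCell true) , true
  literal free         _                      = o0 , code blank , true
  literal chain        zero                   = o0 , code blank , false
  literal chain        _                      = o1 , code blank , true
  literal (final a)    _                      = ow , a , false
  literal (prop a b c) zero                   = o0 , a , false
  literal (prop a b c) (suc zero)             = o1 , b , false
  literal (prop a b c) (suc (suc zero))       = o2 , c , false
  literal (prop a b c) (suc (suc (suc zero))) = ow , code (evolve (letter a) (letter b) (letter c)) , true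

  data Spec : Set where
    fixed             : Γ → Spec
    guess middle last : Spec

  -- In the last row the head must read the answer true.
  bad : Γ → Bool
  bad (just true , _)  = false
  bad (_ , just _)     = true
  bad (_ , nothing)    = false

  -- On the guessed stretch `free` and `chain` together describe a word followed by blanks. The
  -- transition clauses are active at every position.
  activates : Spec → Kind → Bool
  activates (fixed γ) (unit a)     = eqF a (code γ)
  activates guess     free         = true
  activates guess     chain        = true
  activates last      (final a)    = bad (letter a)
  activates _         (prop _ _ _) = true
  activates _         _            = false

  module Sized (w′ T′ off W : ℕ) (prefix : List Bool) where

    w rows : ℕ
    w = suc w′
    rows = 2 + T′

    offset : Offset → ℕ
    offset o0 = 0
    offset o1 = 1
    offset o2 = 2
    offset ow = w

    row : List Bool → List Γ
    row z = replicate off blank ++ (nothing , just nothing) ∷ map bitCell z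

    -- The closing blank is the cell that the `chain` clause of the last guessed position refers to.
    firstRow specs : List Spec
    firstRow = map fixed (row prefix) ++ replicate W guess ++ fixed blank ∷ []
    specs = firstRow ++ replicate (T′ * w) middle ++ replicate w last

    specAt : ℕ → Spec
    specAt = nthOr middle specs

    Models : (ℕ → Fin g → Bool) → Set
    Models U = ∀ p κ → p < rows * w → activates (specAt p) κ ≡ true →
      Σ[ l ∈ Fin 4 ] U (p + offset (proj₁ (literal κ l))) (proj₁ (proj₂ (literal κ l))) ≡ proj₂ (proj₂ (literal κ l))

    q : ℕ
    q = length (row prefix)

    row-++ : ∀ z → row (prefix ++ z) ≡ row prefix ++ map bitCell z
    row-++ z = trans (cong (λ xs → replicate off blank ++ (nothing , just nothing) ∷ xs) (Listₚ.map-++ bitCell prefix z))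
      (sym (Listₚ.++-assoc (replicate off blank) ((nothing , just nothing) ∷ map bitCell prefix) (map bitCell z)))

    length-row : ∀ z → length (row z) ≡ off + suc (length z)
    length-row z = trans (Listₚ.length-++ (replicate off blank)) (cong₂ _+_ (Listₚ.length-replicate off) (cong ℕ.suc (Listₚ.length-map bitCell z)))

    module _ (width-≡ : w ≡ q + suc W) (off-≡ : off ≡ T′ + T′ + 8) where

      length-firstRow : length firstRow ≡ w
      length-firstRow = trans (Listₚ.length-++ (map fixed (row prefix))) (trans (cong₂ _+_ (Listₚ.length-map fixed (row prefix))
        (trans (Listₚ.length-++ (replicate W guess)) (trans (cong (_+ 1) (Listₚ.length-replicate W)) (+-comm W 1)))) (sym width-≡))

      in-first : ∀ {p} → p < w → specAt p ≡ nthOr middle firstRow p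
      in-first lt = nthOr-++ˡ middle firstRow _ (subst (_ <_) (sym length-firstRow) lt)

      q<w : q < w
      q<w = subst (q <_) (sym width-≡) (m<m+n q (s≤s z≤n))

      length-fixed : length (map fixed (row prefix)) ≡ q
      length-fixed = Listₚ.length-map fixed (row prefix)

      spec-fixed : ∀ {p} → p < q → specAt p ≡ fixed (nthOr blank (row prefix) p)
      spec-fixed {p} lt = trans (in-first (<-trans lt q<w)) (trans (nthOr-++ˡ middle (map fixed (row prefix)) _ (subst (p <_) (sym length-fixed) lt))
        (nthOr-map middle blank fixed (row prefix) lt))

      after-fixed : ∀ i → q + i < w → specAt (q + i) ≡ nthOr middle (replicate W guess ++ fixed blank ∷ []) i
      after-fixed i lt = trans (in-first lt) (subst (λ n → nthOr middle firstRow (n + i) ≡ nthOr middle (replicate W guess ++ fixed blank ∷ []) i) length-fixed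
        (nthOr-++ʳ middle (map fixed (row prefix)) (replicate W guess ++ fixed blank ∷ []) i))

      guess<w : ∀ {i} → i ≤ W → q + i < w
      guess<w {i} le = subst (q + i <_) (sym width-≡) (+-monoʳ-< q (s≤s le))

      spec-guess : ∀ {i} → i < W → specAt (q + i) ≡ guess
      spec-guess {i} lt = trans (after-fixed i (guess<w (<⇒≤ lt))) (trans (nthOr-++ˡ middle (replicate W guess) _ (subst (i <_) (sym (Listₚ.length-replicate W)) lt))
        (nthOr-replicate middle W guess lt))

      spec-pad : specAt (q + W) ≡ fixed blank
      spec-pad = trans (after-fixed W (guess<w ≤-refl)) (subst (λ n → nthOr middle (replicate W guess ++ fixed blank ∷ []) n ≡ fixed blank)
        (trans (+-identityʳ _) (Listₚ.length-replicate W)) (nthOr-++ʳ middle (replicate W guess) (fixed blank ∷ []) 0))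

      after-first : ∀ i → specAt (w + i) ≡ nthOr middle (replicate (T′ * w) middle ++ replicate w last) i
      after-first i = subst (λ n → nthOr middle specs (n + i) ≡ nthOr middle (replicate (T′ * w) middle ++ replicate w last) i) length-firstRow
        (nthOr-++ʳ middle firstRow _ i)

      spec-middle : ∀ {i} → i < T′ * w → specAt (w + i) ≡ middle
      spec-middle {i} lt = trans (after-first i) (trans (nthOr-++ˡ middle (replicate (T′ * w) middle) _ (subst (i <_) (sym (Listₚ.length-replicate (T′ * w))) lt))
        (nthOr-replicate middle (T′ * w) middle lt))

      spec-last : ∀ {i} → i < w → specAt (w + (T′ * w + i)) ≡ last
      spec-last {i} lt = trans (after-first (T′ * w + i)) (trans (subst (λ n → nthOr middle (replicate (T′ * w) middle ++ replicate w last) (n + i) ≡ nthOr middle (replicate w last) i)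
        (Listₚ.length-replicate (T′ * w)) (nthOr-++ʳ middle (replicate (T′ * w) middle) (replicate w last) i)) (nthOr-replicate middle w last lt))

      data Place : ℕ → Set where
        inFixed : ∀ {p} → p < q → Place p
        inGuess : ∀ {i} → i < W → Place (q + i)
        inPad   : Place (q + W)
        inMid   : ∀ {i} → i < T′ * w → Place (w + i)
        inLast  : ∀ {i} → i < w → Place (w + (T′ * w + i))

      place : ∀ p → p < rows * w → Place p
      place p lt with p <? q
      ... | yes p<q = inFixed p<q
      ... | no p≮q with p <? w
      ...   | yes p<w with p ∸ q <? W
      ...     | yes i<W = subst Place (m+[n∸m]≡n (≮⇒≥ p≮q)) (inGuess i<W)
      ...     | no i≮W  = subst Place (trans (cong (λ i → q + i) (≤-antisym (≮⇒≥ i≮W) i≤W)) (m+[n∸m]≡n (≮⇒≥ p≮q))) inPad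
        where
        i≤W : p ∸ q ≤ W
        i≤W = s≤s⁻¹ (+-cancelˡ-< q _ _ (subst₂ _<_ (sym (m+[n∸m]≡n (≮⇒≥ p≮q))) width-≡ p<w))
      place p lt | no p≮q | no p≮w with p ∸ w <? T′ * w
      ...     | yes i<  = subst Place (m+[n∸m]≡n (≮⇒≥ p≮w)) (inMid i<)
      ...     | no i≮   = subst Place (trans (cong (λ i → w + i) (m+[n∸m]≡n (≮⇒≥ i≮))) (m+[n∸m]≡n (≮⇒≥ p≮w)))
          (inLast (+-cancelˡ-< (T′ * w) _ _ (subst₂ _<_ (sym (m+[n∸m]≡n (≮⇒≥ i≮))) (+-comm w (T′ * w))
            (+-cancelˡ-< w _ _ (subst (_< w + (w + T′ * w)) (sym (m+[n∸m]≡n (≮⇒≥ p≮w))) lt)))))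

      2<w : 2 < w
      2<w = ≤-trans (≤-trans (s≤s (s≤s (s≤s z≤n))) (≤-trans (m≤n+m 8 (T′ + T′)) (≤-reflexive (sym off-≡)))) (≤-trans (m≤m+n off _) (≤-trans (≤-reflexive (sym (length-row prefix))) (<⇒≤ q<w)))

      -- The last row for which this is used is `suc T′`, where the left side is `2 * T′ + 5`.
      enough : ∀ t → t < rows → suc (suc (t + t)) + 1 < off
      enough t (s≤s lt) = subst (suc (suc (t + t)) + 1 <_) (sym off-≡) (≤-trans (+-monoˡ-≤ 1 (s≤s (s≤s (s≤s (+-mono-≤ lt lt))))) (≤-by 2 (shape T′)))
        where
        shape : ∀ rows → suc (suc (suc (suc rows + suc rows))) + 1 + 2 ≡ rows + rows + 8
        shape = solve-∀

      module WithWitness (z : List Bool) (z≤ : length z ≤ W) where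
        open Computation off (prefix ++ z)
        open Rows w′ hiding (w)

        R = suc off + length (prefix ++ z)

        R≤w : R ≤ w
        R≤w = ≤-trans (≤-reflexive (trans (cong (λ n → suc off + n) (Listₚ.length-++ prefix)) (trans (shape off (length prefix) (length z))
            (cong (_+ length z) (sym (length-row prefix)))))) (≤-trans (+-monoʳ-≤ q (m≤n⇒m≤1+n z≤)) (≤-reflexive (sym width-≡)))
          where
          shape : ∀ o a b → suc o + (a + b) ≡ o + suc a + b
          shape = solve-∀

        open Padded {R} {off} (<-trans (s≤s (s≤s z≤n)) 2<w) R≤w cell-right cell-left

        window : ∀ p → p < rows * w → string (p + w) ≡ evolve (string p) (string (suc p)) (string (suc (suc p)))
        window p lt = subst (λ p → string (p + w) ≡ evolve (string p) (string (suc p)) (string (suc (suc p)))) (sym (m≡m%n+[m/n]*n p w))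
          (string-window (p / w) (p % w) (m%n<n p w) (enough (p / w) (m<n*o⇒m/o<n {o = w} lt)))

        first-cells : ∀ p → cell (at-time 0) p ≡ nthOr blank (row (prefix ++ z)) p
        first-cells p = trans (cong₂ _,_ refl (reshape p)) (go off p)
          where
          reshape : ∀ p → headAt (+ p) (+ off) nothing ≡ (if does (p ≟ off) then just nothing else nothing)
          reshape p = refl
          go : ∀ o p → (nth (replicate (suc o) nothing ++ map just (prefix ++ z)) p , (if does (p ≟ o) then just nothing else nothing)) ≡
            nthOr blank (replicate o blank ++ (nothing , just nothing) ∷ map bitCell (prefix ++ z)) p
          go zero    zero    = refl
          go zero    (suc p) = bits-at (prefix ++ z) p
            where
            bits-at : ∀ xs p → (nth (map just xs) p , nothing) ≡ nthOr blank (map bitCell xs) p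
            bits-at []       p       = refl
            bits-at (x ∷ xs) zero    = refl
            bits-at (x ∷ xs) (suc p) = bits-at xs p
          go (suc o) zero    = refl
          go (suc o) (suc p) = go o p

        string-first : ∀ p → p < w → string p ≡ nthOr blank (row (prefix ++ z)) p
        string-first p lt = trans (cong string (sym (+-identityʳ p))) (trans (string-row 0 p lt) (trans (cong (cell (at-time 0)) (+-identityʳ p)) (first-cells p)))

        string-fixed : ∀ {p} → p < q → string p ≡ nthOr blank (row prefix) p
        string-fixed {p} lt = trans (string-first p (<-trans lt q<w)) (trans (cong (λ xs → nthOr blank xs p) (row-++ z)) (nthOr-++ˡ blank (row prefix) _ lt))

        string-guess : ∀ {i} → i ≤ W → string (q + i) ≡ nthOr blank (map bitCell z) i
        string-guess {i} le = trans (string-first (q + i) (guess<w le)) (trans (cong (λ xs → nthOr blank xs (q + i)) (row-++ z)) (nthOr-++ʳ blank (row prefix) (map bitCell z) i))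

        string-pad : string (q + W) ≡ blank
        string-pad = trans (string-guess ≤-refl) (nthOr-beyond blank (map bitCell z) W (subst (_≤ W) (sym (Listₚ.length-map bitCell z)) z≤))

        model : ℕ → Fin g → Bool
        model p a = does (letter a ≟Γ string p)

        module Answered (b : Bool) (halted : Snapshot.control (at-time rows) ≡ just halt)
                        (answered : Snapshot.tape (at-time rows) (Snapshot.position (at-time rows)) ≡ just b) where

          last-row : ∀ i → i < w → string (w + (T′ * w + i) + w) ≡ cell (at-time rows) (i + rows)
          last-row i lt = trans (cong string (shape w (T′ * w) i)) (string-row rows i lt)
            where
            shape : ∀ w m i → w + (m + i) + w ≡ i + (w + (w + m))
            shape = solve-∀

          not-bad : b ≡ true → ∀ y → bad (cell (at-time rows) y) ≡ false
          not-bad refl y = go (Snapshot.position (at-time rows)) (Snapshot.tape (at-time rows)) (Snapshot.control (at-time rows)) answered (+ y ℤ.≟ Snapshot.position (at-time rows))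
            where
            go : ∀ h c q → c h ≡ just true → Dec (+ y ≡ h) → bad (c (+ y) , headAt (+ y) h q) ≡ false
            go h c q e (yes refl) = cong (λ s → bad (s , headAt (+ y) h q)) e
            go h c q e (no ne) = trans (cong (λ m → bad (c (+ y) , m)) (headAt-no (+ y) h q ne)) (headless (c (+ y)))
              where
              headless : ∀ s → bad (s , nothing) ≡ false
              headless nothing      = refl
              headless (just false) = refl
              headless (just true)  = refl

          complete : b ≡ true → Models model
          complete b≡ p κ lt act = by-place (place p lt) lt κ act
            where
            U : ℕ → Fin g → Bool
            U = model
            holds-at : ∀ p γ → string p ≡ γ → U p (code γ) ≡ true
            holds-at p γ e = dec-true (letter (code γ) ≟Γ string p) (trans (letter-code γ) (sym e))
            Goal : ℕ → Kind → Set
            Goal p κ = Σ[ l ∈ Fin 4 ] U (p + offset (proj₁ (literal κ l))) (proj₁ (proj₂ (literal κ l))) ≡ proj₂ (proj₂ (literal κ l))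
            here-at : ∀ p γ → string p ≡ γ → U (p + 0) (code γ) ≡ true
            here-at p γ e = subst (λ p → U p (code γ) ≡ true) (sym (+-identityʳ p)) (holds-at p γ e)
            unit-goal : ∀ p a γ → string p ≡ γ → eqF a (code γ) ≡ true → Goal p (unit a)
            unit-goal p a γ e eq with a Fin.≟ code γ
            ... | yes refl = zero , here-at p γ e
            prop-goal : ∀ p a b c → p < rows * w → Goal p (prop a b c)
            prop-goal p a b c lt = choose (letter a ≟Γ string (p + 0)) (letter b ≟Γ string (p + 1)) (letter c ≟Γ string (p + 2))
              where
              choose : Dec (letter a ≡ string (p + 0)) → Dec (letter b ≡ string (p + 1)) → Dec (letter c ≡ string (p + 2)) → Goal p (prop a b c)
              choose (no ne)  _        _        = zero , dec-false (letter a ≟Γ string (p + 0)) ne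
              choose (yes _)  (no ne)  _        = suc zero , dec-false (letter b ≟Γ string (p + 1)) ne
              choose (yes _)  (yes _)  (no ne)  = suc (suc zero) , dec-false (letter c ≟Γ string (p + 2)) ne
              choose (yes xa) (yes xb) (yes xc) = suc (suc (suc zero)) , holds-at (p + w) _ (trans (window p lt)
                (sym (trans (cong₂ (λ α β → evolve α β (letter c)) (trans xa (cong string (+-identityʳ p))) (trans xb (cong string (+-comm p 1))))
                  (cong (evolve (string p) (string (suc p))) (trans xc (cong string (+-comm p 2)))))))
            free-goal : ∀ p → (Σ[ b ∈ Bool ] string p ≡ bitCell b) ⊎ string p ≡ blank → Goal p free
            free-goal p (inj₁ (false , e)) = zero , here-at p (bitCell false) e
            free-goal p (inj₁ (true , e))  = suc zero , here-at p (bitCell true) e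
            free-goal p (inj₂ e)           = suc (suc zero) , here-at p blank e
            bit-or-blank : ∀ xs i → (Σ[ b ∈ Bool ] nthOr blank (map bitCell xs) i ≡ bitCell b) ⊎ nthOr blank (map bitCell xs) i ≡ blank
            bit-or-blank []       i       = inj₂ refl
            bit-or-blank (x ∷ xs) zero    = inj₁ (x , refl)
            bit-or-blank (x ∷ xs) (suc i) = bit-or-blank xs i
            blank-on : ∀ xs i → nthOr blank (map bitCell xs) i ≡ blank → nthOr blank (map bitCell xs) (suc i) ≡ blank
            blank-on []       i       e = refl
            blank-on (x ∷ xs) (suc i) e = blank-on xs i e
            chain-goal : ∀ {i} → i < W → Goal (q + i) chain
            chain-goal {i} lt = choose (letter (code blank) ≟Γ string (q + i + 0))
              where
              choose : Dec (letter (code blank) ≡ string (q + i + 0)) → Goal (q + i) chain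
              choose (no ne) = zero , dec-false (letter (code blank) ≟Γ string (q + i + 0)) ne
              choose (yes e) = suc zero , holds-at (q + i + 1) blank (trans (cong string (trans (+-assoc q i 1) (cong (λ j → q + j) (+-comm i 1)))) (trans (string-guess lt) (blank-on z i
                (trans (sym (string-guess (<⇒≤ lt))) (trans (cong string (sym (+-identityʳ (q + i)))) (trans (sym e) (letter-code blank)))))))
            final-goal : ∀ {i} a → i < w → bad (letter a) ≡ true → Goal (w + (T′ * w + i)) (final a)
            final-goal {i} a lt e = zero , dec-false (letter a ≟Γ string (w + (T′ * w + i) + w)) λ same →
              contradiction (trans (sym e) (trans (cong bad (trans same (last-row i lt))) (not-bad b≡ (i + rows)))) λ ()
            by-spec : ∀ {p s} → specAt p ≡ s → ∀ κ → activates (specAt p) κ ≡ true → activates s κ ≡ true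
            by-spec e κ act = trans (sym (cong (λ s → activates s κ) e)) act
            in-fixed : ∀ {p} γ → p < rows * w → string p ≡ γ → ∀ κ → activates (fixed γ) κ ≡ true → Goal p κ
            in-fixed {p} γ lt e (unit a)     act = unit-goal p a γ e act
            in-fixed {p} γ lt e (prop a b c) act = prop-goal p a b c lt
            in-guess : ∀ {i} → i < W → q + i < rows * w → ∀ κ → activates guess κ ≡ true → Goal (q + i) κ
            in-guess {i} i< lt free         act = free-goal (q + i) (Sum.map (λ { (b , e) → b , trans (string-guess (<⇒≤ i<)) e }) (trans (string-guess (<⇒≤ i<))) (bit-or-blank z i))
            in-guess {i} i< lt chain        act = chain-goal i<
            in-guess {i} i< lt (prop a b c) act = prop-goal (q + i) a b c lt
            in-middle : ∀ {p} → p < rows * w → ∀ κ → activates middle κ ≡ true → Goal p κ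
            in-middle {p} lt (prop a b c) act = prop-goal p a b c lt
            in-last : ∀ {i} → i < w → w + (T′ * w + i) < rows * w → ∀ κ → activates last κ ≡ true → Goal (w + (T′ * w + i)) κ
            in-last i< lt (final a)    act = final-goal a i< act
            in-last i< lt (prop a b c) act = prop-goal _ a b c lt
            by-place : ∀ {p} → Place p → p < rows * w → ∀ κ → activates (specAt p) κ ≡ true → Goal p κ
            by-place (inFixed p<q) lt κ act = in-fixed _ lt (string-fixed p<q) κ (by-spec (spec-fixed p<q) κ act)
            by-place (inGuess i<W) lt κ act = in-guess i<W lt κ (by-spec (spec-guess i<W) κ act)
            by-place inPad         lt κ act = in-fixed blank lt string-pad κ (by-spec spec-pad κ act)
            by-place (inMid i<)    lt κ act = in-middle lt κ (by-spec (spec-middle i<) κ act)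
            by-place (inLast i<)   lt κ act = in-last i< lt κ (by-spec (spec-last i<) κ act)

          -- A model may make several letters true at the same cell. The argument follows only the
          -- letter of the actual computation, which unit clauses and the guess make true in the
          -- first row and transition clauses propagate. If the answer were false, the letter at the
          -- head in the last row would be bad, and an active `final` clause would forbid it.
          sound : ∀ U → Models U → (∀ {i} → i < W → U (q + i) (code (nthOr blank (map bitCell z) i)) ≡ true) → b ≡ true
          sound U models guessed = good b refl
            where
            unit-true : ∀ {p γ} → p < rows * w → specAt p ≡ fixed γ → U p (code γ) ≡ true
            unit-true {p} {γ} lt e = trans (cong (λ n → U n (code γ)) (sym (+-identityʳ p)))
              (proj₂ (models p (unit (code γ)) lt (trans (cong (λ s → activates s (unit (code γ))) e) (eqF-refl (code γ)))))
            rows≥ : w ≤ rows * w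
            rows≥ = m≤m+n w _
            first-true : ∀ {p} → p < w → U p (code (string p)) ≡ true
            first-true {p} lt = by-place (place p (<-≤-trans lt rows≥)) lt
              where
              by-place : ∀ {p} → Place p → p < w → U p (code (string p)) ≡ true
              by-place (inFixed p<q) lt = subst (λ γ → U _ (code γ) ≡ true) (sym (string-fixed p<q)) (unit-true (<-≤-trans lt rows≥) (spec-fixed p<q))
              by-place (inGuess i<W) lt = subst (λ γ → U _ (code γ) ≡ true) (sym (string-guess (<⇒≤ i<W))) (guessed i<W)
              by-place inPad         lt = subst (λ γ → U _ (code γ) ≡ true) (sym string-pad) (unit-true (<-≤-trans lt rows≥) spec-pad)
              by-place (inMid _)     lt = contradiction lt (≤⇒≯ (m≤m+n w _))
              by-place (inLast _)    lt = contradiction lt (≤⇒≯ (m≤m+n w _))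
            -- The transition clause at `p ∸ w` is taken for the three letters that actually stand
            -- there. Its negative literals fail by the induction hypothesis, those cells lying
            -- before `p` as `2 < w`; the remaining literal names the letter computed by `evolve`,
            -- which `window` identifies with the one at `p`.
            derive : ∀ n p → p < suc n → p < rows * w + w → w ≤ p → (∀ p → p < n → p < rows * w + w → U p (code (string p)) ≡ true) → U p (code (string p)) ≡ true
            derive n p p<n lt w≤p before = subst (λ p → U p (code (string p)) ≡ true) p≡ (derived (models π (prop α β γ) π< refl′))
              where
              π = p ∸ w
              p≡ : π + w ≡ p
              p≡ = m∸n+n≡m w≤p
              π< : π < rows * w
              π< = +-cancelʳ-< w _ _ (subst (_< rows * w + w) (sym p≡) lt)
              earlier : ∀ i → i < w → U (π + i) (code (string (π + i))) ≡ true
              earlier i i<w = before (π + i) (<-≤-trans (subst (π + i <_) p≡ (+-monoʳ-< π i<w)) (s≤s⁻¹ p<n)) (<-trans (subst (π + i <_) p≡ (+-monoʳ-< π i<w)) lt)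
              α = code (string (π + 0))
              β = code (string (π + 1))
              γ = code (string (π + 2))
              refl′ : activates (specAt π) (prop α β γ) ≡ true
              refl′ = always (specAt π)
                where
                always : ∀ s → activates s (prop α β γ) ≡ true
                always (fixed _) = refl
                always guess     = refl
                always middle    = refl
                always last      = refl
              evolved : evolve (letter α) (letter β) (letter γ) ≡ string (π + w)
              evolved = trans (cong₂ (λ a b → evolve a b (letter γ)) (trans (letter-code _) (cong string (+-identityʳ π))) (trans (letter-code _) (cong string (+-comm π 1))))
                (trans (cong (evolve (string π) (string (suc π))) (trans (letter-code _) (cong string (+-comm π 2)))) (sym (window π π<)))
              derived : (Σ[ l ∈ Fin 4 ] U (π + offset (proj₁ (literal (prop α β γ) l))) (proj₁ (proj₂ (literal (prop α β γ) l))) ≡ proj₂ (proj₂ (literal (prop α β γ) l))) →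
                U (π + w) (code (string (π + w))) ≡ true
              derived (zero , e)                   = contradiction (trans (sym e) (earlier 0 (s≤s z≤n))) λ ()
              derived (suc zero , e)               = contradiction (trans (sym e) (earlier 1 (<-trans (s≤s (s≤s z≤n)) 2<w))) λ ()
              derived (suc (suc zero) , e)         = contradiction (trans (sym e) (earlier 2 2<w)) λ ()
              derived (suc (suc (suc zero)) , e)   = subst (λ γ → U (π + w) (code γ) ≡ true) evolved e
            all-true : ∀ n p → p < n → p < rows * w + w → U p (code (string p)) ≡ true
            all-true (suc n) p p<n lt = [ first-true , (λ w≤p → derive n p p<n lt w≤p (all-true n)) ]′ (<-≤-connex p w)
            good : ∀ b′ → b ≡ b′ → b′ ≡ true
            good true  _ = refl
            good false e = refute (position-bound rows (≤-trans (m≤m+n rows rows) rows+rows≤off))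
              where
              rows+rows≤off : rows + rows ≤ off
              rows+rows≤off = subst (rows + rows ≤_) (sym off-≡) (≤-by 4 (shape T′))
                where
                shape : ∀ t → (2 + t) + (2 + t) + 4 ≡ t + t + 8
                shape = solve-∀
              refute : (Σ[ y ∈ ℕ ] Snapshot.position (at-time rows) ≡ + y × off ≤ y + rows × y ≤ off + rows) → false ≡ true
              refute (y , at-y , lo , hi) = contradiction (trans (sym (all-true _ (π + w) ≤-refl (+-monoˡ-< w π<))) false-there) λ ()
               where
                -- Row `rows` begins at tape cell `rows`, so this is the place of the head within
                -- the row.
                i = y ∸ rows
                rows≤y : rows ≤ y
                rows≤y = +-cancelʳ-≤ rows _ _ (≤-trans rows+rows≤off lo)
                i<w : i < w
                i<w = ≤-<-trans (m≤n+o⇒m∸n≤o y rows (subst (y ≤_) (+-comm off rows) hi)) (≤-<-trans (≤-trans (m≤m+n off _) (≤-reflexive (sym (length-row prefix)))) q<w)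
                π = w + (T′ * w + i)
                π< : π < rows * w
                π< = +-monoʳ-< w (subst (T′ * w + i <_) (+-comm (T′ * w) w) (+-monoʳ-< (T′ * w) i<w))
                cell-head : string (π + w) ≡ (just false , just (just halt))
                cell-head = trans (last-row i i<w) (trans (cong (cell (at-time rows)) (m∸n+n≡m rows≤y)) (cong₂ _,_ (trans (cong (Snapshot.tape (at-time rows)) (sym at-y)) (trans answered (cong just e)))
                  (trans (headAt-yes (+ y) (Snapshot.position (at-time rows)) (Snapshot.control (at-time rows)) (sym at-y)) (cong just halted))))
                bad-there : activates (specAt π) (final (code (string (π + w)))) ≡ true
                bad-there = trans (cong (λ s → activates s (final (code (string (π + w))))) (spec-last i<w)) (trans (cong bad (letter-code (string (π + w)))) (cong bad cell-head))
                false-there : U (π + w) (code (string (π + w))) ≡ false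
                false-there = proj₂ (models π (final (code (string (π + w)))) π< bad-there)

      -- The word ends at the first cell where the blank is true: from there on `chain` keeps the
      -- blank true, and before it `free` has to provide a bit.
      guessed-word : ∀ U → Models U → Σ[ z ∈ List Bool ] length z ≤ W × (∀ {i} → i < W → U (q + i) (code (nthOr blank (map bitCell z) i)) ≡ true)
      guessed-word U models with go W 0 refl
        where
        q+< : ∀ {i} → i < W → q + i < rows * w
        q+< lt = <-≤-trans (guess<w (<⇒≤ lt)) (m≤m+n w _)
        Blank-from : ℕ → ℕ → Set
        Blank-from r s = ∀ {i} → i < r → U (q + (s + i)) (code blank) ≡ true
        blank-next : ∀ {i} → i < W → U (q + i) (code blank) ≡ true → U (q + suc i) (code blank) ≡ true
        blank-next {i} lt e = next-blank (models (q + i) chain (q+< lt) (cong (λ s → activates s chain) (spec-guess lt)))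
          where
          next-blank : (Σ[ l ∈ Fin 4 ] U (q + i + offset (proj₁ (literal chain l))) (proj₁ (proj₂ (literal chain l))) ≡ proj₂ (proj₂ (literal chain l))) → U (q + suc i) (code blank) ≡ true
          next-blank (zero , e′) = contradiction (trans (sym e′) (trans (cong (λ p → U p (code blank)) (+-identityʳ (q + i))) e)) λ ()
          next-blank (suc _ , e′) = trans (cong (λ p → U p (code blank)) (trans (+-suc q i) (+-comm 1 (q + i)))) e′
        blanks : ∀ r s → s + r ≡ W → U (q + s) (code blank) ≡ true → Blank-from r s
        blanks (suc r) s eq e {zero}  _        = trans (cong (λ i → U (q + i) (code blank)) (+-identityʳ s)) e
        blanks (suc r) s eq e {suc i} (s≤s lt) = trans (cong (λ j → U (q + j) (code blank)) (+-suc s i))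
          (blanks r (suc s) (trans (sym (+-suc s r)) eq) (blank-next (subst (s <_) eq (m<m+n s (s≤s z≤n))) e) lt)
        free-at : ∀ {i} → i < W → U (q + i) (code blank) ≡ false → Σ[ b ∈ Bool ] U (q + i) (code (bitCell b)) ≡ true
        free-at {i} lt ne = a-bit (models (q + i) free (q+< lt) (cong (λ s → activates s free) (spec-guess lt)))
          where
          a-bit : (Σ[ l ∈ Fin 4 ] U (q + i + offset (proj₁ (literal free l))) (proj₁ (proj₂ (literal free l))) ≡ proj₂ (proj₂ (literal free l))) → Σ[ b ∈ Bool ] U (q + i) (code (bitCell b)) ≡ true
          a-bit (zero , e)        = false , trans (cong (λ p → U p (code (bitCell false))) (sym (+-identityʳ (q + i)))) e
          a-bit (suc zero , e)    = true , trans (cong (λ p → U p (code (bitCell true))) (sym (+-identityʳ (q + i)))) e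
          a-bit (suc (suc _) , e) = contradiction (trans (sym ne) (trans (cong (λ p → U p (code blank)) (sym (+-identityʳ (q + i)))) e)) λ ()
        go : ∀ r s → s + r ≡ W → Σ[ z ∈ List Bool ] length z ≤ r × (∀ {i} → i < r → U (q + (s + i)) (code (nthOr blank (map bitCell z) i)) ≡ true)
        go zero    s eq = [] , z≤n , λ ()
        go (suc r) s eq with U (q + s) (code blank) in e
        ... | true  = [] , z≤n , blanks (suc r) s eq e
        ... | false with go r (suc s) (trans (sym (+-suc s r)) eq) | free-at {s} (subst (s <_) eq (m<m+n s (s≤s z≤n))) e
        ...   | z , z≤ , us | b , u = b ∷ z , s≤s z≤ , λ { {zero} _ → trans (cong (λ i → U (q + i) (code (bitCell b))) (+-identityʳ s)) u
                                                         ; {suc i} (s≤s lt) → trans (cong (λ j → U (q + j) (code (nthOr blank (map bitCell z) i))) (+-suc s i)) (us lt) }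
      ... | z , z≤ , us = z , z≤ , us

-- Clause indices and the capacities of the columns in closed form

leq : ℕ → ℕ → Bool
leq zero    _       = true
leq (suc m) zero    = false
leq (suc m) (suc n) = leq m n

leq-≤ : ∀ m n → leq m n ≡ true → m ≤ n
leq-≤ zero    n       _ = z≤n
leq-≤ (suc m) (suc n) e = s≤s (leq-≤ m n e)

≤-leq : ∀ {m n} → m ≤ n → leq m n ≡ true
≤-leq z≤n      = refl
≤-leq (s≤s le) = ≤-leq le

∑-swap : ∀ {A B : Set} xs ys (f : A → B → ℕ) → ∑ xs (λ x → ∑ ys (f x)) ≡ ∑ ys (λ y → ∑ xs (λ x → f x y))
∑-swap []       ys f = sym (∑-zero ys)
∑-swap (x ∷ xs) ys f = trans (cong (λ s → ∑ ys (f x) + s) (∑-swap xs ys f)) (sym (∑-+ ys (f x) _))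

allFin-suc : ∀ n → allFin (suc n) ≡ zero ∷ map suc (allFin n)
allFin-suc n = cong (zero ∷_) (sym (Listₚ.map-tabulate id suc))

tabulate-+ : ∀ {A : Set} m n (f : Fin (m + n) → A) → tabulate f ≡ tabulate (f ∘ (Fin._↑ˡ n)) ++ tabulate (f ∘ (m Fin.↑ʳ_))
tabulate-+ zero    n f = refl
tabulate-+ (suc m) n f = cong (f zero ∷_) (tabulate-+ m n (f ∘ suc))

allFin-* : ∀ m n → allFin (m * n) ≡ map (λ p → combine (proj₁ p) (proj₂ p)) (cartesianProduct (allFin m) (allFin n))
allFin-* zero    n = refl
allFin-* (suc m) n = trans (tabulate-+ n (m * n) id) (trans (cong₂ _++_ first rest)
    (trans (sym (Listₚ.map-++ (λ p → combine (proj₁ p) (proj₂ p)) (map (λ j → zero , j) (allFin n)) _))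
      (cong (map (λ p → combine (proj₁ p) (proj₂ p))) (cong (λ xs → cartesianProduct xs (allFin n)) (sym (allFin-suc m))))))
  where
  first : tabulate (Fin._↑ˡ (m * n)) ≡ map (λ p → combine {suc m} (proj₁ p) (proj₂ p)) (map (λ j → zero , j) (allFin n))
  first = trans (sym (Listₚ.map-tabulate id (Fin._↑ˡ (m * n)))) (Listₚ.map-∘ (allFin n))
  product-suc : ∀ (xs : List (Fin m)) (ys : List (Fin n)) → map (λ p → n Fin.↑ʳ combine (proj₁ p) (proj₂ p)) (cartesianProduct xs ys) ≡
    map (λ p → combine {suc m} (proj₁ p) (proj₂ p)) (cartesianProduct (map suc xs) ys)
  product-suc []       ys = refl
  product-suc (x ∷ xs) ys = trans (Listₚ.map-++ _ (map (λ y → x , y) ys) _) (trans (cong₂ _++_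
    (trans (sym (Listₚ.map-∘ ys)) (Listₚ.map-∘ ys)) (product-suc xs ys)) (sym (Listₚ.map-++ _ (map (λ y → suc x , y) ys) _)))
  rest : tabulate (n Fin.↑ʳ_) ≡ map (λ p → combine {suc m} (proj₁ p) (proj₂ p)) (cartesianProduct (map suc (allFin m)) (allFin n))
  rest = trans (sym (Listₚ.map-tabulate id (n Fin.↑ʳ_))) (trans (cong (map (n Fin.↑ʳ_)) (allFin-* m n)) (trans (sym (Listₚ.map-∘ (cartesianProduct (allFin m) (allFin n))))
    (product-suc (allFin m) (allFin n))))

∑-combine : ∀ m n (f : Fin (m * n) → ℕ) → ∑ (allFin (m * n)) f ≡ ∑ (allFin m) (λ i → ∑ (allFin n) (λ j → f (combine i j)))
∑-combine m n f = trans (cong (λ xs → ∑ xs f) (allFin-* m n)) (trans (∑-map (λ p → combine (proj₁ p) (proj₂ p)) (cartesianProduct (allFin m) (allFin n)) f) (∑-product (allFin m) (allFin n) _))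

∑-shift : ∀ o n (f : ℕ → ℕ) → ∑ (allFin (o + n)) (λ c → if leq o (toℕ c) then f (toℕ c ∸ o) else 0) ≡ ∑ (allFin n) (f ∘ toℕ)
∑-shift zero    n f = refl
∑-shift (suc o) n f = trans (∑-allFin {o + n} (λ c → if leq (suc o) (toℕ c) then f (toℕ c ∸ suc o) else 0)) (∑-shift o n f)

weight-> : ∀ {i m} → m < i → weight i m ≡ 0
weight-> {suc i} {zero}  _        = refl
weight-> {suc i} {suc m} (s≤s lt) = weight-> lt

weight-< : ∀ {i m} → i < m → weight i m ≡ 2
weight-< {zero}  {suc m} _        = refl
weight-< {suc i} {suc m} (s≤s lt) = weight-< lt

weight-cancel : ∀ a i m → weight (a + i) (a + m) ≡ weight i m
weight-cancel zero    i m = refl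
weight-cancel (suc a) i m = weight-cancel a i m

-- The indices form blocks of length `n`, one element being taken from each block. Those of earlier
-- blocks weigh 2, those of later blocks 0, and within block `π` only the places inside the block
-- are compared.
∑-weight : ∀ n N π {i m} → π < N → i < n → m < n → ∑ (allFin N) (λ c → weight (n * toℕ c + i) (n * π + m)) ≡ 2 * π + weight i m
∑-weight n (suc N) zero {i} {m} _ i< m< = trans (∑-allFin {N} (λ c → weight (n * toℕ c + i) (n * 0 + m))) (trans (cong₂ _+_ (cong₂ (λ a b → weight (a + i) (b + m)) (*-zeroʳ n) (*-zeroʳ n))
  (trans (∑-cong (allFin N) (λ c → weight-> (subst (_< n * suc (toℕ c) + i) (cong (_+ m) (sym (*-zeroʳ n)))
    (<-≤-trans m< (≤-trans (≤-trans (m≤m+n n (n * toℕ c)) (≤-reflexive (sym (*-suc n (toℕ c))))) (m≤m+n _ i)))))) (∑-zero (allFin N)))) (+-identityʳ _))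
∑-weight n (suc N) (suc π) {i} {m} (s≤s lt) i< m< = trans (∑-allFin {N} (λ c → weight (n * toℕ c + i) (n * suc π + m))) (trans (cong₂ _+_
    (weight-< (subst (λ x → x + i < n * suc π + m) (sym (*-zeroʳ n)) (<-≤-trans i< (≤-trans (≤-trans (m≤m+n n (n * π)) (≤-reflexive (sym (*-suc n π)))) (m≤m+n _ m)))))
    (trans (∑-cong (allFin N) (λ c → trans (cong₂ weight (unfold (toℕ c) i) (unfold π m)) (weight-cancel n _ _))) (∑-weight n N π lt i< m<)))
  (trans (sym (+-assoc 2 (2 * π) _)) (cong (_+ weight i m) (sym (*-suc 2 π)))))
  where
  unfold : ∀ a b → n * suc a + b ≡ n + (n * a + b)
  unfold a b = trans (cong (_+ b) (*-suc n a)) (+-assoc n (n * a) b)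

∑-weight-1 : ∀ n m → m < n → ∑ (allFin n) (λ c → weight (toℕ c) m) ≡ 2 * m + 1
∑-weight-1 (suc n) zero    _        = trans (∑-allFin {n} (λ c → weight (toℕ c) 0)) (cong (λ x → 1 + x) (∑-zero (allFin n)))
∑-weight-1 (suc n) (suc m) (s≤s lt) = trans (∑-allFin {n} (λ c → weight (toℕ c) (suc m))) (trans (cong (λ x → 2 + x) (∑-weight-1 n m lt)) (cong (_+ 1) (sym (*-suc 2 m))))

mixed-injective : ∀ n a b {i j} → i < n → j < n → n * a + i ≡ n * b + j → a ≡ b × i ≡ j
mixed-injective n a b {i} {j} i< j< e with <-cmp a b
... | tri≈ _ refl _ = refl , +-cancelˡ-≡ (n * a) _ _ e
... | tri< a<b _ _ = contradiction e (<⇒≢ (<-≤-trans (+-monoʳ-< (n * a) i<) (≤-trans (≤-reflexive (trans (+-comm (n * a) n) (sym (*-suc n a)))) (≤-trans (*-monoʳ-≤ n a<b) (m≤m+n _ j)))))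
... | tri> _ _ b<a = contradiction (sym e) (<⇒≢ (<-≤-trans (+-monoʳ-< (n * b) j<) (≤-trans (≤-reflexive (trans (+-comm (n * b) n) (sym (*-suc n b)))) (≤-trans (*-monoʳ-≤ n b<a) (m≤m+n _ i)))))

module Link (M : TM) (w′ T′ off W : ℕ) (prefix : List Bool) where
  open Formula M
  open Sized w′ T′ off W prefix

  cells clauses J columns : ℕ
  clauses = rows * w
  cells   = clauses + w
  J       = cells * g
  columns = clauses * C

  -- All gadgets have the same slots, one for every literal of every kind; whether a slot is put to
  -- use is a matter of its index only. This uniformity keeps the adjacency matrix regular.
  Slot : Set
  Slot = Fin C × Fin 4

  slots : List Slot
  slots = cartesianProduct (allFin C) (allFin 4)

  slots-unique : Unique slots
  slots-unique = Uniqueₚ.cartesianProduct⁺ (Uniqueₚ.allFin⁺ C) (Uniqueₚ.allFin⁺ 4)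

  slots-complete : ∀ r → r ∈ slots
  slots-complete (κ , l) = ∈ₚ.∈-cartesianProduct⁺ (∈ₚ.∈-allFin κ) (∈ₚ.∈-allFin l)

  shiftOf : Slot → ℕ
  shiftOf (κ , l) = offset (proj₁ (literal (kind κ) l))

  letterOf : Slot → Fin g
  letterOf (κ , l) = proj₁ (proj₂ (literal (kind κ) l))

  sgn : Slot → Bool
  sgn (κ , l) = proj₂ (proj₂ (literal (kind κ) l))

  -- The clause in which a slot of the variable (c , a) represents a literal; slots without a literal get the index
  -- columns, which is beyond all clauses.
  clauseIndex : ℕ → Fin g → Slot → ℕ
  clauseIndex c a r = if eqF a (letterOf r) ∧ leq (shiftOf r) c then C * (c ∸ shiftOf r) + toℕ (proj₁ r) else columns

  idx : Fin J → Slot → ℕ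
  idx j r = clauseIndex (toℕ (proj₁ (remQuot {cells} g j))) (proj₂ (remQuot {cells} g j)) r

  clauseOf : Fin columns → Fin clauses × Fin C
  clauseOf = remQuot {clauses} C

  active : Fin columns → Bool
  active m = activates (specAt (toℕ (proj₁ (clauseOf m)))) (kind (proj₂ (clauseOf m)))

  -- Each of the four literals of each of the `C` kinds leaves two edges for every earlier position.
  -- At the position itself a kind before `κ` leaves 2, `κ` leaves 1 and a later one 0, which makes
  -- `2 * κ + 1`.
  baseOf : ℕ → ℕ → ℕ
  baseOf π κ = 4 * (C * (2 * π) + (2 * κ + 1))

  base : Fin columns → ℕ
  base m = baseOf (toℕ (proj₁ (clauseOf m))) (toℕ (proj₂ (clauseOf m)))

  toℕ-clause : ∀ m → toℕ m ≡ C * toℕ (proj₁ (clauseOf m)) + toℕ (proj₂ (clauseOf m))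
  toℕ-clause m = trans (cong toℕ (sym (Finₚ.combine-remQuot {clauses} C m))) (Finₚ.toℕ-combine (proj₁ (clauseOf m)) (proj₂ (clauseOf m)))

  open Construction J columns slots using (pairs)

  module _ (2<w : 2 < w) where

    shift≤w : ∀ o → offset o ≤ w
    shift≤w o0 = z≤n
    shift≤w o1 = s≤s z≤n
    shift≤w o2 = <⇒≤ 2<w
    shift≤w ow = ≤-refl

    -- Variables with another letter have index `columns` and weigh nothing. For the right letter,
    -- subtracting the offset turns cells into clause positions, and the additional row of cells
    -- makes sure that none of the positions is missed. So the sum is the same for every literal of
    -- a kind, whatever its letter and offset.
    slot-weight : ∀ m r → ∑ (allFin J) (λ j → weight (idx j r) (toℕ m)) ≡ 2 * toℕ (proj₁ (clauseOf m)) + weight (toℕ (proj₁ r)) (toℕ (proj₂ (clauseOf m)))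
    slot-weight m r@(κ , l) = trans (∑-combine cells g _) (trans (∑-cong (allFin cells) (λ c → trans (∑-cong (allFin g) (λ a → cong (λ p → weight (clauseIndex (toℕ (proj₁ p)) (proj₂ p) r) (toℕ m)) (Finₚ.remQuot-combine c a)))
        (one-letter (toℕ c)))) (trans (cong (λ n → ∑ (allFin n) (λ c → if leq (shiftOf r) (toℕ c) then weight (C * (toℕ c ∸ shiftOf r) + toℕ κ) (toℕ m) else 0)) cells≡)
        (trans (∑-shift (shiftOf r) n (λ c → weight (C * c + toℕ κ) (toℕ m))) (trans (∑-cong (allFin n) (λ c → cong (weight (C * toℕ c + toℕ κ)) (toℕ-clause m)))
          (∑-weight C n (toℕ (proj₁ (clauseOf m))) (<-≤-trans (Finₚ.toℕ<n _) (m≤m+n clauses _)) (Finₚ.toℕ<n κ) (Finₚ.toℕ<n _))))))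
      where
      n = clauses + (w ∸ shiftOf r)
      cells≡ : cells ≡ shiftOf r + n
      cells≡ = trans (cong (λ x → clauses + x) (sym (m+[n∸m]≡n (shift≤w (proj₁ (literal (kind κ) l)))))) (swap clauses (shiftOf r) _)
        where
        swap : ∀ a b c → a + (b + c) ≡ b + (a + c)
        swap = solve-∀
      one-letter : ∀ c → ∑ (allFin g) (λ a → weight (clauseIndex c a r) (toℕ m)) ≡ (if leq (shiftOf r) c then weight (C * (c ∸ shiftOf r) + toℕ κ) (toℕ m) else 0)
      one-letter c = trans (∑-single {x = letterOf r} _ (Uniqueₚ.allFin⁺ g) (∈ₚ.∈-allFin _) (λ a ne → trans (cong (λ b → weight (if b ∧ leq (shiftOf r) c then C * (c ∸ shiftOf r) + toℕ κ else columns) (toℕ m)) (eqF-≢ ne)) outside))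
          (trans (cong (λ b → weight (if b ∧ leq (shiftOf r) c then C * (c ∸ shiftOf r) + toℕ κ else columns) (toℕ m)) (eqF-refl (letterOf r))) (push-in (leq (shiftOf r) c)))
        where
        outside : weight columns (toℕ m) ≡ 0
        outside = weight-> (Finₚ.toℕ<n m)
        push-in : ∀ b → weight (if b then C * (c ∸ shiftOf r) + toℕ κ else columns) (toℕ m) ≡ (if b then weight (C * (c ∸ shiftOf r) + toℕ κ) (toℕ m) else 0)
        push-in true  = refl
        push-in false = outside

    base-≡ : ∀ m → base m ≡ ∑ pairs (λ p → weight (idx (proj₁ p) (proj₂ p)) (toℕ m))
    base-≡ m = sym (trans (∑-product (allFin J) slots _) (trans (∑-swap (allFin J) slots (λ j r → weight (idx j r) (toℕ m))) (trans (∑-cong slots (slot-weight m))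
        (trans (∑-product (allFin C) (allFin 4) _) (trans (∑-cong (allFin C) (λ κ → ∑-const (allFin 4) (2 * π + own-weight κ))) (trans (∑-times (allFin C) (λ κ → 2 * π + own-weight κ))
          (cong (4 *_) (trans (∑-+ (allFin C) (λ _ → 2 * π) own-weight) (cong₂ _+_ (trans (∑-const (allFin C) (2 * π)) (cong (λ n → n * (2 * π)) (length-allFin C)))
            (∑-weight-1 C (toℕ (proj₂ (clauseOf m))) (Finₚ.toℕ<n (proj₂ (clauseOf m)))))))))))))
      where
      π = toℕ (proj₁ (clauseOf m))
      own-weight : Fin C → ℕ
      own-weight κ = weight (toℕ κ) (toℕ (proj₂ (clauseOf m)))
      ∑-times : ∀ {A : Set} (xs : List A) f → ∑ xs (λ x → 4 * f x) ≡ 4 * ∑ xs f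
      ∑-times []       f = refl
      ∑-times (x ∷ xs) f = trans (cong (λ s → 4 * f x + s) (∑-times xs f)) (sym (*-distribˡ-+ 4 (f x) _))

    open Capacities J columns slots slots-unique slots-complete idx sgn active base using (Satisfies)

    valueAt : (Fin J → Bool) → ℕ → Fin g → Bool
    valueAt u p a = go (p <? cells)
      where
      go : Dec (p < cells) → Bool
      go (yes lt) = u (combine (Fin.fromℕ< lt) a)
      go (no _)   = false

    valueAt-toℕ : ∀ u (c : Fin cells) a → valueAt u (toℕ c) a ≡ u (combine c a)
    valueAt-toℕ u c a with toℕ c <? cells
    ... | yes lt = cong (λ c → u (combine c a)) (Finₚ.fromℕ<-toℕ c lt)
    ... | no ≮   = contradiction (Finₚ.toℕ<n c) ≮

    -- The slot that satisfies clause `m` has index `m` and not `columns`, so its letter and offset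
    -- fit. Position and kind can be recovered from the index since the kind is below `C`.
    satisfies⇒models : ∀ u → Satisfies u → Models (valueAt u)
    satisfies⇒models u sat p K lt act = result (sat m act′)
      where
      κ = index (kinds-complete K)
      kind-κ : kind κ ≡ K
      kind-κ = sym (Anyₚ.lookup-index (kinds-complete K))
      m = combine (Fin.fromℕ< lt) κ
      split : clauseOf m ≡ (Fin.fromℕ< lt , κ)
      split = Finₚ.remQuot-combine (Fin.fromℕ< lt) κ
      act′ : active m ≡ true
      act′ = trans (cong₂ (λ π κ → activates (specAt (toℕ π)) (kind κ)) (cong proj₁ split) (cong proj₂ split)) (trans (cong₂ activates (cong specAt (Finₚ.toℕ-fromℕ< lt)) kind-κ) act)
      toℕ-m : toℕ m ≡ C * p + toℕ κ
      toℕ-m = trans (Finₚ.toℕ-combine (Fin.fromℕ< lt) κ) (cong (λ x → C * x + toℕ κ) (Finₚ.toℕ-fromℕ< lt))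
      Goal : Set
      Goal = Σ[ l ∈ Fin 4 ] valueAt u (p + offset (proj₁ (literal K l))) (proj₁ (proj₂ (literal K l))) ≡ proj₂ (proj₂ (literal K l))
      result : (Σ[ j ∈ Fin J ] Σ[ r ∈ Slot ] idx j r ≡ toℕ m × u j ≡ sgn r) → Goal
      result (j , (κ′ , l) , e , v) = decide (eqF a (letterOf (κ′ , l))) (leq (shiftOf (κ′ , l)) (toℕ c)) refl refl
        where
        c = proj₁ (remQuot {cells} g j)
        a = proj₂ (remQuot {cells} g j)
        none : ∀ {X : Set} → columns ≡ toℕ m → X
        none e = contradiction (sym e) (<⇒≢ (Finₚ.toℕ<n m))
        decide : ∀ x y → eqF a (letterOf (κ′ , l)) ≡ x → leq (shiftOf (κ′ , l)) (toℕ c) ≡ y → Goal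
        decide false y     ex ey = none (trans (sym (cong₂ (λ x y → if x ∧ y then C * (toℕ c ∸ shiftOf (κ′ , l)) + toℕ κ′ else columns) ex ey)) e)
        decide true  false ex ey = none (trans (sym (cong₂ (λ x y → if x ∧ y then C * (toℕ c ∸ shiftOf (κ′ , l)) + toℕ κ′ else columns) ex ey)) e)
        decide true  true  ex ey = found (mixed-injective C _ p (Finₚ.toℕ<n κ′) (Finₚ.toℕ<n κ)
            (trans (trans (sym (cong₂ (λ x y → if x ∧ y then C * (toℕ c ∸ shiftOf (κ′ , l)) + toℕ κ′ else columns) ex ey)) e) toℕ-m)) (letters (a Fin.≟ letterOf (κ′ , l)) ex)
          where
          letters : ∀ (d : Dec (a ≡ letterOf (κ′ , l))) → does d ≡ true → a ≡ letterOf (κ′ , l)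
          letters (yes e) _ = e
          found : toℕ c ∸ shiftOf (κ′ , l) ≡ p × toℕ κ′ ≡ toℕ κ → a ≡ letterOf (κ′ , l) → Goal
          found (c≡ , κ≡) a≡ = l , subst (λ K → valueAt u (p + offset (proj₁ (literal K l))) (proj₁ (proj₂ (literal K l))) ≡ proj₂ (proj₂ (literal K l))) (trans (cong kind (Finₚ.toℕ-injective κ≡)) kind-κ)
            (trans (cong₂ (valueAt u) p+ (sym a≡)) (trans (valueAt-toℕ u c a) (trans (cong u (Finₚ.combine-remQuot {cells} g j)) v)))
            where
            p+ : p + shiftOf (κ′ , l) ≡ toℕ c
            p+ = trans (cong (_+ shiftOf (κ′ , l)) (sym c≡)) (m∸n+n≡m (leq-≤ (shiftOf (κ′ , l)) (toℕ c) ey))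

    models⇒satisfies : ∀ U → Models U → Satisfies (λ j → U (toℕ (proj₁ (remQuot {cells} g j))) (proj₂ (remQuot {cells} g j)))
    models⇒satisfies U models m act = result (models (toℕ π) (kind κ) (Finₚ.toℕ<n π) act)
      where
      π = proj₁ (clauseOf m)
      κ = proj₂ (clauseOf m)
      result : (Σ[ l ∈ Fin 4 ] U (toℕ π + shiftOf (κ , l)) (letterOf (κ , l)) ≡ sgn (κ , l)) →
        Σ[ j ∈ Fin J ] Σ[ r ∈ Slot ] idx j r ≡ toℕ m × U (toℕ (proj₁ (remQuot {cells} g j))) (proj₂ (remQuot {cells} g j)) ≡ sgn r
      result (l , e) = combine c (letterOf r) , r ,
          trans (cong (λ p → clauseIndex (toℕ (proj₁ p)) (proj₂ p) r) split) (trans (cong (λ x → clauseIndex x (letterOf r) r) (Finₚ.toℕ-fromℕ< lt))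
            (trans (cong₂ (λ x y → if x ∧ y then C * (toℕ π + shiftOf r ∸ shiftOf r) + toℕ κ else columns) (eqF-refl (letterOf r)) (≤-leq (m≤n+m (shiftOf r) (toℕ π))))
              (trans (cong (λ x → C * x + toℕ κ) (m+n∸n≡m (toℕ π) (shiftOf r))) (sym (toℕ-clause m))))) ,
          trans (cong (λ p → U (toℕ (proj₁ p)) (proj₂ p)) split) (trans (cong (λ x → U x (letterOf r)) (Finₚ.toℕ-fromℕ< lt)) e)
        where
        r : Slot
        r = κ , l
        lt : toℕ π + shiftOf r < cells
        lt = +-mono-<-≤ (Finₚ.toℕ<n π) (shift≤w (proj₁ (literal (kind κ) l)))
        c = Fin.fromℕ< lt
        split : remQuot {cells} g (combine c (letterOf r)) ≡ (c , letterOf r)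
        split = Finₚ.remQuot-combine c (letterOf r)

-- The reduction

pairEnc-++ : ∀ x z → pairEnc x z ≡ pairEnc x [] ++ z
pairEnc-++ []      z = refl
pairEnc-++ (b ∷ x) z = cong (λ ys → b ∷ b ∷ ys) (pairEnc-++ x z)

length-pairEnc : ∀ x → length (pairEnc x []) ≡ 2 * length x + 2
length-pairEnc []      = refl
length-pairEnc (b ∷ x) = trans (cong (λ l → 2 + l) (length-pairEnc x)) (cong (_+ 2) (sym (*-suc 2 (length x))))

poly-mono : ∀ a d {m n} → m ≤ n → poly a d m ≤ poly a d n
poly-mono a d le = +-monoˡ-≤ a (*-monoʳ-≤ a (^-monoˡ-≤ d le))

-- The sizes of the tableau: W cells are left to be guessed, and T′ bounds the running time of the verifier.
module Sizes (a d a′ d′ : ℕ) (n : ℕ) where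
  W lengthBound T′ off w′ : ℕ
  W = poly a d n
  lengthBound = 2 * n + 2 + W
  T′ = poly a′ d′ lengthBound
  -- The head starts at cell `off`, and row `t` begins at cell `t`. Its first two cells must still
  -- be blank in the next row too, which asks for `2 * t + 3 < off` for all `t` up to `suc T′`;
  -- adding 8 is enough.
  off = T′ + T′ + 8
  -- The left margin, the cell of the head, the encoded input with its two closing bits, and the
  -- guessed cells; the width `suc w′` has one more cell, for the closing blank.
  w′ = off + suc (2 * n + 2) + W

module Widths (M : TM) (a d a′ d′ : ℕ) (x : List Bool) where
  open Sizes a d a′ d′ (length x)
  open Formula.Sized M w′ T′ off W (pairEnc x [])

  q-≡ : q ≡ off + suc (2 * length x + 2)
  q-≡ = trans (length-row (pairEnc x [])) (cong (λ l → off + suc l) (length-pairEnc x))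

  width-≡ : w ≡ q + suc W
  width-≡ = trans (cong (λ y → suc (y + W)) (sym q-≡)) (sym (+-suc q W))

module Reduction {L V : List Bool → Set} (χ : List Bool → Bool) (M : TM) (a′ d′ : ℕ)
  (runs : ∀ y → Σ[ t ∈ ℕ ] t ≤ poly a′ d′ (length y) × RunsTo M y t (χ y ∷ [])) (V⇔χ : ∀ y → V y ⇔ (χ y ≡ true))
  (a d : ℕ) (L⇔V : ∀ x → L x ⇔ (Σ (List Bool) λ z → length z ≤ poly a d (length x) × V (pairEnc x z))) (x : List Bool) where

  open Sizes a d a′ d′ (length x) public
  open Formula M
  open Sized w′ T′ off W (pairEnc x [])
  open Link M w′ T′ off W (pairEnc x []) public
  open Widths M a d a′ d′ x using (width-≡)

  private
    2<w′ : 2 < w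
    2<w′ = 2<w width-≡ refl

  module _ (z : List Bool) (z≤ : length z ≤ W) where
    private
      y = pairEnc x [] ++ z
      t = proj₁ (runs y)

      y≤ : length y ≤ lengthBound
      y≤ = ≤-trans (≤-reflexive (trans (Listₚ.length-++ (pairEnc x [])) (cong (_+ length z) (length-pairEnc x)))) (+-monoʳ-≤ (2 * length x + 2) z≤)

      t≤ : t ≤ suc T′
      t≤ = m≤n⇒m≤1+n (≤-trans (proj₁ (proj₂ (runs y))) (poly-mono a′ d′ y≤))

      open Tableau M using (module Computation; module Snapshot)
      open Computation off y

      -- Row `2 + T′` shows the machine after `suc T′` steps, the first step of the tableau being
      -- the one into the start state. By then the verifier has halted.
      answered : Snapshot.control (at-time (2 + T′)) ≡ just (TM.halt M) × Snapshot.tape (at-time (2 + T′)) (Snapshot.position (at-time (2 + T′))) ≡ just (χ y)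
      answered = subst (λ s → Snapshot.control (at-time (suc s)) ≡ just (TM.halt M) × Snapshot.tape (at-time (suc s)) (Snapshot.position (at-time (suc s))) ≡ just (χ y))
        (m+[n∸m]≡n t≤) (answer {t} {χ y} (suc T′ ∸ t) (proj₂ (proj₂ (runs y))))

    open WithWitness width-≡ refl z z≤ public using (model)
    open WithWitness width-≡ refl z z≤ using (module Answered)
    open Answered (χ y) (proj₁ answered) (proj₂ answered) public

  L⇒models : L x → Σ[ U ∈ (ℕ → Fin g → Bool) ] Models U
  L⇒models l = from-word (Equivalence.to (L⇔V x) l)
    where
    from-word : (Σ (List Bool) λ z → length z ≤ W × V (pairEnc x z)) → Σ[ U ∈ (ℕ → Fin g → Bool) ] Models U
    from-word (z , z≤ , v) = model z z≤ , complete z z≤ (trans (cong χ (sym (pairEnc-++ x z))) (Equivalence.to (V⇔χ (pairEnc x z)) v))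

  models⇒L : (Σ[ U ∈ (ℕ → Fin g → Bool) ] Models U) → L x
  models⇒L (U , models) = from-word (guessed-word width-≡ refl U models)
    where
    from-word : (Σ[ z ∈ List Bool ] length z ≤ W × (∀ {i} → i < W → U (q + i) (code (nthOr (Tableau.blank M) (map bitCell z) i)) ≡ true)) → L x
    from-word (z , z≤ , guessed) = Equivalence.from (L⇔V x) (z , z≤ ,
      Equivalence.from (V⇔χ (pairEnc x z)) (trans (cong χ (pairEnc-++ x z)) (sound z z≤ U models guessed)))

  open Construction J columns slots public
  open Named slots-unique slots-complete public
  open Capacities J columns slots slots-unique slots-complete idx sgn active base public using (cap; budget; Satisfies; module Soundness)

  instanceOf : CVCInstance
  instanceOf = instance′ cap budget

  _≟ₛ_ : (r r′ : Slot) → Dec (r ≡ r′)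
  _≟ₛ_ = Productₚ.≡-dec Fin._≟_ Fin._≟_

  yes⇔L : L x ⇔ CVCYes instanceOf
  yes⇔L = mk⇔ (λ l → from-models (L⇒models l)) (λ y → models⇒L (to-models (yes⇒cover cap budget y)))
    where
    from-models : (Σ[ U ∈ (ℕ → Fin g → Bool) ] Models U) → CVCYes instanceOf
    from-models (U , models) = cover⇒yes cap budget (Completeness.cover J columns slots slots-unique slots-complete idx sgn active base _≟ₛ_ (base-≡ 2<w′) _ (models⇒satisfies 2<w′ U models))
    to-models : Cover cap budget → Σ[ U ∈ (ℕ → Fin g → Bool) ] Models U
    to-models c = valueAt 2<w′ (Soundness.u (base-≡ 2<w′) c) , satisfies⇒models 2<w′ (Soundness.u (base-≡ 2<w′) c) (Soundness.satisfied (base-≡ 2<w′) c)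

  narrow : LinCWAtMost 6 (CVCInstance.G instanceOf)
  narrow = LinearCliqueWidth.linearCliqueWidth J columns slots

-- The encoded instance and its emission

cat : ∀ {A : Set} → List A → (A → List Bool) → List Bool
cat xs f = concat (map f xs)

cat-cong : ∀ {A : Set} (xs : List A) {f g : A → List Bool} → (∀ x → f x ≡ g x) → cat xs f ≡ cat xs g
cat-cong xs eq = cong concat (Listₚ.map-cong eq xs)

cat-++ : ∀ {A : Set} xs ys (f : A → List Bool) → cat (xs ++ ys) f ≡ cat xs f ++ cat ys f
cat-++ []       ys f = refl
cat-++ (x ∷ xs) ys f = trans (cong (f x ++_) (cat-++ xs ys f)) (sym (Listₚ.++-assoc (f x) _ _))

cat-map : ∀ {A B : Set} (g : B → A) xs (f : A → List Bool) → cat (map g xs) f ≡ cat xs (f ∘ g)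
cat-map g xs f = cong concat (sym (Listₚ.map-∘ xs))

cat-product : ∀ {A B : Set} xs ys (f : A × B → List Bool) → cat (cartesianProduct xs ys) f ≡ cat xs (λ x → cat ys (λ y → f (x , y)))
cat-product []       ys f = refl
cat-product (x ∷ xs) ys f = trans (cat-++ (map (λ y → x , y) ys) _ f) (cong₂ _++_ (cat-map (λ y → x , y) ys f) (cat-product xs ys f))

map-cat : ∀ {A : Set} (f : A → Bool) xs → map f xs ≡ cat xs (λ x → f x ∷ [])
map-cat f []       = refl
map-cat f (x ∷ xs) = cong (f x ∷_) (map-cat f xs)

cat-const : ∀ {A : Set} (xs : List A) bs → cat xs (λ _ → bs) ≡ concat (replicate (length xs) bs)
cat-const []       bs = refl
cat-const (x ∷ xs) bs = cong (bs ++_) (cat-const xs bs)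

cat-allFin-suc : ∀ n (f : Fin (suc n) → List Bool) → cat (allFin (suc n)) f ≡ f zero ++ cat (allFin n) (f ∘ suc)
cat-allFin-suc n f = trans (cong (λ xs → cat xs f) (allFin-suc n)) (cong (f zero ++_) (cat-map suc (allFin n) f))

cat-combine : ∀ m n (f : Fin (m * n) → List Bool) → cat (allFin (m * n)) f ≡ cat (allFin m) (λ i → cat (allFin n) (λ j → f (combine i j)))
cat-combine m n f = trans (cong (λ xs → cat xs f) (allFin-* m n)) (trans (cat-map (λ p → combine (proj₁ p) (proj₂ p)) (cartesianProduct (allFin m) (allFin n)) f) (cat-product (allFin m) (allFin n) _))

cat-select : ∀ {n} (j : Fin n) (own other : List Bool) → cat (allFin n) (λ j′ → if eqF j j′ then own else other) ≡
  concat (replicate (toℕ j) other) ++ (own ++ concat (replicate (n ∸ suc (toℕ j)) other))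
cat-select {suc n} zero    own other = trans (cat-allFin-suc n _) (cong (own ++_) (trans (cat-const (allFin n) other) (cong (λ k → concat (replicate k other)) (length-allFin n))))
cat-select {suc n} (suc j) own other = trans (cat-allFin-suc n _) (trans (cong (other ++_) (cat-select j own other)) (sym (Listₚ.++-assoc other _ _)))

-- Each entry receives the number of entries before it and after it, as the body of a loop does
-- through counter 0 and the counter it runs over.
range : ℕ → ℕ → (ℕ → ℕ → List Bool) → List Bool
range i zero    F = []
range i (suc r) F = F i r ++ range (suc i) r F

range-+ : ∀ i m n (f : ℕ → List Bool) → range i (m + n) (λ i _ → f i) ≡ range i m (λ i _ → f i) ++ range (i + m) n (λ i _ → f i)
range-+ i zero    n f = cong (λ i → range i n (λ i _ → f i)) (sym (+-identityʳ i))
range-+ i (suc m) n f = trans (cong (f i ++_) (trans (range-+ (suc i) m n f) (cong (λ k → range (suc i) m (λ i _ → f i) ++ range k n (λ i _ → f i)) (sym (+-suc i m)))))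
  (sym (Listₚ.++-assoc (f i) (range (suc i) m (λ i _ → f i)) (range (i + suc m) n (λ i _ → f i))))

range-shift : ∀ i k r (f : ℕ → List Bool) → range i r (λ i _ → f (k + i)) ≡ range (k + i) r (λ i _ → f i)
range-shift i k zero    f = refl
range-shift i k (suc r) f = cong (f (k + i) ++_) (trans (range-shift (suc i) k r f) (cong (λ j → range j r (λ i _ → f i)) (+-suc k i)))

cat-range : ∀ n i F (G : Fin n → List Bool) → (∀ j → G j ≡ F (i + toℕ j) (n ∸ suc (toℕ j))) → cat (allFin n) G ≡ range i n F
cat-range zero    i F G eq = refl
cat-range (suc n) i F G eq = trans (cat-allFin-suc n G) (cong₂ _++_ (trans (eq zero) (cong (λ k → F k n) (+-identityʳ i)))
  (cat-range n (suc i) F (G ∘ suc) (λ j → trans (eq (suc j)) (cong (λ k → F k (n ∸ suc (toℕ j))) (+-suc i (toℕ j))))))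

-- The positions of a list of symbols, each passed on together with its index.
indexed : ∀ {A : Set} → ℕ → List A → (A → ℕ → List Bool) → List Bool
indexed i []       f = []
indexed i (x ∷ xs) f = f x i ++ indexed (suc i) xs f

indexed-++ : ∀ {A : Set} i xs ys (f : A → ℕ → List Bool) → indexed i (xs ++ ys) f ≡ indexed i xs f ++ indexed (i + length xs) ys f
indexed-++ i []       ys f = cong (λ k → indexed k ys f) (sym (+-identityʳ i))
indexed-++ i (x ∷ xs) ys f = trans (cong (f x i ++_) (trans (indexed-++ (suc i) xs ys f) (cong (λ k → indexed (suc i) xs f ++ indexed k ys f) (sym (+-suc i (length xs))))))
  (sym (Listₚ.++-assoc (f x i) _ _))

indexed-replicate : ∀ {A : Set} i n (x : A) f → indexed i (replicate n x) f ≡ range i n (λ i _ → f x i)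
indexed-replicate i zero    x f = refl
indexed-replicate i (suc n) x f = cong (f x i ++_) (indexed-replicate (suc i) n x f)

cat-indexed : ∀ {A : Set} (d : A) n i xs f → length xs ≡ n → cat (allFin n) (λ j → f (nthOr d xs (toℕ j)) (i + toℕ j)) ≡ indexed i xs f
cat-indexed d zero    i []       f eq = refl
cat-indexed d (suc n) i (x ∷ xs) f eq = trans (cat-allFin-suc n _) (cong₂ _++_ (cong (f x) (+-identityʳ i))
  (trans (cat-cong (allFin n) (λ j → cong (f (nthOr d xs (toℕ j))) (+-suc i (toℕ j)))) (cat-indexed d n (suc i) xs f (suc-injective eq))))

leavesFor : ∀ {A : Set} {κ} → List A → (A → List (Leaf κ)) → List (Leaf κ)
leavesFor xs f = concat (map f xs)

outLeaves-++ : ∀ {κ} ls ms (cs : Stacks κ) → outLeaves (ls ++ ms) cs ≡ outLeaves ls cs ++ outLeaves ms cs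
outLeaves-++ []       ms cs = refl
outLeaves-++ (l ∷ ls) ms cs = trans (cong (outLeaf l cs ++_) (outLeaves-++ ls ms cs)) (sym (Listₚ.++-assoc (outLeaf l cs) _ _))

outLeaves-for : ∀ {A : Set} {κ} xs (f : A → List (Leaf κ)) cs → outLeaves (leavesFor xs f) cs ≡ cat xs (λ x → outLeaves (f x) cs)
outLeaves-for []       f cs = refl
outLeaves-for (x ∷ xs) f cs = trans (outLeaves-++ (f x) _ cs) (cong (outLeaves (f x) cs ++_) (outLeaves-for xs f cs))

outTops-++ : ∀ {κ} ts us (ds : Stacks κ) → outTops (ts ++ us) ds ≡ outTops ts ds ++ outTops us ds
outTops-++ []       us ds = refl
outTops-++ (t ∷ ts) us ds = trans (cong (outTop t ds ++_) (outTops-++ ts us ds)) (sym (Listₚ.++-assoc (outTop t ds) _ _))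

outFor-range : ∀ {κ} body (ds : Stacks κ) r F N →
  (∀ b s xs → length s + suc (length xs) ≡ N → outLeaves (body b) (s ∷ (ds [ r ]≔ xs)) ≡ F (length s) (length xs)) →
  ∀ s xs → length s + length xs ≡ N → outFor body ds r s xs ≡ range (length s) (length xs) F
outFor-range body ds r F N eq s []       e = refl
outFor-range body ds r F N eq s (b ∷ xs) e = cong₂ _++_ (eq b s xs e) (outFor-range body ds r F N eq (b ∷ s) xs (trans (sym (+-suc (length s) (length xs))) e))

total : ∀ {κ} → List (Fin κ) → Stacks κ → ℕ
total []       cs = 0
total (i ∷ is) cs = length (lookup cs i) + total is cs

value-total : ∀ {κ} is k β (cs : Stacks κ) → value (map (λ i → i , k) is) β cs ≡ β + k * total is cs
value-total []       k β cs = trans (sym (+-identityʳ β)) (cong (λ x → β + x) (sym (*-zeroʳ k)))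
value-total (i ∷ is) k β cs = trans (value-total is k _ cs) (arithmetic β (length (lookup cs i)) k (total is cs))
  where
  arithmetic : ∀ β l k t → β + l * k + k * t ≡ β + k * (l + t)
  arithmetic = solve-∀

-- The rows of the adjacency matrix

module Encoding (J M : ℕ) {Slot : Set} (slots : List Slot) where
  open Construction J M slots

  cat-vertices : ∀ F → cat vertices F ≡ cat (allFin J) (λ j → cat slots (λ r → F (slot j r false) ++ F (slot j r true)) ++ (F (lit j false) ++ F (lit j true)))
    ++ (cat (allFin M) (λ m → F (col m false) ++ F (col m true)) ++ (F slotHub ++ F columnHub))
  cat-vertices F = trans (cat-++ (map inj₁ (cartesianProduct (allFin J) gadget)) _ F) (cong₂ _++_
    (trans (cat-map inj₁ (cartesianProduct (allFin J) gadget) F) (trans (cat-product (allFin J) gadget (F ∘ inj₁))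
      (cat-cong (allFin J) λ j → trans (cat-++ (map inj₁ (cartesianProduct slots bools)) _ _) (cong₂ _++_
          (trans (cat-map inj₁ (cartesianProduct slots bools) _) (trans (cat-product slots bools _) (cat-cong slots λ r → two (λ s → F (slot j r s)))))
          (two (λ s → F (lit j s)))))))
    (trans (cat-map inj₂ (map inj₁ (cartesianProduct (allFin M) bools) ++ map inj₂ bools) F) (trans (cat-++ (map inj₁ (cartesianProduct (allFin M) bools)) _ _)
      (cong₂ _++_ (trans (cat-map inj₁ (cartesianProduct (allFin M) bools) _) (trans (cat-product (allFin M) bools _) (cat-cong (allFin M) λ m → two (λ i → F (col m i)))))
        (two (λ i → F (inj₂ (inj₂ i))))))))
    where
    two : ∀ (G : Bool → List Bool) → G false ++ (G true ++ []) ≡ G false ++ G true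
    two G = cong (G false ++_) (Listₚ.++-identityʳ (G true))

  length-vertices : length vertices ≡ 2 + J * (2 * length slots + 2) + M * 2
  length-vertices = trans (sym (*-identityʳ _)) (trans (sym (∑-const vertices 1)) (trans (∑-vertices (λ _ → 1)) (trans (cong₂ _+_ (cong₂ _+_
      (trans (∑-product (allFin J) slots (λ _ → 2)) (trans (∑-cong (allFin J) (λ _ → ∑-const slots 2)) (trans (∑-const (allFin J) _) (cong (λ x → x * (length slots * 2)) (length-allFin J)))))
      (trans (∑-const (allFin J) 2) (cong (λ x → x * 2) (length-allFin J))))
      (cong (_+ 2) (trans (∑-const (allFin M) 2) (cong (λ x → x * 2) (length-allFin M)))))
    (rearrange J (length slots) M))))
    where
    rearrange : ∀ J R M → (J * (R * 2) + J * 2) + (M * 2 + 2) ≡ 2 + J * (2 * R + 2) + M * 2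
    rearrange = solve-∀

  pairOf : Bool → Bool → List Bool
  pairOf a b = a ∷ b ∷ []

  -- The part of a row that belongs to one gadget: for a vertex without neighbours in it, and for
  -- one on the column side, which sees all slot vertices and no literal.
  zeros full : List Bool
  zeros = cat slots (λ _ → pairOf false false) ++ pairOf false false
  full  = cat slots (λ _ → pairOf true true) ++ pairOf false false

  ownSlot ownLit : Bool → List Bool
  ownSlot s = cat slots (λ _ → pairOf false false) ++ pairOf (same s false) (same s true)
  ownLit s  = cat slots (λ _ → pairOf (same s false) (same s true)) ++ pairOf (not (same s false)) (not (same s true))

  times : ℕ → List Bool → List Bool
  times n bs = concat (replicate n bs)

  slotRow litRow : Bool → ℕ → ℕ → List Bool
  slotRow s i r = times i zeros ++ (ownSlot s ++ (times r zeros ++ (times M (pairOf true true) ++ pairOf false true)))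
  litRow s i r  = times i zeros ++ (ownLit s ++ (times r zeros ++ (times M (pairOf false false) ++ pairOf false false)))

  columnRow : ℕ → ℕ → List Bool
  columnRow i r = times J full ++ (times i (pairOf false false) ++ (pairOf false false ++ (times r (pairOf false false) ++ pairOf true false)))

  slotHubRow columnHubRow : List Bool
  slotHubRow   = times J zeros ++ (times M (pairOf true true) ++ pairOf false true)
  columnHubRow = times J full ++ (times M (pairOf false false) ++ pairOf true false)

  row-of : Vertex → List Bool
  row-of v = map (adjacent v) vertices

  row-≡ : ∀ v → row-of v ≡ cat (allFin J) (λ j → cat slots (λ r → pairOf (adjacent v (slot j r false)) (adjacent v (slot j r true))) ++ pairOf (adjacent v (lit j false)) (adjacent v (lit j true)))
    ++ (cat (allFin M) (λ m → pairOf (adjacent v (col m false)) (adjacent v (col m true))) ++ pairOf (adjacent v slotHub) (adjacent v columnHub))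
  row-≡ v = trans (map-cat (adjacent v) vertices) (cat-vertices (λ w → adjacent v w ∷ []))

  all-gadgets : ∀ bs → cat (allFin J) (λ _ → bs) ≡ times J bs
  all-gadgets bs = trans (cat-const (allFin J) bs) (cong (λ n → times n bs) (length-allFin J))

  all-columns : ∀ bs → cat (allFin M) (λ _ → bs) ≡ times M bs
  all-columns bs = trans (cat-const (allFin M) bs) (cong (λ n → times n bs) (length-allFin M))

  assoc₃ : ∀ (a b c d : List Bool) → (a ++ (b ++ c)) ++ d ≡ a ++ (b ++ (c ++ d))
  assoc₃ a b c d = trans (Listₚ.++-assoc a (b ++ c) d) (cong (a ++_) (Listₚ.++-assoc b c d))

  slot-row : ∀ j r s → row-of (slot j r s) ≡ slotRow s (toℕ j) (J ∸ suc (toℕ j))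
  slot-row j r s = trans (row-≡ (slot j r s)) (trans (cong₂ _++_ (trans (cat-cong (allFin J) (gadget-part s)) (cat-select j (ownSlot s) zeros)) (cong (_++ pairOf false true) (all-columns (pairOf true true))))
    (assoc₃ (times (toℕ j) zeros) (ownSlot s) (times (J ∸ suc (toℕ j)) zeros) (times M (pairOf true true) ++ pairOf false true)))
    where
    gadget-part : ∀ s j′ → cat slots (λ r′ → pairOf false false) ++ pairOf (adjacent (slot j r s) (lit j′ false)) (adjacent (slot j r s) (lit j′ true)) ≡ (if eqF j j′ then ownSlot s else zeros)
    gadget-part s j′ with eqF j j′ | s
    ... | false | _     = refl
    ... | true  | false = refl
    ... | true  | true  = refl

  lit-row : ∀ j s → row-of (lit j s) ≡ litRow s (toℕ j) (J ∸ suc (toℕ j))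
  lit-row j s = trans (row-≡ (lit j s)) (trans (cong₂ _++_ (trans (cat-cong (allFin J) (gadget-part s)) (cat-select j (ownLit s) zeros)) (cong (_++ pairOf false false) (all-columns (pairOf false false))))
    (assoc₃ (times (toℕ j) zeros) (ownLit s) (times (J ∸ suc (toℕ j)) zeros) (times M (pairOf false false) ++ pairOf false false)))
    where
    gadget-part : ∀ s j′ → cat slots (λ r′ → pairOf (adjacent (lit j s) (slot j′ r′ false)) (adjacent (lit j s) (slot j′ r′ true))) ++ pairOf (adjacent (lit j s) (lit j′ false)) (adjacent (lit j s) (lit j′ true)) ≡ (if eqF j j′ then ownLit s else zeros)
    gadget-part s j′ with eqF j j′ | s
    ... | false | _     = refl
    ... | true  | false = refl
    ... | true  | true  = refl

  column-row : ∀ m i → row-of (col m i) ≡ columnRow (toℕ m) (M ∸ suc (toℕ m))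
  column-row m i = trans (row-≡ (col m i)) (cong₂ _++_ (all-gadgets full) (trans (cong (_++ pairOf true false) (trans (cat-cong (allFin M) unselected)
      (cat-select m (pairOf false false) (pairOf false false)))) (assoc₃ (times (toℕ m) (pairOf false false)) (pairOf false false) (times (M ∸ suc (toℕ m)) (pairOf false false)) (pairOf true false))))
    where
    unselected : ∀ m′ → pairOf false false ≡ (if eqF m m′ then pairOf false false else pairOf false false)
    unselected m′ with eqF m m′
    ... | true  = refl
    ... | false = refl

  slotHub-row : row-of slotHub ≡ slotHubRow
  slotHub-row = trans (row-≡ slotHub) (cong₂ _++_ (all-gadgets zeros) (cong (_++ pairOf false true) (all-columns (pairOf true true))))

  columnHub-row : row-of columnHub ≡ columnHubRow
  columnHub-row = trans (row-≡ columnHub) (cong₂ _++_ (all-gadgets full) (cong (_++ pairOf true false) (all-columns (pairOf false false))))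

  gadgetRows : ℕ → ℕ → List Bool
  gadgetRows i r = cat slots (λ _ → slotRow false i r ++ slotRow true i r) ++ (litRow false i r ++ litRow true i r)

  rows-≡ : cat vertices row-of ≡ range 0 J gadgetRows ++ (range 0 M (λ i r → columnRow i r ++ columnRow i r) ++ (slotHubRow ++ columnHubRow))
  rows-≡ = trans (cat-vertices row-of) (cong₂ _++_ (cat-range J 0 gadgetRows _ (λ j → cong₂ _++_ (cat-cong slots (λ r → cong₂ _++_ (slot-row j r false) (slot-row j r true))) (cong₂ _++_ (lit-row j false) (lit-row j true))))
    (cong₂ _++_ (cat-range M 0 (λ i r → columnRow i r ++ columnRow i r) _ (λ m → cong₂ _++_ (column-row m false) (column-row m true))) (cong₂ _++_ slotHub-row columnHub-row)))

  encode-≡ : ∀ (cap : Vertex → ℕ) k → encCVC (record { G = graph ; cap = cap ∘ List.lookup vertices ; k = k }) ≡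
    encode (length vertices) ++ (encode k ++ (cat vertices (encode ∘ cap) ++ cat vertices row-of))
  encode-≡ cap k = cong₂ _++_ (sym (encode-encℕ (length vertices))) (cong₂ _++_ (sym (encode-encℕ k)) (cong₂ _++_ (trans (cong concat (map-allFin-lookup (encℕ ∘ cap) vertices)) (cat-cong vertices (λ v → sym (encode-encℕ (cap v)))))
    (cong concat (trans (Listₚ.map-cong (λ i → map-allFin-lookup (adjacent (List.lookup vertices i)) vertices) (allFin (length vertices))) (map-allFin-lookup row-of vertices)))))

-- Computing the sizes as lengths of counters

ones : ℕ → List Bool
ones n = replicate n true

leafLength : ∀ {κ} → Leaf κ → Stacks κ → ℕ
leafLength (bits bs)  cs = length bs
leafLength (rep r bs) cs = length (lookup cs r) * length bs
leafLength (num ls β) cs = length (outLeaf (num ls β) cs)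

leavesLength : ∀ {κ} → List (Leaf κ) → Stacks κ → ℕ
leavesLength []       cs = 0
leavesLength (l ∷ ls) cs = leafLength l cs + leavesLength ls cs

length-times : ∀ n (bs : List Bool) → length (concat (replicate n bs)) ≡ n * length bs
length-times zero    bs = refl
length-times (suc n) bs = trans (Listₚ.length-++ bs) (cong (λ x → length bs + x) (length-times n bs))

length-leaves : ∀ {κ} ls (cs : Stacks κ) → length (outLeaves ls cs) ≡ leavesLength ls cs
length-leaves []       cs = refl
length-leaves (l ∷ ls) cs = trans (Listₚ.length-++ (outLeaf l cs)) (cong₂ _+_ (length-leaf l) (length-leaves ls cs))
  where
  length-leaf : ∀ l → length (outLeaf l cs) ≡ leafLength l cs
  length-leaf (bits bs)  = refl
  length-leaf (rep r bs) = length-times (length (lookup cs r)) bs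
  length-leaf (num ls β) = refl

length-straight : ∀ {κ} ls (ds : Stacks κ) → length (outTops (straight ls ∷ []) ds) ≡ leavesLength ls ([] ∷ ds)
length-straight ls ds = trans (cong length (Listₚ.++-identityʳ (outLeaves ls ([] ∷ ds)))) (length-leaves ls ([] ∷ ds))

length-for : ∀ {κ} body (ds : Stacks κ) r k → (∀ b s xs → leavesLength (body b) (s ∷ (ds [ r ]≔ xs)) ≡ k) →
  length (outTops (for r body ∷ []) ds) ≡ length (lookup ds r) * k
length-for body ds r k eq = trans (cong length (Listₚ.++-identityʳ (outFor body ds r [] (lookup ds r)))) (go [] (lookup ds r))
  where
  go : ∀ s xs → length (outFor body ds r s xs) ≡ length xs * k
  go s []       = refl
  go s (b ∷ xs) = trans (Listₚ.length-++ (outLeaves (body b) (s ∷ (ds [ r ]≔ xs)))) (cong₂ _+_ (trans (length-leaves (body b) (s ∷ (ds [ r ]≔ xs))) (eq b s xs)) (go (b ∷ s) xs))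

exec-++ : ∀ {κ} ps qs (ds : Stacks κ) → exec (ps ++ qs) ds ≡ exec qs (exec ps ds)
exec-++ []              qs ds = refl
exec-++ ((r , ts) ∷ ps) qs ds = exec-++ ps qs (ds [ r ]≔ outTops ts ds)

-- The loop consumes `r` while it runs, so the factor has to be another counter; accordingly `Power`
-- asks that the length of `b` does not depend on the content of `r`.
multiply : ∀ {κ} → Fin κ → Fin κ → Fin κ × List (Top κ)
multiply r b = r , for r (λ _ → rep (suc b) (ones 1) ∷ []) ∷ []

module Power {κ : ℕ} (r b : Fin κ) (state : List Bool → Stacks κ) (B : ℕ) (look : ∀ p → lookup (state p) r ≡ p)
  (set : ∀ p q → state p [ r ]≔ q ≡ state q) (base : ∀ p → length (lookup (state p) b) ≡ B) where

  power-run : ∀ e p → Σ[ q ∈ List Bool ] exec (replicate e (multiply r b)) (state p) ≡ state q × length q ≡ length p * B ^ e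
  power-run zero    p = p , refl , sym (*-identityʳ _)
  power-run (suc e) p = finish (power-run e p′)
    where
    p′ = outTops (proj₂ (multiply r b)) (state p)
    length-p′ : length p′ ≡ length p * B
    length-p′ = trans (length-for (λ _ → rep (suc b) (ones 1) ∷ []) (state p) r B (λ _ s xs → trans (+-identityʳ _) (trans (*-identityʳ _)
      (trans (cong (λ ds → length (lookup ds b)) (set p xs)) (base xs))))) (cong (λ q → length q * B) (look p))
    finish : (Σ[ q ∈ List Bool ] exec (replicate e (multiply r b)) (state p′) ≡ state q × length q ≡ length p′ * B ^ e) →
      Σ[ q ∈ List Bool ] exec (replicate (suc e) (multiply r b)) (state p) ≡ state q × length q ≡ length p * B ^ suc e
    finish (q , eq , len) = q , trans (cong (exec (replicate e (multiply r b))) (set p p′)) eq ,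
      trans len (trans (cong (λ l → l * B ^ e) length-p′) (*-assoc (length p) B (B ^ e)))

n0 : ∀ {n} → Fin (1 + n)
n1 : ∀ {n} → Fin (2 + n)
n2 : ∀ {n} → Fin (3 + n)
n3 : ∀ {n} → Fin (4 + n)
n4 : ∀ {n} → Fin (5 + n)
n5 : ∀ {n} → Fin (6 + n)
n6 : ∀ {n} → Fin (7 + n)
n7 : ∀ {n} → Fin (8 + n)
n8 : ∀ {n} → Fin (9 + n)
n9 : ∀ {n} → Fin (10 + n)
n10 : ∀ {n} → Fin (11 + n)
n11 : ∀ {n} → Fin (12 + n)
n12 : ∀ {n} → Fin (13 + n)
n0 = zero
n1 = suc n0
n2 = suc n1
n3 = suc n2
n4 = suc n3
n5 = suc n4
n6 = suc n5
n7 = suc n6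
n8 = suc n7
n9 = suc n8
n10 = suc n9
n11 = suc n10
n12 = suc n11

-- The counters: the input, off, W, w - 2, w, T′ * w, the numbers of clause positions, of variables and of clauses,
-- the current power, the bound for the length of verifier inputs, and T′.
module Counters (M : TM) (a d a′ d′ : ℕ) where
  open Formula M using (g; C)

  -- Inside leaves index 0 is the number of past iterations, so a counter is numbered one higher
  -- there than as the target of a step or the range of a loop. The width less 2 is a counter of its
  -- own because leaves can add constants but not subtract them. The last step of `prepare₁` resets
  -- the power for the second exponentiation.
  prepare₁ prepare₂ prepare₃ preparation : Steps 12
  prepare₁ = (n2 , straight (rep n10 (ones a) ∷ bits (ones a) ∷ []) ∷ []) ∷
             (n10 , straight (rep n1 (ones 2) ∷ bits (ones 2) ∷ rep n3 (ones 1) ∷ []) ∷ []) ∷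
             (n9 , straight (bits (ones 1) ∷ []) ∷ []) ∷ []
  prepare₂ = (n11 , straight (rep n10 (ones a′) ∷ bits (ones a′) ∷ []) ∷ []) ∷
             (n1 , straight (rep n12 (ones 2) ∷ bits (ones 8) ∷ []) ∷ []) ∷
             (n3 , straight (rep n2 (ones 1) ∷ rep n1 (ones 2) ∷ bits (ones 2) ∷ rep n3 (ones 1) ∷ []) ∷ []) ∷
             (n4 , straight (bits (ones 2) ∷ rep n4 (ones 1) ∷ []) ∷ []) ∷ []
  prepare₃ = (n5 , for n11 (λ _ → rep n5 (ones 1) ∷ []) ∷ []) ∷
             (n6 , straight (rep n5 (ones 2) ∷ rep n6 (ones 1) ∷ []) ∷ []) ∷
             (n7 , straight (rep n7 (ones g) ∷ rep n5 (ones g) ∷ []) ∷ []) ∷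
             (n8 , straight (rep n7 (ones C) ∷ []) ∷ []) ∷ []
  preparation = ((n9 , straight (bits (ones 1) ∷ []) ∷ []) ∷ replicate d (multiply n9 n0)) ++
    (prepare₁ ++ (replicate d′ (multiply n9 n10) ++ (prepare₂ ++ prepare₃)))

  layout : (x o W w₂ w E P J M p l t : List Bool) → Stacks 12
  layout x o W w₂ w E P J M p l t = x ∷ o ∷ W ∷ w₂ ∷ w ∷ E ∷ P ∷ J ∷ M ∷ p ∷ l ∷ t ∷ []

  record Prepared (x : List Bool) : Set where
    open Sizes a d a′ d′ (length x) public
    field
      oₗ Wₗ vₗ wₗ eₗ Pₗ Jₗ Mₗ pₗ lₗ tₗ : List Bool
      state-≡  : exec preparation (start x) ≡ layout x oₗ Wₗ vₗ wₗ eₗ Pₗ Jₗ Mₗ pₗ lₗ tₗ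
      o-≡      : length oₗ ≡ off
      W-≡      : length Wₗ ≡ W
      v-≡      : 2 + length vₗ ≡ suc w′
      wₗ-≡     : length wₗ ≡ suc w′
      E-≡      : length eₗ ≡ T′ * suc w′
      P-≡      : length Pₗ ≡ (2 + T′) * suc w′
      J-≡      : length Jₗ ≡ ((2 + T′) * suc w′ + suc w′) * g
      M-≡      : length Mₗ ≡ (2 + T′) * suc w′ * C

  prepared : ∀ x → Prepared x
  prepared x = first (Power.power-run n9 n0 (λ p → layout x [] [] [] [] [] [] [] [] p [] []) (length x) (λ _ → refl) (λ _ _ → refl) (λ _ → refl) d (ones 1))
    where
    open Sizes a d a′ d′ (length x)
    n = length x
    scaled : ∀ k c → k * length (ones c) + (length (ones c) + 0) ≡ k * c + c
    scaled k c rewrite Listₚ.length-replicate c {true} = cong (λ y → k * c + y) (+-identityʳ c)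
    first : (Σ[ p ∈ List Bool ] exec (replicate d (multiply n9 n0)) (layout x [] [] [] [] [] [] [] [] (ones 1) [] []) ≡ layout x [] [] [] [] [] [] [] [] p [] [] × length p ≡ 1 * n ^ d) → Prepared x
    first (p , p-eq , p-len) = second (Power.power-run n9 n10 (λ q → layout x [] W₁ [] [] [] [] [] [] q l₁ []) lengthBound (λ _ → refl) (λ _ _ → refl) (λ _ → l-len) d′ (ones 1))
      where
      ds₁ = layout x [] [] [] [] [] [] [] [] p [] []
      W₁ = outTops (straight (rep n10 (ones a) ∷ bits (ones a) ∷ []) ∷ []) ds₁
      W-len : length W₁ ≡ W
      W-len = trans (length-straight (rep n10 (ones a) ∷ bits (ones a) ∷ []) ds₁) (trans (scaled (length p) a)
        (cong (_+ a) (trans (cong (_* a) (trans p-len (*-identityˡ _))) (*-comm (n ^ d) a))))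
      l₁ = outTops (straight (rep n1 (ones 2) ∷ bits (ones 2) ∷ rep n3 (ones 1) ∷ []) ∷ []) (layout x [] W₁ [] [] [] [] [] [] p [] [])
      l-len : length l₁ ≡ lengthBound
      l-len = trans (length-straight (rep n1 (ones 2) ∷ bits (ones 2) ∷ rep n3 (ones 1) ∷ []) (layout x [] W₁ [] [] [] [] [] [] p [] []))
        (trans (cong (λ y → n * 2 + (2 + (y * 1 + 0))) W-len) (shape n W))
        where
        shape : ∀ n W → n * 2 + (2 + (W * 1 + 0)) ≡ 2 * n + 2 + W
        shape = solve-∀
      second : (Σ[ q ∈ List Bool ] exec (replicate d′ (multiply n9 n10)) (layout x [] W₁ [] [] [] [] [] [] (ones 1) l₁ []) ≡ layout x [] W₁ [] [] [] [] [] [] q l₁ [] × length q ≡ 1 * lengthBound ^ d′) → Prepared x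
      second (q , q-eq , q-len) = record
        { oₗ = o ; Wₗ = W₁ ; vₗ = w₂ ; wₗ = wₗ ; eₗ = E ; Pₗ = P ; Jₗ = J ; Mₗ = K ; pₗ = q ; lₗ = l₁ ; tₗ = t
        ; state-≡ = trans (exec-++ ((n9 , straight (bits (ones 1) ∷ []) ∷ []) ∷ replicate d (multiply n9 n0)) _ (start x))
            (trans (cong (exec (prepare₁ ++ (replicate d′ (multiply n9 n10) ++ (prepare₂ ++ prepare₃)))) p-eq)
              (trans (exec-++ (replicate d′ (multiply n9 n10)) (prepare₂ ++ prepare₃) (layout x [] W₁ [] [] [] [] [] [] (ones 1) l₁ [])) (cong (exec (prepare₂ ++ prepare₃)) q-eq)))
        ; o-≡ = o-len ; W-≡ = W-len ; v-≡ = w₂-len ; wₗ-≡ = wₗ-len ; E-≡ = E-len ; P-≡ = P-len ; J-≡ = J-len ; M-≡ = K-len }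
        where
        t = outTops (straight (rep n10 (ones a′) ∷ bits (ones a′) ∷ []) ∷ []) (layout x [] W₁ [] [] [] [] [] [] q l₁ [])
        t-len : length t ≡ T′
        t-len = trans (length-straight (rep n10 (ones a′) ∷ bits (ones a′) ∷ []) (layout x [] W₁ [] [] [] [] [] [] q l₁ [])) (trans (scaled (length q) a′)
          (cong (_+ a′) (trans (cong (_* a′) (trans q-len (*-identityˡ _))) (*-comm (lengthBound ^ d′) a′))))
        ds₂ = layout x [] W₁ [] [] [] [] [] [] q l₁ t
        o = outTops (straight (rep n12 (ones 2) ∷ bits (ones 8) ∷ []) ∷ []) ds₂
        o-len : length o ≡ off
        o-len = trans (length-straight (rep n12 (ones 2) ∷ bits (ones 8) ∷ []) ds₂) (trans (cong (λ y → y * 2 + 8) t-len) (cong (_+ 8) (double T′)))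
          where
          double : ∀ t → t * 2 ≡ t + t
          double = solve-∀
        ds₃ = layout x o W₁ [] [] [] [] [] [] q l₁ t
        w₂ = outTops (straight (rep n2 (ones 1) ∷ rep n1 (ones 2) ∷ bits (ones 2) ∷ rep n3 (ones 1) ∷ []) ∷ []) ds₃
        w₂-len : 2 + length w₂ ≡ suc w′
        w₂-len = trans (cong (λ y → 2 + y) (trans (length-straight (rep n2 (ones 1) ∷ rep n1 (ones 2) ∷ bits (ones 2) ∷ rep n3 (ones 1) ∷ []) ds₃)
          (cong₂ (λ y z → y * 1 + (n * 2 + (2 + (z * 1 + 0)))) o-len W-len))) (shape off n W)
          where
          shape : ∀ o n W → 2 + (o * 1 + (n * 2 + (2 + (W * 1 + 0)))) ≡ suc (o + suc (2 * n + 2) + W)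
          shape = solve-∀
        ds₄ = layout x o W₁ w₂ [] [] [] [] [] q l₁ t
        wₗ = outTops (straight (bits (ones 2) ∷ rep n4 (ones 1) ∷ []) ∷ []) ds₄
        wₗ-len : length wₗ ≡ suc w′
        wₗ-len = trans (length-straight (bits (ones 2) ∷ rep n4 (ones 1) ∷ []) ds₄) (trans (cong (λ y → 2 + y) (trans (+-identityʳ _) (*-identityʳ (length w₂)))) w₂-len)
        ds₅ = layout x o W₁ w₂ wₗ [] [] [] [] q l₁ t
        E = outTops (for n11 (λ _ → rep n5 (ones 1) ∷ []) ∷ []) ds₅
        E-len : length E ≡ T′ * suc w′
        E-len = trans (length-for (λ _ → rep n5 (ones 1) ∷ []) ds₅ n11 (suc w′) (λ _ _ _ → trans (+-identityʳ _) (trans (*-identityʳ (length wₗ)) wₗ-len))) (cong (_* suc w′) t-len)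
        ds₆ = layout x o W₁ w₂ wₗ E [] [] [] q l₁ t
        P = outTops (straight (rep n5 (ones 2) ∷ rep n6 (ones 1) ∷ []) ∷ []) ds₆
        P-len : length P ≡ (2 + T′) * suc w′
        P-len = trans (length-straight (rep n5 (ones 2) ∷ rep n6 (ones 1) ∷ []) ds₆) (trans (cong₂ (λ y z → y * 2 + (z * 1 + 0)) wₗ-len E-len) (shape (suc w′) T′))
          where
          shape : ∀ w t → w * 2 + (t * w * 1 + 0) ≡ (2 + t) * w
          shape = solve-∀
        ds₇ = layout x o W₁ w₂ wₗ E P [] [] q l₁ t
        J = outTops (straight (rep n7 (ones g) ∷ rep n5 (ones g) ∷ []) ∷ []) ds₇
        J-len : length J ≡ ((2 + T′) * suc w′ + suc w′) * g
        J-len = trans (length-straight (rep n7 (ones g) ∷ rep n5 (ones g) ∷ []) ds₇) (trans (cong₂ _+_ (cong₂ _*_ P-len (Listₚ.length-replicate g)) (trans (+-identityʳ _) (cong₂ _*_ wₗ-len (Listₚ.length-replicate g))))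
          (sym (*-distribʳ-+ g ((2 + T′) * suc w′) (suc w′))))
        ds₈ = layout x o W₁ w₂ wₗ E P J [] q l₁ t
        K = outTops (straight (rep n7 (ones C) ∷ []) ∷ []) ds₈
        K-len : length K ≡ (2 + T′) * suc w′ * C
        K-len = trans (length-straight (rep n7 (ones C) ∷ []) ds₈) (trans (+-identityʳ _) (cong₂ _*_ P-len (Listₚ.length-replicate C)))

two-leaves : ∀ {κ} (l m : Leaf κ) cs → outLeaves (l ∷ m ∷ []) cs ≡ outLeaf l cs ++ outLeaf m cs
two-leaves l m cs = cong (outLeaf l cs ++_) (Listₚ.++-identityʳ (outLeaf m cs))

-- The leaf for k times a position, given as a constant plus counters, plus a constant.
scaled : ∀ {κ} → List (Fin κ) × ℕ → ℕ → ℕ → Leaf κ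
scaled (is , δ) k β = num (map (λ i → i , k) is) (k * δ + β)

scaled-out : ∀ {κ} is δ k β p (cs : Stacks κ) → p ≡ δ + total is cs → outLeaf (scaled (is , δ) k β) cs ≡ encode (k * p + β)
scaled-out is δ k β p cs eq = cong encode (trans (value-total is k (k * δ + β) cs) (trans (shape k δ β (total is cs)) (cong (λ p → k * p + β) (sym eq))))
  where
  shape : ∀ k δ β t → k * δ + β + k * t ≡ k * (δ + t) + β
  shape = solve-∀

-- The program that emits the instance, and its correctness

module Emission (M : TM) (a d a′ d′ : ℕ) where
  open Formula M
  open Counters M a d a′ d′

  slots₀ : List (Fin C × Fin 4)
  slots₀ = cartesianProduct (allFin C) (allFin 4)

  R : ℕ
  R = length slots₀

  -- For each offset, the position of the clause that a cell lies at this distance from, as counters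
  -- plus a constant. Leaves cannot subtract, so `c ∸ offset` is worked out beforehand for each
  -- stretch of cells.
  Phase : Set
  Phase = Offset → Maybe (List (Fin 13) × ℕ)

  larger : Bool → Fin C × Fin 4 → ℕ
  larger s (κ , l) = ind (not (same s (proj₂ (proj₂ (literal (kind κ) l)))))

  slotLeaf′ : Bool → Maybe (List (Fin 13) × ℕ) → ℕ → ℕ → Leaf 13
  slotLeaf′ true  (just ps) κ e = scaled ps (2 * C) (2 * κ + 2 + e)
  slotLeaf′ true  nothing   κ e = num ((n9 , 2) ∷ []) (2 + e)
  slotLeaf′ false _         κ e = num ((n9 , 2) ∷ []) (2 + e)

  slotLeaf : Phase → Fin g → Fin C × Fin 4 → Bool → Leaf 13
  slotLeaf ph α r@(κ , l) s = slotLeaf′ (eqF α (proj₁ (proj₂ (literal (kind κ) l)))) (ph (proj₁ (literal (kind κ) l))) (toℕ κ) (larger s r)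

  cellLeaves : Phase → List (Leaf 13)
  cellLeaves ph = leavesFor (allFin g) λ α → leavesFor slots₀ (λ r → slotLeaf ph α r false ∷ slotLeaf ph α r true ∷ []) ++ (bits (encode (suc R)) ∷ bits (encode (suc R)) ∷ [])

  -- The factor `8 * C` and the summand `4 * (2 * κ + 1)` come from expanding `baseOf`. Whether a
  -- clause is active depends on the stretch and the kind only, so it is settled when the program is
  -- written.
  clauseLeaves : Spec → List (Fin 13) × ℕ → List (Leaf 13)
  clauseLeaves s ps = leavesFor (allFin C) λ κ → scaled ps (8 * C) (4 * (2 * toℕ κ + 1) + ind (not (activates s (kind κ)))) ∷
    scaled ps (8 * C) (4 * (2 * toℕ κ + 1) + suc (ind (activates s (kind κ)))) ∷ []

  -- The cells 0, 1, those of the rest of the first row, and all others; missing entries have no clause.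
  phase₀ phase₁ phase₂ phase₃ : Phase
  phase₀ o0 = just ([] , 0)
  phase₀ _  = nothing
  phase₁ o0 = just ([] , 1)
  phase₁ o1 = just ([] , 0)
  phase₁ _  = nothing
  phase₂ o0 = just (n0 ∷ [] , 2)
  phase₂ o1 = just (n0 ∷ [] , 1)
  phase₂ o2 = just (n0 ∷ [] , 0)
  phase₂ ow = nothing
  phase₃ o0 = just (n4 ∷ n0 ∷ [] , 2)
  phase₃ o1 = just (n4 ∷ n0 ∷ [] , 1)
  phase₃ o2 = just (n4 ∷ n0 ∷ [] , 0)
  phase₃ ow = just (n0 ∷ [] , 0)

  blank₀ : Tableau.Γ M
  blank₀ = nothing , nothing

  headerTops cellTops clauseTops hubTops rowTops program : List (Top 12)
  headerTops = straight (num ((n8 , 2 * R + 2) ∷ (n9 , 2) ∷ []) 2 ∷ num ((n8 , suc (2 * R)) ∷ (n9 , 2) ∷ []) 1 ∷ []) ∷ []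
  cellTops   = straight (cellLeaves phase₀) ∷ straight (cellLeaves phase₁) ∷ for n3 (λ _ → cellLeaves phase₂) ∷ for n6 (λ _ → cellLeaves phase₃) ∷ []
  clauseTops = for n1 (λ _ → clauseLeaves (fixed blank₀) (n0 ∷ [] , 0)) ∷
               straight (clauseLeaves (fixed (nothing , just nothing)) (n2 ∷ [] , 0)) ∷
               -- `pairEnc` doubles the bits, so each past bit accounts for two cells and the
               -- iteration counter occurs twice; the constant steps over the cell of the head.
               for n0 (λ b → clauseLeaves (fixed (bitCell b)) (n2 ∷ n0 ∷ n0 ∷ [] , 1) ++ clauseLeaves (fixed (bitCell b)) (n2 ∷ n0 ∷ n0 ∷ [] , 2)) ∷
               -- The bits `false` and `true` that close the first component of `pairEnc`, after two
               -- cells for each bit of the input.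
               straight (clauseLeaves (fixed (bitCell false)) (n2 ∷ n1 ∷ n1 ∷ [] , 1) ++ clauseLeaves (fixed (bitCell true)) (n2 ∷ n1 ∷ n1 ∷ [] , 2)) ∷
               for n2 (λ _ → clauseLeaves guess (n2 ∷ n1 ∷ n1 ∷ n0 ∷ [] , 3)) ∷
               straight (clauseLeaves (fixed blank₀) (n2 ∷ n1 ∷ n1 ∷ n3 ∷ [] , 3)) ∷
               for n5 (λ _ → clauseLeaves middle (n4 ∷ n0 ∷ [] , 2)) ∷
               for n4 (λ _ → clauseLeaves last (n4 ∷ n6 ∷ n0 ∷ [] , 2)) ∷ []
  hubTops    = straight (bits (encode 1) ∷ bits (encode 0) ∷ []) ∷ []

  -- These blocks involve the slots only, so any numbers of variables and clauses give the same
  -- lists; taking 0 keeps the program independent of the input.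
  open Encoding 0 0 slots₀ using (zeros; full; ownSlot; ownLit; pairOf)

  slotRowLeaves litRowLeaves : Bool → List (Leaf 13)
  slotRowLeaves s = rep n0 zeros ∷ bits (ownSlot s) ∷ rep n8 zeros ∷ rep n9 (pairOf true true) ∷ bits (pairOf false true) ∷ []
  litRowLeaves s  = rep n0 zeros ∷ bits (ownLit s) ∷ rep n8 zeros ∷ rep n9 (pairOf false false) ∷ bits (pairOf false false) ∷ []

  columnRowLeaves : List (Leaf 13)
  columnRowLeaves = rep n8 full ∷ rep n0 (pairOf false false) ∷ bits (pairOf false false) ∷ rep n9 (pairOf false false) ∷ bits (pairOf true false) ∷ []

  rowTops = for n7 (λ _ → leavesFor slots₀ (λ _ → slotRowLeaves false ++ slotRowLeaves true) ++ (litRowLeaves false ++ litRowLeaves true)) ∷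
            for n8 (λ _ → columnRowLeaves ++ columnRowLeaves) ∷
            straight (rep n8 zeros ∷ rep n9 (pairOf true true) ∷ bits (pairOf false true) ∷ []) ∷
            straight (rep n8 full ∷ rep n9 (pairOf false false) ∷ bits (pairOf true false) ∷ []) ∷ []

  program = headerTops ++ (cellTops ++ (clauseTops ++ (hubTops ++ rowTops)))

  module Correct (x : List Bool) (prep : Prepared x) where
    open Prepared prep
    open Formula.Sized M w′ T′ off W (pairEnc x [])
    open Link M w′ T′ off W (pairEnc x [])
    open Construction J columns slots
    open Named slots-unique slots-complete
    open Capacities J columns slots slots-unique slots-complete idx sgn active base using (cap; budget)

    ds : Stacks 12
    ds = layout x oₗ Wₗ vₗ wₗ eₗ Pₗ Jₗ Mₗ pₗ lₗ tₗ

    slotCap : ℕ → Fin g → Slot → Bool → List Bool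
    slotCap c α r s = encode (2 * clauseIndex c α r + 2 + larger s r)

    cellCaps : ℕ → List Bool
    cellCaps c = cat (allFin g) λ α → cat slots (λ r → slotCap c α r false ++ slotCap c α r true) ++ (encode (suc R) ++ encode (suc R))

    Fits : Maybe (List (Fin 13) × ℕ) → ℕ → ℕ → Stacks 13 → Set
    Fits (just (is , δ)) o c cs = o ≤ c × c ∸ o ≡ δ + total is cs
    Fits nothing         o c cs = c < o

    leq-no : ∀ {m n} → n < m → leq m n ≡ false
    leq-no {suc m} {zero}  _        = refl
    leq-no {suc m} {suc n} (s≤s lt) = leq-no lt

    slot-out : ∀ ph c α r s cs → length (lookup cs n9) ≡ columns → Fits (ph (proj₁ (literal (kind (proj₁ r)) (proj₂ r)))) (shiftOf r) c cs →
      outLeaf (slotLeaf ph α r s) cs ≡ slotCap c α r s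
    slot-out ph c α r@(κ , l) s cs M-len fits = go (eqF α (letterOf r)) (ph (proj₁ (literal (kind κ) l))) fits
      where
      far : ∀ e → encode (2 + e + length (lookup cs n9) * 2) ≡ encode (2 * columns + 2 + e)
      far e = cong encode (trans (cong (λ y → 2 + e + y * 2) M-len) (shape e columns))
        where
        shape : ∀ e m → 2 + e + m * 2 ≡ 2 * m + 2 + e
        shape = solve-∀
      go : ∀ b m → Fits m (shiftOf r) c cs →
        outLeaf (slotLeaf′ b m (toℕ κ) (larger s r)) cs ≡ encode (2 * (if b ∧ leq (shiftOf r) c then C * (c ∸ shiftOf r) + toℕ κ else columns) + 2 + larger s r)
      go false m               f         = far (larger s r)
      go true  nothing         f         rewrite leq-no f = far (larger s r)
      go true  (just (is , δ)) (le , eq) rewrite ≤-leq le = trans (scaled-out is δ (2 * C) (2 * toℕ κ + 2 + larger s r) (c ∸ shiftOf r) cs eq)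
          (cong encode (shape C (c ∸ shiftOf r) (toℕ κ) (larger s r)))
        where
        shape : ∀ C p κ e → 2 * C * p + (2 * κ + 2 + e) ≡ 2 * (C * p + κ) + 2 + e
        shape = solve-∀

    cells-out : ∀ ph c cs → length (lookup cs n9) ≡ columns → (∀ o → Fits (ph o) (offset o) c cs) → outLeaves (cellLeaves ph) cs ≡ cellCaps c
    cells-out ph c cs M-len fits = trans (outLeaves-for (allFin g) _ cs) (cat-cong (allFin g) λ α →
      trans (outLeaves-++ (leavesFor slots₀ (λ r → slotLeaf ph α r false ∷ slotLeaf ph α r true ∷ [])) (bits (encode (suc R)) ∷ bits (encode (suc R)) ∷ []) cs)
        (cong₂ _++_ (trans (outLeaves-for slots₀ _ cs) (cat-cong slots₀ λ r → trans (two-leaves (slotLeaf ph α r false) (slotLeaf ph α r true) cs)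
            (cong₂ _++_ (slot-out ph c α r false cs M-len (fits _)) (slot-out ph c α r true cs M-len (fits _)))))
          (two-leaves (bits (encode (suc R))) (bits (encode (suc R))) cs)))

    clauseCaps : Spec → ℕ → List Bool
    clauseCaps s π = cat (allFin C) λ κ → encode (baseOf π (toℕ κ) + ind (not (activates s (kind κ)))) ++ encode (baseOf π (toℕ κ) + suc (ind (activates s (kind κ))))

    clauses-out : ∀ s is δ π cs → π ≡ δ + total is cs → outLeaves (clauseLeaves s (is , δ)) cs ≡ clauseCaps s π
    clauses-out s is δ π cs eq = trans (outLeaves-for (allFin C) _ cs) (cat-cong (allFin C) λ κ → trans (two-leaves (scaled (is , δ) (8 * C) (4 * (2 * toℕ κ + 1) + ind (not (activates s (kind κ))))) (scaled (is , δ) (8 * C) (4 * (2 * toℕ κ + 1) + suc (ind (activates s (kind κ))))) cs)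
      (cong₂ _++_ (trans (scaled-out is δ (8 * C) _ π cs eq) (cong encode (shape C π (toℕ κ) (ind (not (activates s (kind κ)))))))
        (trans (scaled-out is δ (8 * C) _ π cs eq) (cong encode (shape C π (toℕ κ) (suc (ind (activates s (kind κ)))))))))
      where
      shape : ∀ C π κ e → 8 * C * π + (4 * (2 * κ + 1) + e) ≡ 4 * (C * (2 * π) + (2 * κ + 1)) + e
      shape = solve-∀

    header-≡ : outTops headerTops ds ≡ encode (length vertices) ++ encode budget
    header-≡ = trans (Listₚ.++-identityʳ _) (trans (two-leaves (num ((n8 , 2 * R + 2) ∷ (n9 , 2) ∷ []) 2) (num ((n8 , suc (2 * R)) ∷ (n9 , 2) ∷ []) 1) ([] ∷ ds))
      (cong₂ _++_ (cong encode (trans (cong₂ (λ j m → 2 + j * (2 * R + 2) + m * 2) J-≡ M-≡) (sym (Encoding.length-vertices J columns slots))))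
        (cong encode (trans (cong₂ (λ j m → 1 + j * suc (2 * R) + m * 2) J-≡ M-≡) (shape J R columns)))))
      where
      shape : ∀ J R M → 1 + J * suc (2 * R) + M * 2 ≡ J * suc (2 * R) + suc (2 * M)
      shape = solve-∀

    cells-≡ : outTops cellTops ds ≡ cat (allFin J) (λ j → cat slots (λ r → encode (cap (slot j r false)) ++ encode (cap (slot j r true))) ++ (encode (cap (lit j false)) ++ encode (cap (lit j true))))
    cells-≡ = trans emitted (trans (sym (cong (λ ys → cellCaps 0 ++ (cellCaps 1 ++ ys)) (range-+ 2 (length vₗ) (length Pₗ) cellCaps)))
        (trans (sym (cong (λ n → range 0 n (λ i _ → cellCaps i)) cells-split)) (sym needed)))
      where
      cellCap : ℕ → Fin g → List Bool
      cellCap c α = cat slots (λ r → slotCap c α r false ++ slotCap c α r true) ++ (encode (suc R) ++ encode (suc R))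
      cells-split : cells ≡ 2 + (length vₗ + length Pₗ)
      cells-split = trans (+-comm clauses w) (cong₂ _+_ (sym v-≡) (sym P-≡))
      fits₀ : ∀ o → Fits (phase₀ o) (offset o) 0 ([] ∷ ds)
      fits₀ o0 = z≤n , refl
      fits₀ o1 = s≤s z≤n
      fits₀ o2 = s≤s z≤n
      fits₀ ow = s≤s z≤n
      1<w : 1 < w
      1<w = subst (1 <_) v-≡ (s≤s (s≤s z≤n))
      fits₁ : ∀ o → Fits (phase₁ o) (offset o) 1 ([] ∷ ds)
      fits₁ o0 = z≤n , refl
      fits₁ o1 = ≤-refl , refl
      fits₁ o2 = ≤-refl
      fits₁ ow = 1<w
      fits₂ : ∀ s xs → length s + suc (length xs) ≡ length vₗ → ∀ o → Fits (phase₂ o) (offset o) (2 + length s) (s ∷ (ds [ n3 ]≔ xs))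
      fits₂ s xs e o0 = z≤n , cong (λ y → 2 + y) (sym (+-identityʳ _))
      fits₂ s xs e o1 = s≤s z≤n , cong (λ y → 1 + y) (sym (+-identityʳ _))
      fits₂ s xs e o2 = s≤s (s≤s z≤n) , sym (+-identityʳ _)
      fits₂ s xs e ow = subst (2 + length s <_) v-≡ (s≤s (s≤s (subst (length s <_) e (m<m+n (length s) (s≤s z≤n)))))
      fits₃ : ∀ s xs o → Fits (phase₃ o) (offset o) (w + length s) (s ∷ (ds [ n6 ]≔ xs))
      fits₃ s xs o0 = z≤n , trans (cong (_+ length s) (sym v-≡)) (cong (λ y → 2 + (length vₗ + y)) (sym (+-identityʳ _)))
      fits₃ s xs o1 = s≤s z≤n , trans (cong (λ y → y + length s ∸ 1) (sym v-≡)) (cong (λ y → 1 + (length vₗ + y)) (sym (+-identityʳ _)))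
      fits₃ s xs o2 = ≤-trans 1<w (m≤m+n w _) , trans (cong (λ y → y + length s ∸ 2) (sym v-≡)) (cong (λ y → length vₗ + y) (sym (+-identityʳ _)))
      fits₃ s xs ow = m≤m+n w _ , trans (m+n∸m≡n w (length s)) (sym (+-identityʳ _))
      third : outTop (for n3 (λ _ → cellLeaves phase₂)) ds ≡ range 2 (length vₗ) (λ i _ → cellCaps i)
      third = trans (outFor-range (λ _ → cellLeaves phase₂) ds n3 (λ i _ → cellCaps (2 + i)) (length vₗ) (λ b s xs e → cells-out phase₂ (2 + length s) (s ∷ (ds [ n3 ]≔ xs)) M-≡ (fits₂ s xs e)) [] vₗ refl)
        (range-shift 0 2 (length vₗ) cellCaps)
      fourth : outTop (for n6 (λ _ → cellLeaves phase₃)) ds ≡ range (2 + length vₗ) (length Pₗ) (λ i _ → cellCaps i)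
      fourth = trans (outFor-range (λ _ → cellLeaves phase₃) ds n6 (λ i _ → cellCaps (w + i)) (length Pₗ) (λ b s xs e → cells-out phase₃ (w + length s) (s ∷ (ds [ n6 ]≔ xs)) M-≡ (fits₃ s xs)) [] Pₗ refl)
        (trans (range-shift 0 w (length Pₗ) cellCaps) (cong (λ k → range k (length Pₗ) (λ i _ → cellCaps i)) (trans (+-identityʳ w) (sym v-≡))))
      emitted : outTops cellTops ds ≡ cellCaps 0 ++ (cellCaps 1 ++ (range 2 (length vₗ) (λ i _ → cellCaps i) ++ range (2 + length vₗ) (length Pₗ) (λ i _ → cellCaps i)))
      emitted = cong₂ _++_ (cells-out phase₀ 0 ([] ∷ ds) M-≡ fits₀) (cong₂ _++_ (cells-out phase₁ 1 ([] ∷ ds) M-≡ fits₁) (cong₂ _++_ third (trans (Listₚ.++-identityʳ _) fourth)))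
      needed : cat (allFin J) (λ j → cat slots (λ r → encode (cap (slot j r false)) ++ encode (cap (slot j r true))) ++ (encode (cap (lit j false)) ++ encode (cap (lit j true)))) ≡ range 0 cells (λ i _ → cellCaps i)
      needed = trans (cat-combine cells g _) (trans (cat-cong (allFin cells) (λ c → cat-cong (allFin g) (λ α → cong (λ p → cellCap (toℕ (proj₁ p)) (proj₂ p)) (Finₚ.remQuot-combine c α))))
        (cat-range cells 0 (λ i _ → cellCaps i) _ (λ _ → refl)))

    open Widths M a d a′ d′ x

    n : ℕ
    n = length x

    head₀ : Tableau.Γ M
    head₀ = nothing , just nothing

    -- The position of the first of the two cells that encode input bit k.
    bitPosition : ℕ → ℕ
    bitPosition k = suc (off + (k + k))

    bitPosition-suc : ∀ k → bitPosition (suc k) ≡ suc (suc (bitPosition k))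
    bitPosition-suc k = cong ℕ.suc (trans (+-suc off (k + suc k)) (cong ℕ.suc (trans (cong (λ y → off + y) (+-suc k k)) (+-suc off (k + k)))))

    bitLeaves : Bool → List (Leaf 13)
    bitLeaves b = clauseLeaves (fixed (bitCell b)) (n2 ∷ n0 ∷ n0 ∷ [] , 1) ++ clauseLeaves (fixed (bitCell b)) (n2 ∷ n0 ∷ n0 ∷ [] , 2)

    -- Generalised over the bits `s` already read. The positions of the closing bits depend only on
    -- the total length, which does not change along the induction.
    bits-out : ∀ s xs → outFor bitLeaves ds n0 s xs ++
        (clauseCaps (fixed (bitCell false)) (bitPosition (length s + length xs)) ++ clauseCaps (fixed (bitCell true)) (suc (bitPosition (length s + length xs)))) ≡
      indexed (bitPosition (length s)) (map fixed (map bitCell (pairEnc xs []))) clauseCaps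
    bits-out s [] rewrite +-identityʳ (length s) = cong (clauseCaps (fixed (bitCell false)) (bitPosition (length s)) ++_) (sym (Listₚ.++-identityʳ _))
    bits-out s (b ∷ xs) = trans (Listₚ.++-assoc (outLeaves (bitLeaves b) cs) _ _) (trans (cong₂ _++_ (trans (outLeaves-++ (clauseLeaves (fixed (bitCell b)) (n2 ∷ n0 ∷ n0 ∷ [] , 1)) _ cs)
          (cong₂ _++_ (clauses-out (fixed (bitCell b)) (n2 ∷ n0 ∷ n0 ∷ []) 1 (bitPosition (length s)) cs (at-bit 1))
            (clauses-out (fixed (bitCell b)) (n2 ∷ n0 ∷ n0 ∷ []) 2 (suc (bitPosition (length s))) cs (at-bit 2))))
        (trans (cong (λ k → outFor bitLeaves ds n0 (b ∷ s) xs ++ (clauseCaps (fixed (bitCell false)) (bitPosition k) ++ clauseCaps (fixed (bitCell true)) (suc (bitPosition k)))) (+-suc (length s) (length xs)))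
          (trans (bits-out (b ∷ s) xs) (cong (λ k → indexed k (map fixed (map bitCell (pairEnc xs []))) clauseCaps) (bitPosition-suc (length s))))))
      (Listₚ.++-assoc (clauseCaps (fixed (bitCell b)) (bitPosition (length s))) _ _))
      where
      cs = s ∷ (ds [ n0 ]≔ xs)
      at-bit : ∀ k → k + (off + (length s + length s)) ≡ k + (length oₗ + (length s + (length s + 0)))
      at-bit k = cong₂ (λ o y → k + (o + (length s + y))) (sym o-≡) (sym (+-identityʳ (length s)))

    length-specs : length specs ≡ clauses
    length-specs = trans (Listₚ.length-++ firstRow) (cong₂ _+_ (length-firstRow width-≡ refl) (trans (Listₚ.length-++ (replicate (T′ * w) middle))
      (trans (cong₂ _+_ (Listₚ.length-replicate (T′ * w)) (Listₚ.length-replicate w)) (+-comm (T′ * w) w))))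

    first-≡ : indexed 0 firstRow clauseCaps ≡ (range 0 off (λ i _ → clauseCaps (fixed blank₀) i) ++ (clauseCaps (fixed head₀) off ++
      indexed (bitPosition 0) (map fixed (map bitCell (pairEnc x []))) clauseCaps)) ++ (range q W (λ i _ → clauseCaps guess i) ++ (clauseCaps (fixed blank₀) (q + W) ++ []))
    first-≡ = trans (indexed-++ 0 (map fixed (row (pairEnc x []))) (replicate W guess ++ fixed blank₀ ∷ []) clauseCaps) (cong₂ _++_
      (trans (cong (λ ys → indexed 0 ys clauseCaps) (trans (Listₚ.map-++ fixed (replicate off blank₀) (head₀ ∷ map bitCell (pairEnc x []))) (cong (_++ (fixed head₀ ∷ map fixed (map bitCell (pairEnc x [])))) (Listₚ.map-replicate fixed off blank₀))))
        (trans (trans (indexed-++ 0 (replicate off (fixed blank₀)) _ clauseCaps) (cong₂ _++_ (indexed-replicate 0 off (fixed blank₀) clauseCaps)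
          (cong (λ k → clauseCaps (fixed head₀) k ++ indexed (suc k) (map fixed (map bitCell (pairEnc x []))) clauseCaps) (Listₚ.length-replicate off))))
          (cong (λ k → range 0 off (λ i _ → clauseCaps (fixed blank₀) i) ++ (clauseCaps (fixed head₀) off ++ indexed k (map fixed (map bitCell (pairEnc x []))) clauseCaps)) (cong ℕ.suc (sym (+-identityʳ off))))))
      (trans (cong (λ k → indexed k (replicate W guess ++ fixed blank₀ ∷ []) clauseCaps) (Listₚ.length-map fixed (row (pairEnc x []))))
        (trans (indexed-++ q (replicate W guess) (fixed blank₀ ∷ []) clauseCaps) (cong₂ _++_ (indexed-replicate q W guess clauseCaps)
          (cong (λ k → clauseCaps (fixed blank₀) (q + k) ++ []) (Listₚ.length-replicate W))))))

    specs-≡ : indexed 0 specs clauseCaps ≡ indexed 0 firstRow clauseCaps ++ (range w (T′ * w) (λ i _ → clauseCaps middle i) ++ range (w + T′ * w) w (λ i _ → clauseCaps last i))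
    specs-≡ = trans (indexed-++ 0 firstRow _ clauseCaps) (cong (indexed 0 firstRow clauseCaps ++_) (trans (cong (λ k → indexed k (replicate (T′ * w) middle ++ replicate w last) clauseCaps) (length-firstRow width-≡ refl))
      (trans (indexed-++ w (replicate (T′ * w) middle) (replicate w last) clauseCaps) (cong₂ _++_ (indexed-replicate w (T′ * w) middle clauseCaps)
        (trans (cong (λ k → indexed (w + k) (replicate w last) clauseCaps) (Listₚ.length-replicate (T′ * w))) (indexed-replicate (w + T′ * w) w last clauseCaps))))))

    loop-out : ∀ r s is δ p N → length (lookup ds r) ≡ N → (∀ u xs → p + length u ≡ δ + total is (u ∷ (ds [ r ]≔ xs))) →
      outTop (for r (λ _ → clauseLeaves s (is , δ))) ds ≡ range p N (λ i _ → clauseCaps s i)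
    loop-out r s is δ p N len eq = trans (outFor-range (λ _ → clauseLeaves s (is , δ)) ds r (λ i _ → clauseCaps s (p + i)) (length (lookup ds r))
        (λ b u xs _ → clauses-out s is δ (p + length u) (u ∷ (ds [ r ]≔ xs)) (eq u xs)) [] (lookup ds r) refl)
      (trans (range-shift 0 p (length (lookup ds r)) (clauseCaps s)) (cong₂ (λ k l → range k l (λ i _ → clauseCaps s i)) (+-identityʳ p) len))

    clauses-≡ : outTops clauseTops ds ≡ cat (allFin columns) (λ m → encode (cap (col m false)) ++ encode (cap (col m true)))
    clauses-≡ = trans (cong₂ _++_ (loop-out n1 (fixed blank₀) (n0 ∷ []) 0 0 off o-≡ (λ u _ → sym (+-identityʳ (length u))))
        (cong₂ _++_ (clauses-out (fixed head₀) (n2 ∷ []) 0 off ([] ∷ ds) (trans (sym o-≡) (sym (+-identityʳ (length oₗ)))))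
        (cong (outFor bitLeaves ds n0 [] x ++_)
        (cong₂ _++_ (trans (outLeaves-++ (clauseLeaves (fixed (bitCell false)) (n2 ∷ n1 ∷ n1 ∷ [] , 1)) _ ([] ∷ ds))
            (cong₂ _++_ (clauses-out (fixed (bitCell false)) (n2 ∷ n1 ∷ n1 ∷ []) 1 (bitPosition n) ([] ∷ ds) (after-bits 1))
              (clauses-out (fixed (bitCell true)) (n2 ∷ n1 ∷ n1 ∷ []) 2 (suc (bitPosition n)) ([] ∷ ds) (after-bits 2))))
        (cong₂ _++_ (loop-out n2 guess (n2 ∷ n1 ∷ n1 ∷ n0 ∷ []) 3 q W W-≡ (λ u _ → in-guesses (length u)))
        (cong₂ _++_ (clauses-out (fixed blank₀) (n2 ∷ n1 ∷ n1 ∷ n3 ∷ []) 3 (q + W) ([] ∷ ds) (trans (cong (λ y → q + y) (sym W-≡)) (in-guesses (length Wₗ))))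
        (cong₂ _++_ (loop-out n5 middle (n4 ∷ n0 ∷ []) 2 w (T′ * w) E-≡ (λ u _ → trans (cong (_+ length u) (sym v-≡)) (cong (λ y → 2 + (length vₗ + y)) (sym (+-identityʳ (length u))))))
        (cong (_++ []) (loop-out n4 last (n4 ∷ n6 ∷ n0 ∷ []) 2 (w + T′ * w) w wₗ-≡ (λ u _ → in-last (length u))))))))))) 
      (trans (assemble (range 0 off (λ i _ → clauseCaps (fixed blank₀) i)) (clauseCaps (fixed head₀) off) (outFor bitLeaves ds n0 [] x)
          (clauseCaps (fixed (bitCell false)) (bitPosition n) ++ clauseCaps (fixed (bitCell true)) (suc (bitPosition n)))
          (range q W (λ i _ → clauseCaps guess i)) (clauseCaps (fixed blank₀) (q + W)) (range w (T′ * w) (λ i _ → clauseCaps middle i)) (range (w + T′ * w) w (λ i _ → clauseCaps last i))) (trans (cong (λ ys → ((range 0 off (λ i _ → clauseCaps (fixed blank₀) i) ++ (clauseCaps (fixed head₀) off ++ ys)) ++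
          (range q W (λ i _ → clauseCaps guess i) ++ (clauseCaps (fixed blank₀) (q + W) ++ []))) ++ (range w (T′ * w) (λ i _ → clauseCaps middle i) ++ range (w + T′ * w) w (λ i _ → clauseCaps last i))) (bits-out [] x))
        (trans (cong (_++ (range w (T′ * w) (λ i _ → clauseCaps middle i) ++ range (w + T′ * w) w (λ i _ → clauseCaps last i))) (sym first-≡)) (trans (sym specs-≡) (sym needed)))))
      where
      assemble : ∀ (r h b e g p m l : List Bool) → r ++ (h ++ (b ++ (e ++ (g ++ (p ++ (m ++ (l ++ []))))))) ≡ ((r ++ (h ++ (b ++ e))) ++ (g ++ (p ++ []))) ++ (m ++ l)
      assemble r h b e g p m l = solve (Listₚ.++-monoid Bool)
      after-bits : ∀ k → k + (off + (n + n)) ≡ k + (length oₗ + (n + (n + 0)))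
      after-bits k = cong₂ (λ o y → k + (o + (n + y))) (sym o-≡) (sym (+-identityʳ n))
      in-guesses : ∀ u → q + u ≡ 3 + (length oₗ + (n + (n + (u + 0))))
      in-guesses u = trans (cong (_+ u) q-≡) (trans (shape off n u) (cong (λ o → 3 + (o + (n + (n + (u + 0))))) (sym o-≡)))
        where
        shape : ∀ o n u → o + suc (2 * n + 2) + u ≡ 3 + (o + (n + (n + (u + 0))))
        shape = solve-∀
      in-last : ∀ u → w + T′ * w + u ≡ 2 + (length vₗ + (length eₗ + (u + 0)))
      in-last u = trans (cong₂ (λ a b → a + b + u) (sym v-≡) (sym E-≡)) (shape (length vₗ) (length eₗ) u)
        where
        shape : ∀ v e u → 2 + v + e + u ≡ 2 + (v + (e + (u + 0)))
        shape = solve-∀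
      columnCaps : Fin clauses × Fin C → List Bool
      columnCaps (π , κ) = encode (baseOf (toℕ π) (toℕ κ) + ind (not (activates (specAt (toℕ π)) (kind κ)))) ++ encode (baseOf (toℕ π) (toℕ κ) + suc (ind (activates (specAt (toℕ π)) (kind κ))))
      needed : cat (allFin columns) (λ m → encode (cap (col m false)) ++ encode (cap (col m true))) ≡ indexed 0 specs clauseCaps
      needed = trans (cat-combine clauses C _) (trans (cat-cong (allFin clauses) (λ π → cat-cong (allFin C) (λ κ → cong columnCaps (Finₚ.remQuot-combine π κ))))
        (cat-indexed middle clauses 0 specs clauseCaps length-specs))

    hubs-≡ : outTops hubTops ds ≡ encode (cap slotHub) ++ encode (cap columnHub)
    hubs-≡ = trans (Listₚ.++-identityʳ _) (two-leaves (bits (encode 1)) (bits (encode 0)) ([] ∷ ds))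

    open Encoding J columns slots using (slotRow; litRow; columnRow; slotHubRow; columnHubRow; gadgetRows; row-of; rows-≡; cat-vertices; encode-≡)

    slotRow-out : ∀ σ s xs → outLeaves (slotRowLeaves σ) (s ∷ (ds [ n7 ]≔ xs)) ≡ slotRow σ (length s) (length xs)
    slotRow-out σ s xs = cong (λ m → concat (replicate (length s) zeros) ++ (ownSlot σ ++ (concat (replicate (length xs) zeros) ++ (concat (replicate m (pairOf true true)) ++ pairOf false true)))) M-≡

    litRow-out : ∀ σ s xs → outLeaves (litRowLeaves σ) (s ∷ (ds [ n7 ]≔ xs)) ≡ litRow σ (length s) (length xs)
    litRow-out σ s xs = cong (λ m → concat (replicate (length s) zeros) ++ (ownLit σ ++ (concat (replicate (length xs) zeros) ++ (concat (replicate m (pairOf false false)) ++ pairOf false false)))) M-≡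

    columnRow-out : ∀ s xs → outLeaves columnRowLeaves (s ∷ (ds [ n8 ]≔ xs)) ≡ columnRow (length s) (length xs)
    columnRow-out s xs = cong (λ j → concat (replicate j full) ++ (concat (replicate (length s) (pairOf false false)) ++ (pairOf false false ++ (concat (replicate (length xs) (pairOf false false)) ++ pairOf true false)))) J-≡

    gadget-out : ∀ s xs → outLeaves (leavesFor slots₀ (λ _ → slotRowLeaves false ++ slotRowLeaves true) ++ (litRowLeaves false ++ litRowLeaves true)) (s ∷ (ds [ n7 ]≔ xs)) ≡ gadgetRows (length s) (length xs)
    gadget-out s xs = trans (outLeaves-++ (leavesFor slots₀ (λ _ → slotRowLeaves false ++ slotRowLeaves true)) _ cs) (cong₂ _++_
      (trans (outLeaves-for slots₀ _ cs) (cat-cong slots₀ λ _ → trans (outLeaves-++ (slotRowLeaves false) (slotRowLeaves true) cs) (cong₂ _++_ (slotRow-out false s xs) (slotRow-out true s xs))))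
      (trans (outLeaves-++ (litRowLeaves false) (litRowLeaves true) cs) (cong₂ _++_ (litRow-out false s xs) (litRow-out true s xs))))
      where cs = s ∷ (ds [ n7 ]≔ xs)

    matrix-≡ : outTops rowTops ds ≡ cat vertices row-of
    matrix-≡ = trans (cong₂ _++_
        (trans (outFor-range _ ds n7 gadgetRows (length Jₗ) (λ _ s xs _ → gadget-out s xs) [] Jₗ refl) (cong (λ j → range 0 j gadgetRows) J-≡))
        (cong₂ _++_ (trans (outFor-range _ ds n8 (λ i r → columnRow i r ++ columnRow i r) (length Mₗ) (λ _ s xs _ → trans (outLeaves-++ columnRowLeaves columnRowLeaves (s ∷ (ds [ n8 ]≔ xs)))
            (cong₂ _++_ (columnRow-out s xs) (columnRow-out s xs))) [] Mₗ refl) (cong (λ m → range 0 m (λ i r → columnRow i r ++ columnRow i r)) M-≡))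
          (cong₂ _++_ (cong₂ (λ j m → concat (replicate j zeros) ++ (concat (replicate m (pairOf true true)) ++ pairOf false true)) J-≡ M-≡)
            (trans (Listₚ.++-identityʳ _) (cong₂ (λ j m → concat (replicate j full) ++ (concat (replicate m (pairOf false false)) ++ pairOf true false)) J-≡ M-≡)))))
      (sym rows-≡)

    evaluates : evaluate preparation program x ≡ encCVC (instance′ cap budget)
    evaluates = trans (cong (outTops program) state-≡) (trans (outTops-++ headerTops (cellTops ++ (clauseTops ++ (hubTops ++ rowTops))) ds) (trans (cong₂ _++_ header-≡ (trans (outTops-++ cellTops (clauseTops ++ (hubTops ++ rowTops)) ds) (cong₂ _++_ cells-≡
        (trans (outTops-++ clauseTops (hubTops ++ rowTops) ds) (cong₂ _++_ clauses-≡ (trans (outTops-++ hubTops rowTops ds) (cong₂ _++_ hubs-≡ matrix-≡)))))))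
      (trans (assemble (encode (length vertices)) (encode budget) (cat (allFin J) (λ j → cat slots (λ r → encode (cap (slot j r false)) ++ encode (cap (slot j r true))) ++ (encode (cap (lit j false)) ++ encode (cap (lit j true)))))
          (cat (allFin columns) (λ m → encode (cap (col m false)) ++ encode (cap (col m true)))) (encode (cap slotHub) ++ encode (cap columnHub)) (cat vertices row-of)) (trans (cong (λ ys → encode (length vertices) ++ (encode budget ++ (ys ++ cat vertices row-of))) (sym (cat-vertices (encode ∘ cap)))) (sym (encode-≡ cap budget))))))
      where
      assemble : ∀ (n k ce cl hu ro : List Bool) → (n ++ k) ++ (ce ++ (cl ++ (hu ++ ro))) ≡ n ++ (k ++ ((ce ++ (cl ++ hu)) ++ ro))
      assemble n k ce cl hu ro = solve (Listₚ.++-monoid Bool)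

theorem6p1 : NPHardOn CVCInstance encCVC CVCYes (λ I → LinCWAtMost 6 (CVCInstance.G I))
theorem6p1 L (V , (χ , (M , a′ , d′ , runs) , V⇔χ) , a , d , L⇔V) =
  evaluate preparation program , evaluate-polytime preparation program , λ x →
    instanceOf x , Emission.Correct.evaluates M a d a′ d′ x (prepared x) , narrow x , yes⇔L x
  where
  open Counters M a d a′ d′ using (preparation; prepared)
  open Emission M a d a′ d′ using (program)
  open Reduction {L} {V} χ M a′ d′ runs V⇔χ a d L⇔V using (instanceOf; narrow; yes⇔L)
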